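{- Let $L\ge 3$ be an integer and let $\mathcal{D}_L=[0,L]\times[0,2]$. Then the even domino group $G_{\mathcal{D}_L}^+$ is isomorphic to the group $$G_L^+=\langle S_L \mid [a_m,a_n]=1 \text{ for } (m,n)\in R_L\rangle,$$ where $S_L=\{a_i : i\in\mathbb{Z}_{\ne0},\ |i|\le\lfloor\frac{L-1}{2}\rfloor\}$ is a set of symbols and $R_L=\{(m,n)\in\mathbb{Z}^2 : \max\{|m|,|n|,|m-n|\}<\lfloor\frac{L}{2}\rfloor\}$.
   Context: In the presentation of $G_L^+$, $[x,y]$ denotes the commutator, and $a_0$ is understood as the identity, so that pairs $(m,n)\in R_L$ with $m=0$ or $n=0$ impose no relation. A quadriculated disk $\mathcal{D}\subset\mathbb{R}^2$ is a finite union of closed unit squares with vertices in $\mathbb{Z}^2$ that is homeomorphic to a closed disk. The unit square $[a,a+1]\times[b,b+1]$, $(a,b)\in\mathbb{Z}^2$, is white if $a+b$ is even and black if $a+b$ is odd. Two unit squares are adjacent if they share an edge; a planar domino is a union of two adjacent unit squares. Domino group. A plug is a union $p\subseteq\mathcal{D}$ of unit squares of $\mathcal{D}$ with equally many white and black squares; $\mathbf{p}_\circ=\emptyset$ is the empty plug. Two plugs are disjoint if their interiors are disjoint. The 2-complex $\mathcal{C}_{\mathcal{D}}$ is defined as follows. - Vertices: the plugs. - Edges: for every two distinct disjoint plugs $p_1,p_2$, one edge between $p_1$ and $p_2$ for each planar domino tiling of $\mathcal{D}\smallsetminus\mathrm{int}(p_1\cup p_2)$ (the empty region has exactly one tiling,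 the empty one); also one loop at $\mathbf{p}_\circ$ for each planar domino tiling of $\mathcal{D}$. - 2-cells: (i) for each loop $f$, a disk attached along $f*f$ (so that a projective plane results); (ii) for each two edges joining the same two distinct plugs whose tilings differ by a single planar flip (replacing two parallel dominoes forming a $2\times2$ square by the other two), a disk attached along the resulting bigon; (iii) for each four plugs $p_1,p_2,p_3,p_4$ with $p_2$ disjoint from $p_1$ and from $p_4$, and $p_2=p_3\cup d$ where $d$ is a domino whose two unit squares are not in $p_3$, and for each tiling $f_1^*$ of $\mathcal{D}\smallsetminus\mathrm{int}(p_1\cup p_2)$ and each tiling $f_2^*$ of $\mathcal{D}\smallsetminus\mathrm{int}(p_2\cup p_4)$, a disk attached along the quadrilateral $p_1\to p_2\to p_4\to p_3\to p_1$ with edges $f_1^*$, $f_2^*$, $f_2^*\cup\{d\}$, $f_1^*\cup\{d\}$. The domino group is $G_{\mathcal{D}}=\pi_1(\mathcal{C}_{\mathcal{D}},\mathbf{p}_\circ)$. The even domino group $G_{\mathcal{D}}^+$ is the kernel of the homomorphism $G_{\mathcal{D}}\to\mathbb{Z}/(2)$ sending a closed edge path of length $N$ to $N \bmod 2$. -}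

module Defs where

open import Level using (Level; 0ℓ; _⊔_)
open import Algebra.Bundles using (Group)
open import Algebra.Morphism.Structures using (module GroupMorphisms)
import Algebra.Properties.Group as GroupProperties
open import Data.Empty using (⊥-elim-irr)
open import Data.Fin.Base using (Fin; toℕ; remQuot; combine)
open import Data.Fin.Properties using (toℕ-injective; combine-remQuot)
open import Data.Fin.Subset using (Subset; _∈_; _∉_; _∪_; _∩_; ∁; ⊤; ⊥; ⁅_⁆; Empty)
  renaming (∣_∣ to size)
open import Data.Fin.Subset.Properties using (∪-comm; ∩-comm; ∩-zeroˡ)
open import Data.Integer.Base as ℤ using (ℤ; +_; ∣_∣; 0ℤ; 1ℤ)
import Data.Integer.Properties as ℤ
open import Data.Nat.Base as ℕ using (ℕ; suc; parity; ⌊_/2⌋)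
open import Data.Nat.Divisibility using (_∣?_)
open import Data.Parity.Base as ℙ using (Parity; 0ℙ; 1ℙ)
import Data.Parity.Properties as ℙ
open import Data.Product.Base using (Σ; ∃; _×_; _,_; proj₁; proj₂; uncurry)
open import Data.Sign.Base using (Sign; opposite) renaming (+ to s+; - to s-)
open import Data.Sign.Properties using (opposite-involutive; s≢opposite[s])
open import Data.Vec.Base using (Vec; tabulate; lookup; _[_]≔_)
open import Relation.Binary.Core using (Rel)
open import Relation.Binary.Construct.Closure.ReflexiveTransitive
  using (Star; ε; _◅_; _◅◅_; reverse; revApp)
open import Relation.Binary.Construct.Closure.ReflexiveTransitive.Properties
  using (◅◅-assoc)
open import Relation.Binary.PropositionalEquality
  using (_≡_; _≢_; refl; sym; trans; cong; cong₂; subst; module ≡-Reasoning)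
open import Relation.Nullary.Decidable using (does)

private variable
  c₁ ℓ₁ c₂ ℓ₂ : Level

_≅_ : Group c₁ ℓ₁ → Group c₂ ℓ₂ → Set (c₁ ⊔ ℓ₁ ⊔ c₂ ⊔ ℓ₂)
G ≅ H = ∃ λ f → IsGroupIsomorphism f
  where open GroupMorphisms (Group.rawGroup G) (Group.rawGroup H)

module _ (G : Group c₁ ℓ₁) (H : Group c₂ ℓ₂) where
  private
    module G = Group G
    module H = Group H
  open GroupMorphisms G.rawGroup H.rawGroup

  kernel : ∀ f → IsGroupHomomorphism f → Group (c₁ ⊔ ℓ₂) ℓ₁
  kernel f f-hom = record
    { Carrier = Σ G.Carrier λ x → f x H.≈ H.ε
    ; _≈_     = λ x y → proj₁ x G.≈ proj₁ y
    ; _∙_     = λ (x , fx≈ε) (y , fy≈ε) → x G.∙ y ,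
        H.trans (homo x y) (H.trans (H.∙-cong fx≈ε fy≈ε) (H.identityˡ H.ε))
    ; ε       = G.ε , ε-homo
    ; _⁻¹     = λ (x , fx≈ε) → x G.⁻¹ ,
        H.trans (⁻¹-homo x) (H.trans (H.⁻¹-cong fx≈ε) (GroupProperties.ε⁻¹≈ε H))
    ; isGroup = record
      { isMonoid = record
        { isSemigroup = record
          { isMagma = record
            { isEquivalence = record
                { refl = G.refl ; sym = G.sym ; trans = G.trans }
            ; ∙-cong = G.∙-cong }
          ; assoc = λ x y z → G.assoc (proj₁ x) (proj₁ y) (proj₁ z) }
        ; identity = (λ x → G.identityˡ (proj₁ x)) , (λ x → G.identityʳ (proj₁ x)) }
      ; inverse = (λ x → G.inverseˡ (proj₁ x)) , (λ x → G.inverseʳ (proj₁ x))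
      ; ⁻¹-cong = G.⁻¹-cong }
    }
    where open IsGroupHomomorphism f-hom

-- Group words over S are formal terms; the group laws are imposed by _⊢_≈_.

infixl 7 _∙_
infix  8 _⁻¹

data Word (S : Set) : Set where
  gen : S → Word S
  one : Word S
  _∙_ : Word S → Word S → Word S
  _⁻¹ : Word S → Word S

[_,_] : ∀ {S} → Word S → Word S → Word S
[ x , y ] = x ∙ y ∙ x ⁻¹ ∙ y ⁻¹

infix 4 _⊢_≈_

data _⊢_≈_ {S : Set} (R : Rel (Word S) 0ℓ) : Rel (Word S) 0ℓ where
  relation  : ∀ {x y} → R x y → R ⊢ x ≈ y
  ≈-refl    : ∀ {x} → R ⊢ x ≈ x
  ≈-sym     : ∀ {x y} → R ⊢ x ≈ y → R ⊢ y ≈ x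
  ≈-trans   : ∀ {x y z} → R ⊢ x ≈ y → R ⊢ y ≈ z → R ⊢ x ≈ z
  ∙-cong    : ∀ {x y u v} → R ⊢ x ≈ y → R ⊢ u ≈ v → R ⊢ x ∙ u ≈ y ∙ v
  ⁻¹-cong   : ∀ {x y} → R ⊢ x ≈ y → R ⊢ x ⁻¹ ≈ y ⁻¹
  assoc     : ∀ x y z → R ⊢ (x ∙ y) ∙ z ≈ x ∙ (y ∙ z)
  identityˡ : ∀ x → R ⊢ one ∙ x ≈ x
  identityʳ : ∀ x → R ⊢ x ∙ one ≈ x
  inverseˡ  : ∀ x → R ⊢ x ⁻¹ ∙ x ≈ one
  inverseʳ  : ∀ x → R ⊢ x ∙ x ⁻¹ ≈ one

⟨_∣_⟩ : (S : Set) → Rel (Word S) 0ℓ → Group 0ℓ 0ℓ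
⟨ S ∣ R ⟩ = record
  { Carrier = Word S ; _≈_ = R ⊢_≈_ ; _∙_ = _∙_ ; ε = one ; _⁻¹ = _⁻¹
  ; isGroup = record
    { isMonoid = record
      { isSemigroup = record
        { isMagma = record
          { isEquivalence = record { refl = ≈-refl ; sym = ≈-sym ; trans = ≈-trans }
          ; ∙-cong = ∙-cong }
        ; assoc = assoc }
      ; identity = identityˡ , identityʳ }
    ; inverse = inverseˡ , inverseʳ
    ; ⁻¹-cong = ⁻¹-cong }
  }

-- The 1-skeleton is a graph in the sense of Serre: Edge consists of oriented
-- edges, so each geometric edge contributes an orbit {e , rev e} of size two
-- (also when it is a loop).  Cell γ is the type of 2-cells attached along the
-- closed edge path γ.

record TwoComplex : Set₁ where
  field
    Vertex : Set
    Edge   : Rel Vertex 0ℓ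
    rev    : ∀ {u v} → Edge u v → Edge v u
    rev-involutive : ∀ {u v} (e : Edge u v) → rev (rev e) ≡ e
    rev-fixfree    : ∀ {v} (e : Edge v v) → rev e ≢ e
    Cell   : ∀ {v} → Star Edge v v → Set

pathLength : ∀ {V : Set} {E : Rel V 0ℓ} {u v} → Star E u v → ℕ
pathLength ε       = 0
pathLength (_ ◅ p) = suc (pathLength p)

module _ (K : TwoComplex) where
  open TwoComplex K

  Path : Rel Vertex 0ℓ
  Path = Star Edge

  revPath : ∀ {u v} → Path u v → Path v u
  revPath = reverse rev

  infix 4 _≃_

  -- Edge paths up to homotopy relative to the end points.  As _≃_ is a
  -- congruence, contracting the boundary of a cell from one base point also
  -- contracts all its rotations, and its inverse.

  data _≃_ : ∀ {u v} → Rel (Path u v) 0ℓ where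
    backtrack : ∀ {u v} (e : Edge u v) → e ◅ rev e ◅ ε ≃ ε
    cell      : ∀ {v} {γ : Path v v} → Cell γ → γ ≃ ε
    ≃-refl    : ∀ {u v} {p : Path u v} → p ≃ p
    ≃-sym     : ∀ {u v} {p q : Path u v} → p ≃ q → q ≃ p
    ≃-trans   : ∀ {u v} {p q r : Path u v} → p ≃ q → q ≃ r → p ≃ r
    ◅◅-cong   : ∀ {u v w} {p q : Path u v} {r s : Path v w} →
                p ≃ q → r ≃ s → p ◅◅ r ≃ q ◅◅ s

  private
    ≡⇒≃ : ∀ {u v} {p q : Path u v} → p ≡ q → p ≃ q
    ≡⇒≃ refl = ≃-refl

    ◅◅-identityʳ : ∀ {u v} (p : Path u v) → p ◅◅ ε ≡ p
    ◅◅-identityʳ ε       = refl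
    ◅◅-identityʳ (e ◅ p) = cong (e ◅_) (◅◅-identityʳ p)

    revApp-◅◅ : ∀ {u v w} (p : Path v u) (q : Path v w) →
                revApp rev p q ≡ revPath p ◅◅ q
    revApp-◅◅ ε       q = refl
    revApp-◅◅ (e ◅ p) q = begin
      revApp rev p (rev e ◅ q)             ≡⟨ revApp-◅◅ p (rev e ◅ q) ⟩
      revPath p ◅◅ (rev e ◅ ε) ◅◅ q        ≡⟨ ◅◅-assoc (revPath p) (rev e ◅ ε) q ⟨
      (revPath p ◅◅ rev e ◅ ε) ◅◅ q        ≡⟨ cong (_◅◅ q) (revApp-◅◅ p (rev e ◅ ε)) ⟨
      revPath (e ◅ p) ◅◅ q                 ∎
      where open ≡-Reasoning

    revPath-◅ : ∀ {u v w} (e : Edge u v) (p : Path v w) →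
                revPath (e ◅ p) ≡ revPath p ◅◅ rev e ◅ ε
    revPath-◅ e p = revApp-◅◅ p (rev e ◅ ε)

    backtrackˡ : ∀ {u v} (e : Edge u v) → rev e ◅ e ◅ ε ≃ ε
    backtrackˡ e =
      subst (λ e′ → rev e ◅ e′ ◅ ε ≃ ε) (rev-involutive e) (backtrack (rev e))

    revPath-inverseʳ : ∀ {u v} (p : Path u v) → p ◅◅ revPath p ≃ ε
    revPath-inverseʳ ε       = ≃-refl
    revPath-inverseʳ (e ◅ p) =
      ≃-trans (≡⇒≃ (trans (cong (λ q → e ◅ p ◅◅ q) (revPath-◅ e p))
                          (cong (e ◅_) (sym (◅◅-assoc p (revPath p) (rev e ◅ ε))))))
      (≃-trans (◅◅-cong (≃-refl {p = e ◅ ε})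
                 (◅◅-cong (revPath-inverseʳ p) (≃-refl {p = rev e ◅ ε})))
               (backtrack e))

    revPath-inverseˡ : ∀ {u v} (p : Path u v) → revPath p ◅◅ p ≃ ε
    revPath-inverseˡ ε       = ≃-refl
    revPath-inverseˡ (e ◅ p) =
      ≃-trans (≡⇒≃ (trans (cong (_◅◅ (e ◅ p)) (revPath-◅ e p))
                          (◅◅-assoc (revPath p) (rev e ◅ ε) (e ◅ p))))
      (≃-trans (◅◅-cong (≃-refl {p = revPath p})
                 (◅◅-cong (backtrackˡ e) (≃-refl {p = p})))
               (revPath-inverseˡ p))

    revPath-cong : ∀ {u v} {p q : Path u v} → p ≃ q → revPath p ≃ revPath q
    revPath-cong {p = p} {q} p≃q =
      ≃-trans (≡⇒≃ (sym (◅◅-identityʳ (revPath p))))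
      (≃-trans (◅◅-cong (≃-refl {p = revPath p}) (≃-sym (revPath-inverseʳ q)))
      (≃-trans (≡⇒≃ (sym (◅◅-assoc (revPath p) q (revPath q))))
      (◅◅-cong (≃-trans (◅◅-cong (≃-refl {p = revPath p}) (≃-sym p≃q))
                        (revPath-inverseˡ p))
               (≃-refl {p = revPath q}))))

  π₁ : Vertex → Group 0ℓ 0ℓ
  π₁ v = record
    { Carrier = Path v v ; _≈_ = _≃_ ; _∙_ = _◅◅_ ; ε = ε ; _⁻¹ = revPath
    ; isGroup = record
      { isMonoid = record
        { isSemigroup = record
          { isMagma = record
            { isEquivalence = record { refl = ≃-refl ; sym = ≃-sym ; trans = ≃-trans }
            ; ∙-cong = ◅◅-cong }
          ; assoc = λ p q r → ≡⇒≃ (◅◅-assoc p q r) }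
        ; identity = (λ _ → ≃-refl) , (λ p → ≡⇒≃ (◅◅-identityʳ p)) }
      ; inverse = revPath-inverseˡ , revPath-inverseʳ
      ; ⁻¹-cong = revPath-cong }
    }

  lengthParity : ∀ {u v} → Path u v → Parity
  lengthParity p = parity (pathLength p)

  private
    parity-suc : ∀ n → parity (suc n) ≡ 1ℙ ℙ.+ parity n
    parity-suc n = ℙ.+-homo-+ 1 n

    pathLength-◅◅ : ∀ {u v w} (p : Path u v) (q : Path v w) →
                    pathLength (p ◅◅ q) ≡ pathLength p ℕ.+ pathLength q
    pathLength-◅◅ ε       q = refl
    pathLength-◅◅ (_ ◅ p) q = cong suc (pathLength-◅◅ p q)

    lengthParity-◅◅ : ∀ {u v w} (p : Path u v) (q : Path v w) →
                      lengthParity (p ◅◅ q) ≡ lengthParity p ℙ.+ lengthParity q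
    lengthParity-◅◅ p q =
      trans (cong parity (pathLength-◅◅ p q)) (ℙ.+-homo-+ (pathLength p) (pathLength q))

    lengthParity-revPath : ∀ {u v} (p : Path u v) →
                           lengthParity (revPath p) ≡ lengthParity p
    lengthParity-revPath ε       = refl
    lengthParity-revPath (e ◅ p) = begin
      lengthParity (revPath (e ◅ p))            ≡⟨ cong lengthParity (revPath-◅ e p) ⟩
      lengthParity (revPath p ◅◅ rev e ◅ ε)     ≡⟨ lengthParity-◅◅ (revPath p) (rev e ◅ ε) ⟩
      lengthParity (revPath p) ℙ.+ 1ℙ           ≡⟨ cong (ℙ._+ 1ℙ) (lengthParity-revPath p) ⟩
      lengthParity p ℙ.+ 1ℙ                     ≡⟨ ℙ.+-comm (lengthParity p) 1ℙ ⟩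
      1ℙ ℙ.+ lengthParity p                     ≡⟨ parity-suc (pathLength p) ⟨
      lengthParity (e ◅ p)                      ∎
      where open ≡-Reasoning

  module _ (even : ∀ {v} {γ : Path v v} → Cell γ → lengthParity γ ≡ 0ℙ) where

    private
      lengthParity-cong : ∀ {u v} {p q : Path u v} → p ≃ q → lengthParity p ≡ lengthParity q
      lengthParity-cong (backtrack e)   = refl
      lengthParity-cong (cell γ)        = even γ
      lengthParity-cong ≃-refl          = refl
      lengthParity-cong (≃-sym h)       = sym (lengthParity-cong h)
      lengthParity-cong (≃-trans h k)   = trans (lengthParity-cong h) (lengthParity-cong k)
      lengthParity-cong (◅◅-cong {p = p} {q} {r} {s} h k) = begin
        lengthParity (p ◅◅ r)               ≡⟨ lengthParity-◅◅ p r ⟩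
        lengthParity p ℙ.+ lengthParity r   ≡⟨ cong₂ ℙ._+_ (lengthParity-cong h) (lengthParity-cong k) ⟩
        lengthParity q ℙ.+ lengthParity s   ≡⟨ lengthParity-◅◅ q s ⟨
        lengthParity (q ◅◅ s)               ∎
        where open ≡-Reasoning

    lengthParity-isGroupHomomorphism : ∀ v →
      GroupMorphisms.IsGroupHomomorphism (Group.rawGroup (π₁ v))
        (Group.rawGroup ℙ.+-0-group) lengthParity
    lengthParity-isGroupHomomorphism v = record
      { isMonoidHomomorphism = record
        { isMagmaHomomorphism = record
          { isRelHomomorphism = record { cong = lengthParity-cong }
          ; homo = lengthParity-◅◅ }
        ; ε-homo = refl }
      ; ⁻¹-homo = lengthParity-revPath }

    evenSubgroup : Vertex → Group 0ℓ 0ℓ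
    evenSubgroup v =
      kernel (π₁ v) ℙ.+-0-group lengthParity (lengthParity-isGroupHomomorphism v)

-- A finite set of unit squares, listed without repetition.  corner s = (a , b)
-- stands for the square [a,a+1]×[b,b+1].  A quadriculated disk is a region whose
-- union is a disk; the constructions below make sense for every region.

record Region : Set where
  field
    area             : ℕ
    corner           : Fin area → ℤ × ℤ
    corner-injective : ∀ {s s′} → corner s ≡ corner s′ → s ≡ s′

-- [0,m]×[0,n]
rectangle : ℕ → ℕ → Region
rectangle m n = record
  { area   = m ℕ.* n
  ; corner = λ s → let (i , j) = remQuot {m} n s in + toℕ i , + toℕ j
  ; corner-injective = λ {s} {s′} eq → begin
      s                                  ≡⟨ combine-remQuot {m} n s ⟨
      uncurry combine (remQuot {m} n s)  ≡⟨ cong₂ combine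
        (toℕ-injective (ℤ.+-injective (cong proj₁ eq)))
        (toℕ-injective (ℤ.+-injective (cong proj₂ eq))) ⟩
      uncurry combine (remQuot {m} n s′) ≡⟨ combine-remQuot {m} n s′ ⟩
      s′                                 ∎
  }
  where open ≡-Reasoning

module _ (D : Region) where
  open Region D

  Square : Set
  Square = Fin area

  white black : Subset area
  white = tabulate λ s → let (a , b) = corner s in does (2 ∣? ∣ a ℤ.+ b ∣)
  black = ∁ white

  -- Two unit squares share an edge iff their corners are at ℓ¹-distance one.
  Adjacent : Rel Square 0ℓ
  Adjacent s s′ =
    let (a , b) = corner s ; (a′ , b′) = corner s′
    in ∣ a ℤ.- a′ ∣ ℕ.+ ∣ b ℤ.- b′ ∣ ≡ 1

  record Plug : Set where
    constructor plug
    field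
      squares   : Subset area
      .balanced : size (squares ∩ white) ≡ size (squares ∩ black)

  open Plug public

  p∘ : Plug
  p∘ = plug ⊥ (trans (cong size (∩-zeroˡ white)) (sym (cong size (∩-zeroˡ black))))

  Disjoint : Rel Plug 0ℓ
  Disjoint p q = Empty (squares p ∩ squares q)

  -- A set of pairwise disjoint dominoes is stored as the involution exchanging
  -- the two squares of each domino and fixing the uncovered squares.  It is a
  -- vector, not a function, so that _≡_ is equality of sets of dominoes.

  Pairing : Set
  Pairing = Vec Square area

  record IsTiling (r : Subset area) (t : Pairing) : Set where
    field
      involutive : ∀ s → lookup t (lookup t s) ≡ s
      covers     : ∀ {s} → s ∈ r → Adjacent s (lookup t s)
      avoids     : ∀ {s} → s ∉ r → lookup t s ≡ s

  record Tiling (r : Subset area) : Set where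
    constructor tiling
    field
      pairing   : Pairing
      .isTiling : IsTiling r pairing

  open Tiling public

  -- t ∪ {d}, where d is the domino made of s and s′ (both uncovered by t)
  addDomino : Square → Square → Pairing → Pairing
  addDomino s s′ t = t [ s ]≔ s′ [ s′ ]≔ s

  -- The tilings h and v differ by one flip, h having the two horizontal and v
  -- the two vertical dominoes of the 2×2 square with rows s₀₀ s₁₀ and s₀₁ s₁₁.
  record Flip (h v : Pairing) : Set where
    field
      s₀₀ s₁₀ s₀₁ s₁₁ : Square
    private
      x = proj₁ (corner s₀₀)
      y = proj₂ (corner s₀₀)
    field
      corner₁₀ : corner s₁₀ ≡ (x ℤ.+ 1ℤ , y)
      corner₀₁ : corner s₀₁ ≡ (x , y ℤ.+ 1ℤ)
      corner₁₁ : corner s₁₁ ≡ (x ℤ.+ 1ℤ , y ℤ.+ 1ℤ)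
      h-bottom : lookup h s₀₀ ≡ s₁₀
      h-top    : lookup h s₀₁ ≡ s₁₁
      v-left   : lookup v s₀₀ ≡ s₀₁
      v-right  : lookup v s₁₀ ≡ s₁₁
      agree    : ∀ s → s ≢ s₀₀ → s ≢ s₁₀ → s ≢ s₀₁ → s ≢ s₁₁ →
                 lookup h s ≡ lookup v s

  -- Oriented edges.  The two orientations of an edge between distinct plugs are
  -- told apart by their sources; those of a loop by a sign.

  data Edge : Rel Plug 0ℓ where
    edge : ∀ {p q} → .(p ≢ q) → .(Disjoint p q) →
           Tiling (∁ (squares p ∪ squares q)) → Edge p q
    loop : Sign → Tiling ⊤ → Edge p∘ p∘

  edgePairing : ∀ {p q} → Edge p q → Pairing
  edgePairing (edge _ _ t) = pairing t
  edgePairing (loop _ t)   = pairing t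

  revEdge : ∀ {p q} → Edge p q → Edge q p
  revEdge {p} {q} (edge p≢q disj (tiling t isT)) =
    edge (λ q≡p → p≢q (sym q≡p))
         (subst Empty (∩-comm (squares p) (squares q)) disj)
         (tiling t (subst (λ r → IsTiling (∁ r) t) (∪-comm (squares p) (squares q)) isT))
  revEdge (loop σ t) = loop (opposite σ) t

  revEdge-involutive : ∀ {p q} (e : Edge p q) → revEdge (revEdge e) ≡ e
  revEdge-involutive (edge _ _ _) = refl
  revEdge-involutive (loop σ t)   = cong (λ σ′ → loop σ′ t) (opposite-involutive σ)

  private
    sign : ∀ {p q} → Edge p q → Sign
    sign (edge _ _ _) = s+
    sign (loop σ _)   = σ

  revEdge-fixfree : ∀ {p} (e : Edge p p) → revEdge e ≢ e
  revEdge-fixfree (edge p≢p _ _) _  = ⊥-elim-irr (p≢p refl)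
  revEdge-fixfree (loop σ t)     eq = s≢opposite[s] σ (sym (cong sign eq))

  -- In quad, p₁ and p₃ (or p₄ and p₃) may both be empty; the corresponding edge
  -- is then a loop, and a cell is attached for either orientation of it.  By
  -- loop² this does not affect the fundamental group.

  data Cell : ∀ {p} → Star Edge p p → Set where
    loop² : (t : Tiling ⊤) → Cell (loop s+ t ◅ loop s+ t ◅ ε)

    bigon : ∀ {p q} → p ≢ q → (e e′ : Edge p q) →
            Flip (edgePairing e) (edgePairing e′) →
            Cell (e ◅ revEdge e′ ◅ ε)

    quad  : ∀ {p₁ p₂ p₃ p₄} {s s′ : Square} →
            Adjacent s s′ → s ∉ squares p₃ → s′ ∉ squares p₃ →
            squares p₂ ≡ squares p₃ ∪ (⁅ s ⁆ ∪ ⁅ s′ ⁆) →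
            (e₁₂ : Edge p₁ p₂) (e₂₄ : Edge p₂ p₄) (e₄₃ : Edge p₄ p₃) (e₃₁ : Edge p₃ p₁) →
            edgePairing e₄₃ ≡ addDomino s s′ (edgePairing e₂₄) →
            edgePairing e₃₁ ≡ addDomino s s′ (edgePairing e₁₂) →
            Cell (e₁₂ ◅ e₂₄ ◅ e₄₃ ◅ e₃₁ ◅ ε)

  dominoComplex : TwoComplex
  dominoComplex = record
    { Vertex = Plug ; Edge = Edge ; rev = revEdge
    ; rev-involutive = revEdge-involutive ; rev-fixfree = revEdge-fixfree
    ; Cell = Cell }

  dominoGroup : Group 0ℓ 0ℓ
  dominoGroup = π₁ dominoComplex p∘

  Cell-even : ∀ {p} {γ : Star Edge p p} → Cell γ → lengthParity dominoComplex γ ≡ 0ℙ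
  Cell-even (loop² _)                = refl
  Cell-even (bigon _ _ _ _)          = refl
  Cell-even (quad _ _ _ _ _ _ _ _ _ _) = refl

  evenDominoGroup : Group 0ℓ 0ℓ
  evenDominoGroup = evenSubgroup dominoComplex Cell-even p∘

record Symbol (L : ℕ) : Set where
  constructor a
  field
    index    : ℤ
    .nonzero : index ≢ 0ℤ
    .bounded : ∣ index ∣ ℕ.≤ ⌊ L ℕ.∸ 1 /2⌋

open Symbol public

InR : ℕ → Rel ℤ 0ℓ
InR L m n = (∣ m ∣ ℕ.⊔ ∣ n ∣) ℕ.⊔ ∣ m ℤ.- n ∣ ℕ.< ⌊ L /2⌋

-- If InR L m n then ∣ m ∣ , ∣ n ∣ ≤ ⌊ L ∸ 1 /2⌋, so each of m and n is 0 or the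
-- index of a symbol; a₀ = 1 makes the pairs with a zero entry vacuous.

data Relation (L : ℕ) : Rel (Word (Symbol L)) 0ℓ where
  commute : ∀ x y → InR L (index x) (index y) → Relation L [ gen x , gen y ] one

G⁺ : ℕ → Group 0ℓ 0ℓ
G⁺ L = ⟨ Symbol L ∣ Relation L ⟩

{-# OPTIONS --safe #-}

-- An even closed path is a path in the double cover of the complex.  There the
-- odd vertex p is joined to the even vertex ∁ p by an edge without dominoes, and
-- contracting these edges leaves plugs, to which dominoes are added one at a
-- time.  Put a particle on each white square of the plug and on each black
-- square outside of it: adding or removing a domino becomes the hop of a
-- particle along an edge of the ladder 2 × L, which carries L particles.  With
-- the height of a column being the number of particles to its left minus the
-- number of columns to its left, a vertical hop at height m is given the weight
-- a_m or its inverse and a horizontal hop the weight 1.  Disjoint hops commute,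
-- the flip cells make neighbouring vertical hops at the same height agree, and
-- two vertical hops at heights m and n are simultaneously possible exactly when
-- (m , n) ∈ R_L; so weights define a homomorphism Φ to G⁺ L.
--
-- For the inverse Ψ, the horizontal hops and the vertical hops at height 0 span
-- a simply connected subcomplex: pushing the heights towards 0 is a terminating
-- rewriting system, locally confluent up to homotopy.  Modulo that subcomplex
-- the class of a vertical hop depends only on its height, as the columns to its
-- left and right can be brought to a normal form.

module Submission where

open import Defs
open import Level using (0ℓ)
open import Algebra.Bundles using (Group)
open import Algebra.Morphism.Structures using (module GroupMorphisms)
import Algebra.Properties.Group as GroupProperties
open import Data.Bool.Base using (Bool; true; false; not; _xor_; if_then_else_)
open import Data.Bool.Properties using (not-involutive; not-injective; ¬-not; ∨-zeroʳ; ∨-identityʳ)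
  renaming (_≟_ to _≟ᵇ_)
open import Data.Empty using (⊥; ⊥-elim; ⊥-elim-irr)
open import Data.Fin.Base using (Fin; zero; suc; toℕ; remQuot; fromℕ<)
open import Data.Fin.Properties using (_≟_; any?; suc-injective)
open import Data.Fin.Subset as Subset using (Subset; _∈_; _∉_; _∪_; _∩_; ∁; ⁅_⁆) renaming (∣_∣ to size)
import Data.Fin.Subset.Properties as Subset
open import Data.Integer.Base as ℤ using (ℤ; +_; +[1+_]; -[1+_]; 0ℤ; 1ℤ; -1ℤ; _-_)
  renaming (_+_ to infixl 6 _+ᶻ_; ∣_∣ to abs)
import Data.Integer.Properties as ℤ
import Data.Integer.Tactic.RingSolver as ℤ-Ring
open import Data.List.Base using (List; []; _∷_; _++_; length; replicate)
open import Data.List.Properties using (length-replicate; length-++; ++-assoc; ++-identityʳ)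
open import Data.List.Relation.Unary.All using (All; []; _∷_)
open import Data.Nat.Base as ℕ using (ℕ; zero; suc; _≤_; _<_; s≤s; z≤n; ⌊_/2⌋; ⌈_/2⌉)
open import Data.Nat.Divisibility using (_∣?_; ∣m+n∣m⇒∣n; ∣m∣n⇒∣m+n; ∣-refl)
open import Data.Nat.Induction using (<-wellFounded)
import Data.Nat.Properties as ℕ
import Data.Nat.Tactic.RingSolver as ℕ-Ring
open import Data.Parity.Base using (Parity; 0ℙ; 1ℙ)
open import Data.Product.Base using (Σ; ∃; _×_; _,_; proj₁; proj₂; map)
open import Data.Sign.Base using () renaming (+ to s+; - to s-)
open import Data.Sum.Base using (_⊎_; inj₁; inj₂; [_,_]′)
open import Data.Unit.Base using (⊤; tt)
open import Data.Vec.Base as Vec using (Vec; []; _∷_; lookup; tabulate; _[_]≔_; updateAt; allFin)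
import Data.Vec.Properties as Vec
open import Function.Base using (_∘_)
open import Induction.WellFounded using (Acc; acc)
open import Relation.Binary.Bundles using (Setoid)
open import Relation.Binary.Construct.Closure.ReflexiveTransitive using (ε; _◅_; _◅◅_)
open import Relation.Binary.Construct.Closure.ReflexiveTransitive.Properties using (◅◅-assoc)
open import Relation.Binary.PropositionalEquality
  using (_≡_; _≢_; refl; sym; trans; cong; cong₂; subst; subst₂; module ≡-Reasoning)
open import Relation.Nullary using (¬_; Dec; yes; no; does; contradiction)
open import Relation.Nullary.Decidable using (does-≡; map′; recompute; ¬?; decidable-stable)

-- The double cover is never built: a path carries a Boolean flag, and an edge leaving an odd vertex
-- is weighed as the inverse of its reverse, which leaves an even one. The dominoes of an edge have
-- no preferred order, so its weight is defined through an arbitrary order of adding them; the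
-- substance of Φ is that the product does not depend on this order. The relations come from
-- counting columns. The height changes by at most one per column, so vertical hops at heights m and
-- n need |m| columns to the left, |m-n| in between, |n| to the right and two for themselves. The
-- largest of the three numbers is the sum of the other two, so |m| + |m-n| + |n| + 2 ≤ L says
-- exactly that it is below ⌊L/2⌋. That height 0 has no generator is essential for contracting the
-- subcomplex: when the height between a full and an empty column is 1 or -1, the two pushes across
-- it obstruct each other, and only vertical hops at height 0 close the square. L ≥ 3 ensures that
-- an edge with at most two dominoes is never a loop.

Col : Set
Col = Bool × Bool

-- Configurations of particles on the ladder, and hops

pattern U = true , false
pattern D = false , true
pattern E₂ = true , true
pattern E₀ = false , false

-- The number of particles minus one, which is the increment of the height across the column. A set
-- of squares is balanced exactly when these increments sum to 0.
exc : Col → ℤ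
exc E₂ = 1ℤ
exc U = 0ℤ
exc D = 0ℤ
exc E₀ = -1ℤ

total : List Col → ℤ
total []      = 0ℤ
total (c ∷ s) = exc c +ᶻ total s

bit : Bool → Col → Bool
bit false (i , j) = i
bit true  (i , j) = j

flip : Bool → Col → Col
flip false (i , j) = not i , j
flip true  (i , j) = i , not j

flip-involutive : ∀ r c → flip r (flip r c) ≡ c
flip-involutive false (i , j) = cong (_, j) (not-involutive i)
flip-involutive true  (i , j) = cong (i ,_) (not-involutive j)

flip-comm : ∀ r r′ c → flip r (flip r′ c) ≡ flip r′ (flip r c)
flip-comm false false c = refl
flip-comm false true  c = refl
flip-comm true  false c = refl
flip-comm true  true  c = refl

bit-flip : ∀ r c → bit r (flip r c) ≡ not (bit r c)
bit-flip false c = refl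
bit-flip true  c = refl

bit-flip-≢ : ∀ {r r′} c → r ≢ r′ → bit r (flip r′ c) ≡ bit r c
bit-flip-≢ {false} {false} c r≢r′ = ⊥-elim (r≢r′ refl)
bit-flip-≢ {false} {true}  c r≢r′ = refl
bit-flip-≢ {true}  {false} c r≢r′ = refl
bit-flip-≢ {true}  {true}  c r≢r′ = ⊥-elim (r≢r′ refl)

-- vert exchanges the two bits of the first column, hor r those in row r of the
-- first two columns, and there e acts as e on the remaining columns.
data Hop : Set where
  vert  : Hop
  hor   : Bool → Hop
  there : Hop → Hop

toggle : Hop → List Col → List Col
toggle vert      []            = []
toggle vert      ((i , j) ∷ s) = (not i , not j) ∷ s
toggle (hor r)   []            = []
toggle (hor r)   (c ∷ [])      = c ∷ []
toggle (hor r)   (c ∷ d ∷ s)   = flip r c ∷ flip r d ∷ s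
toggle (there e) []            = []
toggle (there e) (c ∷ s)       = c ∷ toggle e s

-- `toggle` is total; it is a genuine hop only when exactly one of the two places is occupied. In
-- the plug this says that both squares are in or both are out, since neighbours have opposite
-- colours.
Active : Hop → List Col → Set
Active vert      []            = ⊥
Active vert      ((i , j) ∷ s) = i ≡ not j
Active (hor r)   []            = ⊥
Active (hor r)   (c ∷ [])      = ⊥
Active (hor r)   (c ∷ d ∷ s)   = bit r c ≡ not (bit r d)
Active (there e) []            = ⊥
Active (there e) (c ∷ s)       = Active e s

-- The two edges of the ladder share no place. Recursion on the hops keeps this independent of the
-- number of columns; `Disj⇒Apart` and `Apart⇒Disj` translate it to squares.
Disj : Hop → Hop → Set
Disj vert      vert              = ⊥
Disj vert      (hor _)           = ⊥
Disj vert      (there f)         = ⊤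
Disj (hor _)   vert              = ⊥
Disj (hor r)   (hor r′)          = r ≢ r′
Disj (hor r)   (there vert)      = ⊥
Disj (hor r)   (there (hor r′))  = r ≢ r′
Disj (hor r)   (there (there f)) = ⊤
Disj (there e) vert              = ⊤
Disj (there vert) (hor _)        = ⊥
Disj (there (hor r)) (hor r′)    = r ≢ r′
Disj (there (there e)) (hor r)   = ⊤
Disj (there e) (there f)         = Disj e f

Disj-sym : ∀ e f → Disj e f → Disj f e
Disj-sym vert      (there f)         _ = tt
Disj-sym (hor r)   (hor r′)          d = d ∘ sym
Disj-sym (hor r)   (there (hor r′))  d = d ∘ sym
Disj-sym (hor r)   (there (there f)) _ = tt
Disj-sym (there e) vert              _ = tt
Disj-sym (there (hor r)) (hor r′)    d = d ∘ sym
Disj-sym (there (there e)) (hor r)   _ = tt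
Disj-sym (there e) (there f)         d = Disj-sym e f d

toggle-involutive : ∀ e s → toggle e (toggle e s) ≡ s
toggle-involutive vert      []            = refl
toggle-involutive vert      ((i , j) ∷ s) =
  cong (_∷ s) (cong₂ _,_ (not-involutive i) (not-involutive j))
toggle-involutive (hor r)   []            = refl
toggle-involutive (hor r)   (c ∷ [])      = refl
toggle-involutive (hor r)   (c ∷ d ∷ s)   =
  cong₂ (λ c d → c ∷ d ∷ s) (flip-involutive r c) (flip-involutive r d)
toggle-involutive (there e) []            = refl
toggle-involutive (there e) (c ∷ s)       = cong (c ∷_) (toggle-involutive e s)

toggle-comm : ∀ e f s → Disj e f → toggle e (toggle f s) ≡ toggle f (toggle e s)
toggle-comm vert      (there f)         []          _ = refl
toggle-comm vert      (there f)         (c ∷ s)     _ = refl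
toggle-comm (hor r)   (hor r′)          []          _ = refl
toggle-comm (hor r)   (hor r′)          (c ∷ [])    _ = refl
toggle-comm (hor r)   (hor r′)          (c ∷ d ∷ s) _ =
  cong₂ (λ c d → c ∷ d ∷ s) (flip-comm r r′ c) (flip-comm r r′ d)
toggle-comm (hor r)   (there (hor r′))  []          _ = refl
toggle-comm (hor r)   (there (hor r′))  (c ∷ [])    _ = refl
toggle-comm (hor r)   (there (hor r′))  (c ∷ d ∷ []) _ = refl
toggle-comm (hor r)   (there (hor r′))  (c ∷ d ∷ d′ ∷ s) _ =
  cong (λ d → flip r c ∷ d ∷ flip r′ d′ ∷ s) (flip-comm r r′ d)
toggle-comm (hor r)   (there (there f)) []          _ = refl
toggle-comm (hor r)   (there (there f)) (c ∷ [])    _ = refl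
toggle-comm (hor r)   (there (there f)) (c ∷ d ∷ s) _ = refl
toggle-comm (there e) (there f)         []          d = refl
toggle-comm (there e) (there f)         (c ∷ s)     d = cong (c ∷_) (toggle-comm e f s d)
toggle-comm (there e) vert              []          _ = refl
toggle-comm (there e) vert              (c ∷ s)     _ = refl
toggle-comm (there (hor r)) (hor r′)    []          _ = refl
toggle-comm (there (hor r)) (hor r′)    (c ∷ [])    _ = refl
toggle-comm (there (hor r)) (hor r′)    (c ∷ d ∷ []) _ = refl
toggle-comm (there (hor r)) (hor r′)    (c ∷ d ∷ d′ ∷ s) _ =
  cong (λ d → flip r′ c ∷ d ∷ flip r d′ ∷ s) (flip-comm r r′ d)
toggle-comm (there (there e)) (hor r)   []          _ = refl
toggle-comm (there (there e)) (hor r)   (c ∷ [])    _ = refl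
toggle-comm (there (there e)) (hor r)   (c ∷ d ∷ s) _ = refl

Active-toggle : ∀ e s → Active e s → Active e (toggle e s)
Active-toggle vert      ((i , j) ∷ s) act = cong not act
Active-toggle (hor r)   (c ∷ d ∷ s)   act =
  trans (bit-flip r c) (trans (cong not act) (cong not (sym (bit-flip r d))))
Active-toggle (there e) (c ∷ s)       act = Active-toggle e s act

Active-disj : ∀ e f s → Disj e f → Active e s → Active e (toggle f s)
Active-disj vert      (there f)         (c ∷ s)     _ act = act
Active-disj (hor r)   (hor r′)          (c ∷ d ∷ s) r≢r′ act =
  trans (bit-flip-≢ c r≢r′) (trans act (cong not (sym (bit-flip-≢ d r≢r′))))
Active-disj (hor r)   (there (hor r′))  (c ∷ d ∷ []) r≢r′ act = act
Active-disj (hor r)   (there (hor r′))  (c ∷ d ∷ _ ∷ s) r≢r′ act =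
  trans act (cong not (sym (bit-flip-≢ d r≢r′)))
Active-disj (hor r)   (there (there f)) (c ∷ d ∷ s) _ act = act
Active-disj (there e) vert              (c ∷ s)     _ act = act
Active-disj (there (hor r)) (hor r′)    (c ∷ d ∷ d′ ∷ s) r≢r′ act =
  trans (bit-flip-≢ d r≢r′) act
Active-disj (there (there e)) (hor r)   (c ∷ d ∷ s) _ act = act
Active-disj (there e) (there f)         (c ∷ s)     d act = Active-disj e f s d act

length-toggle : ∀ e s → length (toggle e s) ≡ length s
length-toggle vert      []          = refl
length-toggle vert      (c ∷ s)     = refl
length-toggle (hor r)   []          = refl
length-toggle (hor r)   (c ∷ [])    = refl
length-toggle (hor r)   (c ∷ d ∷ s) = refl
length-toggle (there e) []          = refl
length-toggle (there e) (c ∷ s)     = cong suc (length-toggle e s)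

exc-flip-true : ∀ r c → bit r c ≡ true → exc (flip r c) ≡ exc c +ᶻ -1ℤ
exc-flip-true false (true , false) _ = refl
exc-flip-true false (true , true)  _ = refl
exc-flip-true true  (false , true) _ = refl
exc-flip-true true  (true , true)  _ = refl

exc-flip-false : ∀ r c → bit r c ≡ false → exc (flip r c) ≡ exc c +ᶻ 1ℤ
exc-flip-false false (false , false) _ = refl
exc-flip-false false (false , true)  _ = refl
exc-flip-false true  (false , false) _ = refl
exc-flip-false true  (true , false)  _ = refl

exc-hop : ∀ r c d → bit r c ≡ not (bit r d) →
          exc (flip r c) +ᶻ exc (flip r d) ≡ exc c +ᶻ exc d
exc-hop r c d act with bit r c in eqc | bit r d in eqd
... | true  | false = trans (cong₂ _+ᶻ_ (exc-flip-true r c eqc) (exc-flip-false r d eqd))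
                            (lemma (exc c) (exc d))
  where
  lemma : ∀ x y → (x +ᶻ -1ℤ) +ᶻ (y +ᶻ 1ℤ) ≡ x +ᶻ y
  lemma = ℤ-Ring.solve-∀
... | false | true  = trans (cong₂ _+ᶻ_ (exc-flip-false r c eqc) (exc-flip-true r d eqd))
                            (lemma (exc c) (exc d))
  where
  lemma : ∀ x y → (x +ᶻ 1ℤ) +ᶻ (y +ᶻ -1ℤ) ≡ x +ᶻ y
  lemma = ℤ-Ring.solve-∀

-- A horizontal hop crosses a single boundary, so the height behind both columns, and all that lies
-- further right, does not notice it.
exc-hop-from : ∀ h r c d → bit r c ≡ not (bit r d) →
               h +ᶻ exc (flip r c) +ᶻ exc (flip r d) ≡ h +ᶻ exc c +ᶻ exc d
exc-hop-from h r c d act = begin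
  h +ᶻ exc (flip r c) +ᶻ exc (flip r d)   ≡⟨ ℤ.+-assoc h _ _ ⟩
  h +ᶻ (exc (flip r c) +ᶻ exc (flip r d)) ≡⟨ cong (h +ᶻ_) (exc-hop r c d act) ⟩
  h +ᶻ (exc c +ᶻ exc d)                   ≡⟨ ℤ.+-assoc h _ _ ⟨
  h +ᶻ exc c +ᶻ exc d                     ∎
  where open ≡-Reasoning

exc-vert : ∀ i j → i ≡ not j → exc (not i , not j) ≡ exc (i , j)
exc-vert true  false _ = refl
exc-vert false true  _ = refl

total-toggle : ∀ e s → Active e s → total (toggle e s) ≡ total s
total-toggle vert      ((i , j) ∷ s) act = cong (_+ᶻ total s) (exc-vert i j act)
total-toggle (hor r)   (c ∷ d ∷ s)   act = begin
  exc (flip r c) +ᶻ (exc (flip r d) +ᶻ total s) ≡⟨ ℤ.+-assoc (exc (flip r c)) _ _ ⟨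
  exc (flip r c) +ᶻ exc (flip r d) +ᶻ total s   ≡⟨ cong (_+ᶻ total s) (exc-hop r c d act) ⟩
  exc c +ᶻ exc d +ᶻ total s                     ≡⟨ ℤ.+-assoc (exc c) _ _ ⟩
  exc c +ᶻ (exc d +ᶻ total s)                   ∎
  where open ≡-Reasoning
total-toggle (there e) (c ∷ s)       act = cong (exc c +ᶻ_) (total-toggle e s act)

-- Flat hops as a terminating rewriting system

-- The height before a column is the number of particles to its left minus the
-- number of columns to its left.  A flat hop does not contribute a generator.
Flat : ℤ → Hop → List Col → Set
Flat h vert      s       = h ≡ 0ℤ
Flat h (hor r)   s       = ⊤
Flat h (there e) []      = ⊥
Flat h (there e) (c ∷ s) = Flat (h +ᶻ exc c) e s

-- The height is the one between two columns, the bits are those of one row to its left and right. A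
-- positive height is a surplus on the left, so the particle goes right; a negative one draws it to
-- the left.
Push : ℤ → Bool → Bool → Set
Push +[1+ n ] true  false = ⊤
Push -[1+ n ] false true  = ⊤
Push _        _     _     = ⊥

-- Red hops lower Σ ∣height∣, or else move a particle down at height 0.
Red : ℤ → Hop → List Col → Set
Red h vert      []            = ⊥
Red h vert      ((i , j) ∷ s) = h ≡ 0ℤ × i ≡ true × j ≡ false
Red h (hor r)   []            = ⊥
Red h (hor r)   (c ∷ [])      = ⊥
Red h (hor r)   (c ∷ d ∷ s)   = Push (h +ᶻ exc c) (bit r c) (bit r d)
Red h (there e) []            = ⊥
Red h (there e) (c ∷ s)       = Red (h +ᶻ exc c) e s

data Pushed : ℤ → Bool → Bool → Set where
  right : ∀ {n} → Pushed +[1+ n ] true false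
  left  : ∀ {n} → Pushed -[1+ n ] false true

pushed : ∀ h x y → Push h x y → Pushed h x y
pushed +[1+ n ] true  false _ = right
pushed -[1+ n ] false true  _ = left

Push-≡not : ∀ h x y → Push h x y → x ≡ not y
Push-≡not h x y p with pushed h x y p
... | right = refl
... | left  = refl

Red⇒Active : ∀ h e s → Red h e s → Active e s
Red⇒Active h vert      (_ ∷ s)     (_ , refl , refl) = refl
Red⇒Active h (hor r)   (c ∷ d ∷ s) red = Push-≡not (h +ᶻ exc c) _ _ red
Red⇒Active h (there e) (c ∷ s)     red = Red⇒Active (h +ᶻ exc c) e s red

Red⇒Flat : ∀ h e s → Red h e s → Flat h e s
Red⇒Flat h vert      (_ ∷ s)     (eq , _) = eq
Red⇒Flat h (hor r)   (c ∷ d ∷ s) red = tt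
Red⇒Flat h (there e) (c ∷ s)     red = Red⇒Flat (h +ᶻ exc c) e s red

push-right : ∀ h x y → (∃ λ n → h ≡ +[1+ n ]) → x ≡ true → y ≡ false → Push h x y
push-right _ _ _ (_ , refl) refl refl = tt

push-left : ∀ h x y → (∃ λ n → h ≡ -[1+ n ]) → x ≡ false → y ≡ true → Push h x y
push-left _ _ _ (_ , refl) refl refl = tt

height-flip-true : ∀ h r c → bit r c ≡ true → h +ᶻ exc (flip r c) ≡ h +ᶻ exc c +ᶻ -1ℤ
height-flip-true h r c eq = trans (cong (h +ᶻ_) (exc-flip-true r c eq)) (sym (ℤ.+-assoc h _ _))

height-flip-false : ∀ h r c → bit r c ≡ false → h +ᶻ exc (flip r c) ≡ h +ᶻ exc c +ᶻ 1ℤ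
height-flip-false h r c eq = trans (cong (h +ᶻ_) (exc-flip-false r c eq)) (sym (ℤ.+-assoc h _ _))

-- A horizontal hop changes one height only, by one, so its absolute value drops in exactly one
-- direction; at height 0 a vertical hop reduces from `U` to `D`. The flat hops are therefore the
-- edges of the rewriting system.
Red-orient : ∀ h e s → Active e s → Flat h e s → Red h e s ⊎ Red h e (toggle e s)
Red-orient h vert      (U ∷ s) act h≡0 = inj₁ (h≡0 , refl , refl)
Red-orient h vert      (D ∷ s) act h≡0 = inj₂ (h≡0 , refl , refl)
Red-orient h (hor r)   (c ∷ d ∷ s) act _ with bit r c in eqc | bit r d in eqd | h +ᶻ exc c in eqh
... | true  | false | +[1+ n ] = inj₁ tt
-- Moving right from height 0 leads to height -1, so the reduction is the hop back.
... | true  | false | + 0      = inj₂ (push-left _ _ _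
        (0 , trans (height-flip-true h r c eqc) (cong (_+ᶻ -1ℤ) eqh))
        (trans (bit-flip r c) (cong not eqc)) (trans (bit-flip r d) (cong not eqd)))
... | true  | false | -[1+ n ] = inj₂ (push-left _ _ _
        (suc n , trans (height-flip-true h r c eqc)
          (trans (cong (_+ᶻ -1ℤ) eqh) (cong (λ k → -[1+ suc k ]) (ℕ.+-identityʳ n))))
        (trans (bit-flip r c) (cong not eqc)) (trans (bit-flip r d) (cong not eqd)))
... | false | true  | -[1+ n ] = inj₁ tt
... | false | true  | + n      = inj₂ (push-right _ _ _
        (n , trans (height-flip-false h r c eqc)
          (trans (cong (_+ᶻ 1ℤ) eqh) (cong +_ (ℕ.+-comm n 1))))
        (trans (bit-flip r c) (cong not eqc)) (trans (bit-flip r d) (cong not eqd)))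
Red-orient h (there e) (c ∷ s)     act flat = Red-orient (h +ᶻ exc c) e s act flat

top : Col → ℕ
top (true  , _) = 1
top (false , _) = 0

-- The term `top` serves the vertical reductions: they leave all heights alone and move a particle
-- from the first row to the second, whereas a horizontal hop keeps it in its row.
μ : ℤ → List Col → ℕ
μ h []      = 0
μ h (c ∷ s) = abs (h +ᶻ exc c) ℕ.+ top c ℕ.+ μ (h +ᶻ exc c) s

top-hop : ∀ r c d → bit r c ≡ not (bit r d) → top (flip r c) ℕ.+ top (flip r d) ≡ top c ℕ.+ top d
top-hop true  (true  , _) (true  , _) act = refl
top-hop true  (true  , _) (false , _) act = refl
top-hop true  (false , _) (true  , _) act = refl
top-hop true  (false , _) (false , _) act = refl
top-hop false (true  , _) (false , _) _ = refl
top-hop false (false , _) (true  , _) _ = refl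

pushed-∣∣ : ∀ h r c d → Push (h +ᶻ exc c) (bit r c) (bit r d) →
            suc (abs (h +ᶻ exc (flip r c))) ≡ abs (h +ᶻ exc c)
pushed-∣∣ h r c d p with bit r c in eqc | bit r d | h +ᶻ exc c in eqh | pushed _ _ _ p
... | _ | _ | +[1+ n ] | right =
  cong (suc ∘ abs) (trans (height-flip-true h r c eqc) (cong (_+ᶻ -1ℤ) eqh))
... | _ | _ | -[1+ n ] | left  = trans
  (cong (suc ∘ abs) (trans (height-flip-false h r c eqc) (cong (_+ᶻ 1ℤ) eqh)))
  (cong suc (ℤ.∣⊖∣-≤ (s≤s (z≤n {n}))))

μ-Red : ∀ h e s → Red h e s → μ h (toggle e s) < μ h s
μ-Red h vert      (_ ∷ s)     (_ , refl , refl) =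
  ℕ.+-monoˡ-< (μ (h +ᶻ 0ℤ) s) (ℕ.+-monoʳ-< (abs (h +ᶻ 0ℤ)) (s≤s z≤n))
μ-Red h (hor r)   (c ∷ d ∷ s) red = ℕ.≤-reflexive (begin
  suc (x′ ℕ.+ top (flip r c) ℕ.+ (abs h₂′ ℕ.+ top (flip r d) ℕ.+ μ h₂′ s))
    ≡⟨ cong (λ h → suc (x′ ℕ.+ top (flip r c) ℕ.+ (abs h ℕ.+ top (flip r d) ℕ.+ μ h s)))
            (exc-hop-from h r c d act) ⟩
  suc (x′ ℕ.+ top (flip r c) ℕ.+ (abs h₂ ℕ.+ top (flip r d) ℕ.+ μ h₂ s))
    ≡⟨ regroup (suc x′) (top (flip r c)) (abs h₂) (top (flip r d)) (μ h₂ s) ⟩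
  (suc x′ ℕ.+ (top (flip r c) ℕ.+ top (flip r d))) ℕ.+ (abs h₂ ℕ.+ μ h₂ s)
    ≡⟨ cong₂ (λ x t → (x ℕ.+ t) ℕ.+ (abs h₂ ℕ.+ μ h₂ s)) (pushed-∣∣ h r c d red) (top-hop r c d act) ⟩
  (abs (h +ᶻ exc c) ℕ.+ (top c ℕ.+ top d)) ℕ.+ (abs h₂ ℕ.+ μ h₂ s)
    ≡⟨ regroup (abs (h +ᶻ exc c)) (top c) (abs h₂) (top d) (μ h₂ s) ⟨
  abs (h +ᶻ exc c) ℕ.+ top c ℕ.+ (abs h₂ ℕ.+ top d ℕ.+ μ h₂ s) ∎)
  where
  open ≡-Reasoning
  act = Red⇒Active h (hor r) (c ∷ d ∷ s) red
  x′ = abs (h +ᶻ exc (flip r c))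
  h₂ = h +ᶻ exc c +ᶻ exc d
  h₂′ = h +ᶻ exc (flip r c) +ᶻ exc (flip r d)
  regroup : ∀ x t y u z → x ℕ.+ t ℕ.+ (y ℕ.+ u ℕ.+ z) ≡ (x ℕ.+ (t ℕ.+ u)) ℕ.+ (y ℕ.+ z)
  regroup = ℕ-Ring.solve-∀
μ-Red h (there e) (c ∷ s)     red =
  ℕ.+-monoʳ-< (abs (h +ᶻ exc c) ℕ.+ top c) (μ-Red (h +ᶻ exc c) e s red)

-- The height has to come back to 0, so the run of full columns ends, and its last column can push a
-- particle into a vacancy of the next one.
∃Red-pos : ∀ k h s → h +ᶻ 1ℤ ≡ +[1+ k ] → +[1+ k ] +ᶻ total s ≡ 0ℤ →
           ∃ λ e → Red h e (E₂ ∷ s)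
∃Red-pos k h (E₂ ∷ s) eq end =
  let e , red = ∃Red-pos (suc k) (h +ᶻ 1ℤ) s
                  (trans (cong (_+ᶻ 1ℤ) eq) (cong +_ (ℕ.+-comm (suc k) 1)))
                  (trans (cong (_+ᶻ total s) (cong +_ (sym (ℕ.+-comm (suc k) 1))))
                         (trans (ℤ.+-assoc +[1+ k ] 1ℤ (total s)) end))
  in there e , red
∃Red-pos k h ((false , _) ∷ s) eq end = hor false , push-right _ _ _ (k , eq) refl refl
∃Red-pos k h (U ∷ s)           eq end = hor true  , push-right _ _ _ (k , eq) refl refl

∃Red-neg : ∀ k h s → h +ᶻ -1ℤ ≡ -[1+ k ] → -[1+ k ] +ᶻ total s ≡ 0ℤ →
           ∃ λ e → Red h e (E₀ ∷ s)
∃Red-neg k h (E₀ ∷ s) eq end =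
  let e , red = ∃Red-neg (suc k) (h +ᶻ -1ℤ) s
                  (trans (cong (_+ᶻ -1ℤ) eq) down)
                  (trans (cong (_+ᶻ total s) (sym down))
                         (trans (ℤ.+-assoc -[1+ k ] -1ℤ (total s)) end))
  in there e , red
  where
  down : -[1+ k ] +ᶻ -1ℤ ≡ -[1+ suc k ]
  down = cong (λ k → -[1+ suc k ]) (ℕ.+-identityʳ k)
∃Red-neg k h ((true , _) ∷ s) eq end = hor false , push-left _ _ _ (k , eq) refl refl
∃Red-neg k h (D ∷ s)          eq end = hor true  , push-left _ _ _ (k , eq) refl refl

-- Read from the left at height 0, `D` is passed over, `U` reduces in place, and a full or empty
-- column starts an excursion of the height, which must return to 0 and so contains a push.
Red-or-D : ∀ h s → h ≡ 0ℤ → total s ≡ 0ℤ →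
           s ≡ replicate (length s) D ⊎ ∃ λ e → Red h e s
Red-or-D h []       h≡0 end = inj₁ refl
Red-or-D h (U ∷ s)  h≡0 end = inj₂ (vert , h≡0 , refl , refl)
Red-or-D h (D ∷ s)  refl end with Red-or-D 0ℤ s refl (trans (sym (ℤ.+-identityˡ _)) end)
... | inj₁ eq        = inj₁ (cong (D ∷_) eq)
... | inj₂ (e , red) = inj₂ (there e , red)
Red-or-D h (E₂ ∷ s) refl end = inj₂ (∃Red-pos 0 0ℤ s refl end)
Red-or-D h (E₀ ∷ s) refl end = inj₂ (∃Red-neg 0 0ℤ s refl end)

-- Local confluence of the reductions

side : Bool → Hop
side false = vert
side true  = there vert

-- Around a 2×2 square: hopping along one horizontal and then one vertical side
-- leads to the same state as hopping along the two other sides.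
data Turn : Hop → Hop → Hop → Hop → Set where
  turn  : ∀ r v → Turn (hor r) (side v) (hor (not r)) (side (not v))
  there : ∀ {e e′ f f′} → Turn e e′ f f′ → Turn (there e) (there e′) (there f) (there f′)

Turn-sym : ∀ {e e′ f f′} → Turn e e′ f f′ → Turn f f′ e e′
Turn-sym (turn false false) = turn true true
Turn-sym (turn false true)  = turn true false
Turn-sym (turn true false)  = turn false true
Turn-sym (turn true true)   = turn false false
Turn-sym (there t)          = there (Turn-sym t)

-- Every peak of two different reductions closes with one further step on each side. The two shapes
-- are those squares that the 2-cells are able to fill: disjoint hops, and the circuit of a 2×2
-- block.
data Join (h : ℤ) (s : List Col) (e f : Hop) : Set where
  commuting : Disj e f → Red h f (toggle e s) → Red h e (toggle f s) → Join h s e f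
  turning   : ∀ {e′ f′} → Turn e e′ f f′ →
              Red h e′ (toggle e s) → Red h f′ (toggle f s) → Join h s e f

Join-sym : ∀ {h s e f} → Join h s e f → Join h s f e
Join-sym {e = e} {f} (commuting d x y) = commuting (Disj-sym e f d) y x
Join-sym (turning t x y)               = turning (Turn-sym t) y x

Join-there : ∀ {h c s e f} → Join (h +ᶻ exc c) s e f → Join h (c ∷ s) (there e) (there f)
Join-there (commuting d x y) = commuting d x y
Join-there (turning t x y)   = turning (there t) x y

≢⇒≡not : ∀ {r r′ : Bool} → r ≢ r′ → r′ ≡ not r
≢⇒≡not {false} {false} r≢r′ = ⊥-elim (r≢r′ refl)
≢⇒≡not {false} {true}  r≢r′ = refl
≢⇒≡not {true}  {false} r≢r′ = refl
≢⇒≡not {true}  {true}  r≢r′ = ⊥-elim (r≢r′ refl)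

+-1-cancel : ∀ h → h +ᶻ 1ℤ +ᶻ -1ℤ ≡ h
+-1-cancel = ℤ-Ring.solve-∀

-1+-cancel : ∀ h → h +ᶻ -1ℤ +ᶻ 1ℤ ≡ h
-1+-cancel = ℤ-Ring.solve-∀

-- Both particles of a full column can be pushed into an empty one. If the height in between is at
-- least 2, either push can follow the other. If it is 1, the first push makes it 0 and blocks the
-- second; instead a vertical hop at height 0 turns the remaining `U` into `D`, and both ways end in
-- `D`, `D`.
conflict-right : ∀ n h r s → h +ᶻ 1ℤ ≡ +[1+ n ] → Join h (E₂ ∷ E₀ ∷ s) (hor r) (hor (not r))
conflict-right zero h r s eq = go r
  where
  h≡0 : h ≡ 0ℤ
  h≡0 = trans (sym (+-1-cancel h)) (cong (_+ᶻ -1ℤ) eq)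
  go : ∀ r → Join h (E₂ ∷ E₀ ∷ s) (hor r) (hor (not r))
  go false = turning (turn false true) (trans (ℤ.+-identityʳ h) h≡0 , refl , refl) (h≡0 , refl , refl)
  go true  = turning (turn true false) (h≡0 , refl , refl) (trans (ℤ.+-identityʳ h) h≡0 , refl , refl)
conflict-right (suc n) h r s eq = go r
  where
  h+0≡ : h +ᶻ 0ℤ ≡ +[1+ n ]
  h+0≡ = trans (ℤ.+-identityʳ h) (trans (sym (+-1-cancel h)) (cong (_+ᶻ -1ℤ) eq))
  red : Push (h +ᶻ 0ℤ) true false
  red = push-right _ _ _ (n , h+0≡) refl refl
  go : ∀ r → Join h (E₂ ∷ E₀ ∷ s) (hor r) (hor (not r))
  go false = commuting (λ ()) red red
  go true  = commuting (λ ()) red red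

conflict-left : ∀ n h r s → h +ᶻ -1ℤ ≡ -[1+ n ] → Join h (E₀ ∷ E₂ ∷ s) (hor r) (hor (not r))
conflict-left zero h r s eq = go r
  where
  h≡0 : h ≡ 0ℤ
  h≡0 = trans (sym (-1+-cancel h)) (cong (_+ᶻ 1ℤ) eq)
  go : ∀ r → Join h (E₀ ∷ E₂ ∷ s) (hor r) (hor (not r))
  go false = turning (turn false false) (h≡0 , refl , refl) (trans (ℤ.+-identityʳ h) h≡0 , refl , refl)
  go true  = turning (turn true true) (trans (ℤ.+-identityʳ h) h≡0 , refl , refl) (h≡0 , refl , refl)
conflict-left (suc n) h r s eq = go r
  where
  h+0≡ : h +ᶻ 0ℤ ≡ -[1+ n ]
  h+0≡ = trans (ℤ.+-identityʳ h) (trans (sym (-1+-cancel h)) (cong (_+ᶻ 1ℤ) eq))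
  red : Push (h +ᶻ 0ℤ) false true
  red = push-left _ _ _ (n , h+0≡) refl refl
  go : ∀ r → Join h (E₀ ∷ E₂ ∷ s) (hor r) (hor (not r))
  go false = commuting (λ ()) red red
  go true  = commuting (λ ()) red red

both : ∀ x r c → bit r c ≡ x → bit (not r) c ≡ x → c ≡ (x , x)
both x false (i , j) refl refl = refl
both x true  (i , j) refl refl = refl

conflict-hor : ∀ h r c d s → Push (h +ᶻ exc c) (bit r c) (bit r d) →
               Push (h +ᶻ exc c) (bit (not r) c) (bit (not r) d) →
               Join h (c ∷ d ∷ s) (hor r) (hor (not r))
conflict-hor h r c d s p q with h +ᶻ exc c in eqh | bit r c in c₁ | bit r d in d₁ | pushed _ _ _ p
                              | bit (not r) c in c₂ | bit (not r) d in d₂ | pushed _ _ _ q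
... | +[1+ n ] | _ | _ | right | _ | _ | right
  with refl ← both true r c c₁ c₂ | refl ← both false r d d₁ d₂ = conflict-right n h r s eqh
... | -[1+ n ] | _ | _ | left  | _ | _ | left
  with refl ← both false r c c₁ c₂ | refl ← both true r d d₁ d₂ = conflict-left n h r s eqh

exc-false : ∀ r d → bit r d ≡ false → exc d ≡ 0ℤ ⊎ exc d ≡ -1ℤ
exc-false false D  _ = inj₁ refl
exc-false false E₀ _ = inj₂ refl
exc-false true  U  _ = inj₁ refl
exc-false true  E₀ _ = inj₂ refl

exc-true : ∀ r d → bit r d ≡ true → exc d ≡ 0ℤ ⊎ exc d ≡ 1ℤ
exc-true false U  _ = inj₁ refl
exc-true false E₂ _ = inj₂ refl
exc-true true  D  _ = inj₁ refl
exc-true true  E₂ _ = inj₂ refl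

-- Two reductions cannot push the same particle, or two particles into the same
-- place, in opposite directions: the height changes by at most one per column.
no-clash : ∀ h r d x y → Push h x (bit r d) → ¬ Push (h +ᶻ exc d) (bit r d) y
no-clash h r d x y p q with bit r d in eqd | pushed h x _ p
no-clash +[1+ n ] r d x y p q | false | right with exc d | exc-false r d eqd | y
... | _ | inj₁ refl | true  = q
... | _ | inj₁ refl | false = q
no-clash +[1+ zero ]  r d x y p q | false | right | _ | inj₂ refl | true  = q
no-clash +[1+ zero ]  r d x y p q | false | right | _ | inj₂ refl | false = q
no-clash +[1+ suc n ] r d x y p q | false | right | _ | inj₂ refl | true  = q
no-clash +[1+ suc n ] r d x y p q | false | right | _ | inj₂ refl | false = q
no-clash -[1+ n ] r d x y p q | true | left with exc d | exc-true r d eqd | y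
... | _ | inj₁ refl | true  = q
... | _ | inj₁ refl | false = q
no-clash -[1+ zero ]  r d x y p q | true | left | _ | inj₂ refl | true  = q
no-clash -[1+ zero ]  r d x y p q | true | left | _ | inj₂ refl | false = q
no-clash -[1+ suc n ] r d x y p q | true | left | _ | inj₂ refl | true  = q
no-clash -[1+ suc n ] r d x y p q | true | left | _ | inj₂ refl | false = q

Push-≢0 : ∀ h x y → Push h x y → h ≢ 0ℤ
Push-≢0 h x y p h≡0 with pushed h x y p
Push-≢0 _ _ _ p () | right
Push-≢0 _ _ _ p () | left

-- Only the middle column can be shared. In the same row the two pushes would compete for one place,
-- which `no-clash` excludes; in different rows neither touches the bits of the other.
conflict-hor-there : ∀ h r f c s → Red h (hor r) (c ∷ s) → Red h (there f) (c ∷ s) →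
                     Join h (c ∷ s) (hor r) (there f)
conflict-hor-there h r vert              c (d ∷ s)      p (h≡0 , _) = ⊥-elim (Push-≢0 _ _ _ p h≡0)
conflict-hor-there h r (hor r′)          c (d ∷ d′ ∷ s) p q with r ≟ᵇ r′
... | yes refl = ⊥-elim (no-clash _ r d _ _ p q)
... | no r≢r′  = commuting r≢r′
  (subst (λ k → Push k (bit r′ (flip r d)) (bit r′ d′))
         (sym (exc-hop-from h r c d (Push-≡not _ _ _ p)))
         (subst (λ j → Push (h +ᶻ exc c +ᶻ exc d) j (bit r′ d′))
                (sym (bit-flip-≢ d (r≢r′ ∘ sym))) q))
  (subst (Push (h +ᶻ exc c) (bit r c)) (sym (bit-flip-≢ d r≢r′)) p)
conflict-hor-there h r (there f)         c (d ∷ s)      p q =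
  commuting tt (subst (λ k → Red k f s) (sym (exc-hop-from h r c d (Push-≡not _ _ _ p))) q) p

-- A vertical reduction sits in a single column at height 0, so the height on both sides of the
-- column is 0 and no push crosses either boundary. The overlaps that remain are between horizontal
-- hops.
conflict : ∀ h e f s → Red h e s → Red h f s → e ≡ f ⊎ Join h s e f
conflict h vert      vert      s           p q = inj₁ refl
conflict h vert      (hor r)   (U ∷ d ∷ s) (refl , refl , refl) q = ⊥-elim (Push-≢0 0ℤ (bit r U) (bit r d) q refl)
conflict h vert      (there f) (_ ∷ s)     p@(_ , refl , refl) q = inj₂ (commuting tt q p)
conflict h (hor r)   vert      (U ∷ d ∷ s) p (refl , refl , refl) = ⊥-elim (Push-≢0 0ℤ (bit r U) (bit r d) p refl)
conflict h (there f) vert      (_ ∷ s)     q p@(_ , refl , refl) = inj₂ (commuting tt p q)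
conflict h (hor r)   (hor r′)  (c ∷ d ∷ s) p q with r ≟ᵇ r′
... | yes refl = inj₁ refl
... | no r≢r′ with refl ← ≢⇒≡not r≢r′ = inj₂ (conflict-hor h r c d s p q)
conflict h (hor r)   (there f) (c ∷ s)     p q = inj₂ (conflict-hor-there h r f c s p q)
conflict h (there e) (hor r)   (c ∷ s)     p q = inj₂ (Join-sym (conflict-hor-there h r e c s q p))
conflict h (there e) (there f) (c ∷ s)     p q with conflict (h +ᶻ exc c) e f s p q
... | inj₁ refl = inj₁ refl
... | inj₂ j    = inj₂ (Join-there j)

toggle-turn : ∀ {e e′ f f′} s → Turn e e′ f f′ → Active e s →
              toggle e′ (toggle e s) ≡ toggle f′ (toggle f s)
toggle-turn ((i , j) ∷ (i′ , j′) ∷ s) (turn false false) _ =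
  cong₂ (λ i j′ → (i , not j) ∷ (not i′ , j′) ∷ s) (not-involutive i) (sym (not-involutive j′))
toggle-turn ((i , j) ∷ (i′ , j′) ∷ s) (turn false true) _ =
  cong₂ (λ j i′ → (not i , j) ∷ (i′ , not j′) ∷ s) (sym (not-involutive j)) (not-involutive i′)
toggle-turn ((i , j) ∷ (i′ , j′) ∷ s) (turn true false) _ =
  cong₂ (λ j i′ → (not i , j) ∷ (i′ , not j′) ∷ s) (not-involutive j) (sym (not-involutive i′))
toggle-turn ((i , j) ∷ (i′ , j′) ∷ s) (turn true true) _ =
  cong₂ (λ i j′ → (i , not j) ∷ (not i′ , j′) ∷ s) (sym (not-involutive i)) (not-involutive j′)
toggle-turn (c ∷ s) (there t) act = cong (c ∷_) (toggle-turn s t act)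

-- Weights of hops and their commutation

+-half : ∀ {n} x → x ℕ.+ x ≤ n → x ≤ ⌊ n /2⌋
+-half x le = subst (_≤ _) (sym (ℕ.n≡⌊n+n/2⌋ x)) (ℕ.⌊n/2⌋-mono le)

half-+ : ∀ {n x} → x ≤ ⌊ n /2⌋ → x ℕ.+ x ≤ n
half-+ {n} {x} le = begin
  x ℕ.+ x                   ≤⟨ ℕ.+-mono-≤ le (ℕ.≤-trans le (ℕ.⌊n/2⌋≤⌈n/2⌉ n)) ⟩
  ⌊ n /2⌋ ℕ.+ ⌈ n /2⌉       ≡⟨ ℕ.⌊n/2⌋+⌈n/2⌉≡n n ⟩
  n                         ∎
  where open ℕ.≤-Reasoning

<half : ∀ {L} x y → x ≤ y → x ℕ.+ y ℕ.+ 2 ≤ L → x < ⌊ L /2⌋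
<half {L} x y x≤y le = +-half (suc x) (begin
  suc x ℕ.+ suc x   ≡⟨ lemma x x ⟩
  x ℕ.+ x ℕ.+ 2     ≤⟨ ℕ.+-monoˡ-≤ 2 (ℕ.+-monoʳ-≤ x x≤y) ⟩
  x ℕ.+ y ℕ.+ 2     ≤⟨ le ⟩
  L                 ∎)
  where
  open ℕ.≤-Reasoning
  lemma : ∀ x y → ℕ.suc x ℕ.+ ℕ.suc y ≡ x ℕ.+ y ℕ.+ 2
  lemma = ℕ-Ring.solve-∀

exc-single : ∀ x y → x ≡ not y → exc (x , y) ≡ 0ℤ
exc-single true  false _ = refl
exc-single false true  _ = refl

abs-exc≤1 : ∀ c → abs (exc c) ≤ 1
abs-exc≤1 E₂ = s≤s z≤n
abs-exc≤1 U = z≤n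
abs-exc≤1 D = z≤n
abs-exc≤1 E₀ = s≤s z≤n

abs-total : ∀ s → abs (total s) ≤ length s
abs-total []      = z≤n
abs-total (c ∷ s) = ℕ.≤-trans (ℤ.∣i+j∣≤∣i∣+∣j∣ (exc c) (total s))
                              (ℕ.+-mono-≤ (abs-exc≤1 c) (abs-total s))

abs-height : ∀ h s → h +ᶻ total s ≡ 0ℤ → abs h ≤ length s
abs-height h s end = subst (_≤ length s) (sym eq) (abs-total s)
  where
  open ≡-Reasoning
  eq : abs h ≡ abs (total s)
  eq = begin
    abs h                                   ≡⟨ cong abs (lemma h (total s)) ⟩
    abs (h +ᶻ total s +ᶻ ℤ.- total s)       ≡⟨ cong (λ x → abs (x +ᶻ ℤ.- total s)) end ⟩
    abs (0ℤ +ᶻ ℤ.- total s)                 ≡⟨ cong abs (ℤ.+-identityˡ (ℤ.- total s)) ⟩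
    abs (ℤ.- total s)                       ≡⟨ ℤ.∣-i∣≡∣i∣ (total s) ⟩
    abs (total s)                           ∎
    where
    lemma : ∀ h t → h ≡ h +ᶻ t +ᶻ ℤ.- t
    lemma = ℤ-Ring.solve-∀

height-∷ : ∀ h c s → h +ᶻ total (c ∷ s) ≡ h +ᶻ exc c +ᶻ total s
height-∷ h c s = sym (ℤ.+-assoc h (exc c) (total s))

module Weights (L : ℕ) where

  open Group (G⁺ L) public
    using (_≈_; setoid; ∙-congˡ; ∙-congʳ)
  open GroupProperties (G⁺ L) public
    using (x∙y⁻¹≈ε⇒x≈y; ε⁻¹≈ε; ⁻¹-involutive; ⁻¹-anti-homo-∙; \\-leftDividesˡ; \\-leftDividesʳ; ∙-cancelˡ; inverseˡ-unique)
  module ≈-Reasoning where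
    open import Relation.Binary.Reasoning.Setoid setoid public

  ≡⇒≈ : ∀ {x y} → x ≡ y → x ≈ y
  ≡⇒≈ refl = ≈-refl

  -- α m is also 1 when m is out of range, where there is no symbol a m.
  α : ℤ → Word (Symbol L)
  α m with m ℤ.≟ 0ℤ | abs m ℕ.≤? ⌊ L ℕ.∸ 1 /2⌋
  ... | no m≢0 | yes b = gen (a m m≢0 b)
  ... | _      | _     = one

  α-index : ∀ x → α (index x) ≡ gen x
  α-index (a m m≢0 b) with m ℤ.≟ 0ℤ | abs m ℕ.≤? ⌊ L ℕ.∸ 1 /2⌋
  ... | no _    | yes _ = refl
  ... | no _    | no ¬b = ⊥-elim-irr (¬b b)
  ... | yes m≡0 | _     = ⊥-elim-irr (m≢0 m≡0)

  Commute : Word (Symbol L) → Word (Symbol L) → Set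
  Commute x y = x ∙ y ≈ y ∙ x

  commute-one : ∀ x → Commute x one
  commute-one x = ≈-trans (identityʳ x) (≈-sym (identityˡ x))

  commute-⁻¹ : ∀ {x y} → Commute x y → Commute x (y ⁻¹)
  commute-⁻¹ {x} {y} xy = ∙-cancelˡ y _ _ (begin
    y ∙ (x ∙ y ⁻¹)   ≈⟨ assoc y x (y ⁻¹) ⟨
    y ∙ x ∙ y ⁻¹     ≈⟨ ∙-congʳ xy ⟨
    x ∙ y ∙ y ⁻¹     ≈⟨ assoc x y (y ⁻¹) ⟩
    x ∙ (y ∙ y ⁻¹)   ≈⟨ ∙-congˡ (inverseʳ y) ⟩
    x ∙ one          ≈⟨ identityʳ x ⟩
    x                ≈⟨ \\-leftDividesˡ y x ⟨
    y ∙ (y ⁻¹ ∙ x)   ∎)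
    where open ≈-Reasoning

  commute-[,] : ∀ {x y} → [ x , y ] ≈ one → Commute x y
  commute-[,] {x} {y} [x,y]≈1 = x∙y⁻¹≈ε⇒x≈y (x ∙ y) (y ∙ x) (begin
    x ∙ y ∙ (y ∙ x) ⁻¹       ≈⟨ ∙-congˡ (⁻¹-anti-homo-∙ y x) ⟩
    x ∙ y ∙ (x ⁻¹ ∙ y ⁻¹)    ≈⟨ assoc (x ∙ y) (x ⁻¹) (y ⁻¹) ⟨
    [ x , y ]                ≈⟨ [x,y]≈1 ⟩
    one                      ∎)
    where open ≈-Reasoning

  α-commute : ∀ m n → InR L m n → Commute (α m) (α n)
  α-commute m n r with m ℤ.≟ 0ℤ | abs m ℕ.≤? ⌊ L ℕ.∸ 1 /2⌋
  ... | yes _  | yes _ = ≈-sym (commute-one (α n))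
  ... | yes _  | no _  = ≈-sym (commute-one (α n))
  ... | no _   | no _  = ≈-sym (commute-one (α n))
  ... | no m≢0 | yes b with n ℤ.≟ 0ℤ | abs n ℕ.≤? ⌊ L ℕ.∸ 1 /2⌋
  ... | yes _  | yes _  = commute-one _
  ... | yes _  | no _   = commute-one _
  ... | no _   | no _   = commute-one _
  ... | no n≢0 | yes b′ = commute-[,] (relation (commute (a m m≢0 b) (a n n≢0 b′) r))

  wt : ℤ → Hop → List Col → Word (Symbol L)
  wt h vert      []            = one
  wt h vert      ((x , _) ∷ s) = if x then α h else α h ⁻¹
  wt h (hor r)   s             = one
  wt h (there e) []            = one
  wt h (there e) (c ∷ s)       = wt (h +ᶻ exc c) e s

  wt-flat : ∀ h e s → Flat h e s → wt h e s ≈ one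
  wt-flat h vert      []                refl = ≈-refl
  wt-flat h vert      ((true  , _) ∷ s) refl = ≈-refl
  wt-flat h vert      ((false , _) ∷ s) refl = ε⁻¹≈ε
  wt-flat h (hor r)   s                 flat = ≈-refl
  wt-flat h (there e) (c ∷ s)           flat = wt-flat (h +ᶻ exc c) e s flat

  wt-toggle : ∀ h e s → Active e s → wt h e (toggle e s) ≈ wt h e s ⁻¹
  wt-toggle h vert      (U ∷ s) act = ≈-refl
  wt-toggle h vert      (D ∷ s) act = ≈-sym (⁻¹-involutive (α h))
  wt-toggle h (hor r)   s       act = ≈-sym ε⁻¹≈ε
  wt-toggle h (there e) (c ∷ s) act = wt-toggle (h +ᶻ exc c) e s act

  wt-disj : ∀ h e f s → Disj e f → Active e s → wt h f (toggle e s) ≡ wt h f s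
  wt-disj h vert      (there f) ((x , y) ∷ s)  _ act =
    cong (λ x → wt (h +ᶻ x) f s) (exc-vert x y act)
  wt-disj h (hor r)   (hor r′)          s      _ act = refl
  wt-disj h (hor r)   (there (hor r′))  (c ∷ d ∷ s) _ act = refl
  wt-disj h (hor r)   (there (there f)) (c ∷ d ∷ s) _ act =
    cong (λ x → wt x f s) (exc-hop-from h r c d act)
  wt-disj h (there e) vert              (c ∷ s) _ act = refl
  wt-disj h (there (hor x)) (hor r)     (c ∷ s) _ act = refl
  wt-disj h (there (there e)) (hor r)   (c ∷ s) _ act = refl
  wt-disj h (there e) (there f)         (c ∷ s) d act = wt-disj (h +ᶻ exc c) e f s d act

  -- Since ∣m∣ ≤ A, ∣m - h∣ ≤ B and ∣h∣ ≤ C bound the three sides of a degenerate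
  -- triangle, the largest of them is at most half of A + B + C.
  InR-bound : ∀ m h {A B C} → abs m ≤ A → abs (m ℤ.- h) ≤ B → abs h ≤ C →
              A ℕ.+ B ℕ.+ C ℕ.+ 2 ≤ L → InR L m h
  InR-bound m h {A} {B} {C} m≤ d≤ h≤ le =
    ℕ.⊔-pres-<m (ℕ.⊔-pres-<m
      (<half (abs m) (abs d ℕ.+ abs h)
        (ℕ.≤-trans (ℕ.≤-reflexive (cong abs (lemma₁ m h))) (ℤ.∣i+j∣≤∣i∣+∣j∣ d h))
        (ℕ.≤-trans (ℕ.≤-reflexive (eq₁ (abs m) (abs d) (abs h))) sum≤))
      (<half (abs h) (abs m ℕ.+ abs d)
        (ℕ.≤-trans (ℕ.≤-reflexive (cong abs (lemma₂ m h))) (ℤ.∣i-j∣≤∣i∣+∣j∣ m d))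
        (ℕ.≤-trans (ℕ.≤-reflexive (eq₂ (abs m) (abs d) (abs h))) sum≤)))
      (<half (abs d) (abs m ℕ.+ abs h)
        (ℤ.∣i-j∣≤∣i∣+∣j∣ m h)
        (ℕ.≤-trans (ℕ.≤-reflexive (eq₃ (abs m) (abs d) (abs h))) sum≤))
    where
    d = m ℤ.- h
    sum≤ : abs m ℕ.+ abs d ℕ.+ abs h ℕ.+ 2 ≤ L
    sum≤ = ℕ.≤-trans (ℕ.+-monoˡ-≤ 2 (ℕ.+-mono-≤ (ℕ.+-mono-≤ m≤ d≤) h≤)) le
    lemma₁ : ∀ m h → m ≡ m ℤ.- h +ᶻ h
    lemma₁ = ℤ-Ring.solve-∀
    lemma₂ : ∀ m h → h ≡ m ℤ.- (m ℤ.- h)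
    lemma₂ = ℤ-Ring.solve-∀
    eq₁ : ∀ x y z → x ℕ.+ (y ℕ.+ z) ℕ.+ 2 ≡ x ℕ.+ y ℕ.+ z ℕ.+ 2
    eq₁ = ℕ-Ring.solve-∀
    eq₂ : ∀ x y z → z ℕ.+ (x ℕ.+ y) ℕ.+ 2 ≡ x ℕ.+ y ℕ.+ z ℕ.+ 2
    eq₂ = ℕ-Ring.solve-∀
    eq₃ : ∀ x y z → y ℕ.+ (x ℕ.+ z) ℕ.+ 2 ≡ x ℕ.+ y ℕ.+ z ℕ.+ 2
    eq₃ = ℕ-Ring.solve-∀

  -- A stands for the columns left of the first hop and B for those between the hops; as the height
  -- changes by at most one per column, they bound |m| and |m-h|. Likewise |h| is bounded by the
  -- columns right of the second hop, and the two hops occupy the two columns that `InR-bound` asks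
  -- for in addition.
  α-wt-commute : ∀ m {A} B h f s → abs m ≤ A → abs (m ℤ.- h) ≤ B →
                 A ℕ.+ B ℕ.+ length s < L → h +ᶻ total s ≡ 0ℤ → Active f s →
                 Commute (α m) (wt h f s)
  α-wt-commute m {A} B h vert (c@(x , y) ∷ s) m≤ d≤ lt end act = go x
    where
    h≤ : abs h ≤ length s
    h≤ = abs-height h s (trans (cong (h +ᶻ_)
           (trans (sym (ℤ.+-identityˡ (total s))) (cong (_+ᶻ total s) (sym (exc-single x y act))))) end)
    r : InR L m h
    r = InR-bound m h m≤ d≤ h≤ (ℕ.≤-trans (ℕ.≤-reflexive (eq A B (length s))) lt)
      where
      eq : ∀ A B C → A ℕ.+ B ℕ.+ C ℕ.+ 2 ≡ ℕ.suc (A ℕ.+ B ℕ.+ ℕ.suc C)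
      eq = ℕ-Ring.solve-∀
    go : ∀ x → Commute (α m) (if x then α h else α h ⁻¹)
    go true  = α-commute m h r
    go false = commute-⁻¹ (α-commute m h r)
  α-wt-commute m B h (hor r)   s       m≤ d≤ lt end act = commute-one (α m)
  α-wt-commute m {A} B h (there f) (c ∷ s) m≤ d≤ lt end act =
    α-wt-commute m (suc B) (h +ᶻ exc c) f s m≤ d′≤
      (ℕ.≤-trans (ℕ.≤-reflexive (eq A B (length s))) lt)
      (trans (sym (height-∷ h c s)) end) act
    where
    lemma : ∀ m h x → m ℤ.- (h +ᶻ x) ≡ (m ℤ.- h) ℤ.- x
    lemma = ℤ-Ring.solve-∀
    eq : ∀ A B C → ℕ.suc (A ℕ.+ ℕ.suc B ℕ.+ C) ≡ ℕ.suc (A ℕ.+ B ℕ.+ ℕ.suc C)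
    eq = ℕ-Ring.solve-∀
    d′≤ : abs (m ℤ.- (h +ᶻ exc c)) ≤ suc B
    d′≤ = begin
      abs (m ℤ.- (h +ᶻ exc c))            ≡⟨ cong abs (lemma m h (exc c)) ⟩
      abs ((m ℤ.- h) ℤ.- exc c)           ≤⟨ ℤ.∣i-j∣≤∣i∣+∣j∣ (m ℤ.- h) (exc c) ⟩
      abs (m ℤ.- h) ℕ.+ abs (exc c)       ≤⟨ ℕ.+-mono-≤ d≤ (abs-exc≤1 c) ⟩
      B ℕ.+ 1                             ≡⟨ ℕ.+-comm B 1 ⟩
      suc B                               ∎
      where open ℕ.≤-Reasoning

  -- The columns left of both hops are stripped off first; i counts them and thereby bounds the
  -- height at which the first hop takes place.
  wt-commute : ∀ i h e f s → abs h ≤ i → i ℕ.+ length s ≤ L → h +ᶻ total s ≡ 0ℤ →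
               Disj e f → Active e s → Active f s → Commute (wt h e s) (wt h f s)
  wt-commute-vert : ∀ i h f s → abs h ≤ i → i ℕ.+ length s ≤ L → h +ᶻ total s ≡ 0ℤ →
               Active vert s → Active (there f) s → Commute (wt h vert s) (wt h (there f) s)
  wt-commute-vert i h f (c@(x , y) ∷ s) h≤ le end act act′ = go x
    where
    exc≡0 = exc-single x y act
    α-commutes : Commute (α h) (wt (h +ᶻ exc c) f s)
    -- The column of the vertical hop is single and keeps the height, so the hops are still 0
    -- columns apart behind it.
    α-commutes = α-wt-commute h 0 (h +ᶻ exc c) f s h≤
      (ℕ.≤-reflexive (trans (cong (λ z → abs (h ℤ.- (h +ᶻ z))) exc≡0) (cong abs (lemma h))))
      (ℕ.≤-trans (ℕ.≤-reflexive (eq i (length s))) le)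
      (trans (sym (height-∷ h c s)) end) act′
      where
      lemma : ∀ h → h ℤ.- (h +ᶻ 0ℤ) ≡ 0ℤ
      lemma = ℤ-Ring.solve-∀
      eq : ∀ A C → ℕ.suc (A ℕ.+ 0 ℕ.+ C) ≡ A ℕ.+ ℕ.suc C
      eq = ℕ-Ring.solve-∀
    go : ∀ x → Commute (if x then α h else α h ⁻¹) (wt (h +ᶻ exc c) f s)
    go true  = α-commutes
    go false = ≈-sym (commute-⁻¹ (≈-sym α-commutes))
  wt-commute i h vert      (there f) s       h≤ le end _ act act′ =
    wt-commute-vert i h f s h≤ le end act act′
  wt-commute i h (there e) vert      s       h≤ le end _ act act′ =
    ≈-sym (wt-commute-vert i h e s h≤ le end act′ act)
  wt-commute i h (hor r)   f         s       h≤ le end _ act act′ = ≈-sym (commute-one _)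
  wt-commute i h (there e) (hor r)   s       h≤ le end _ act act′ = commute-one _
  wt-commute i h (there e) (there f) (c ∷ s) h≤ le end d act act′ =
    wt-commute (suc i) (h +ᶻ exc c) e f s h′≤
      (ℕ.≤-trans (ℕ.≤-reflexive (sym (ℕ.+-suc i (length s)))) le)
      (trans (sym (height-∷ h c s)) end) d act act′
    where
    h′≤ : abs (h +ᶻ exc c) ≤ suc i
    h′≤ = ℕ.≤-trans (ℤ.∣i+j∣≤∣i∣+∣j∣ h (exc c))
      (ℕ.≤-trans (ℕ.+-mono-≤ h≤ (abs-exc≤1 c)) (ℕ.≤-reflexive (ℕ.+-comm i 1)))

  Valid : List Col → Set
  Valid s = length s ≡ L × total s ≡ 0ℤ

  -- A hop does not change the height at which a disjoint hop takes place, so everything reduces to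
  -- two weights at the same configuration.
  wt-swap : ∀ e f s → Valid s → Disj e f → Active e s → Active f s →
            wt 0ℤ e s ∙ wt 0ℤ f (toggle e s) ≈ wt 0ℤ f s ∙ wt 0ℤ e (toggle f s)
  wt-swap e f s (len , tot) d act act′ = begin
    wt 0ℤ e s ∙ wt 0ℤ f (toggle e s)   ≡⟨ cong (wt 0ℤ e s ∙_) (wt-disj 0ℤ e f s d act) ⟩
    wt 0ℤ e s ∙ wt 0ℤ f s              ≈⟨ wt-commute 0 0ℤ e f s z≤n (ℕ.≤-reflexive len)
                                            (trans (ℤ.+-identityˡ (total s)) tot) d act act′ ⟩
    wt 0ℤ f s ∙ wt 0ℤ e s              ≡⟨ cong (wt 0ℤ f s ∙_)
                                            (wt-disj 0ℤ f e s (Disj-sym e f d) act′) ⟨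
    wt 0ℤ f s ∙ wt 0ℤ e (toggle f s)   ∎
    where open ≈-Reasoning

-- Plugs as configurations of particles

xor-involutive : ∀ x y → (x xor y) xor y ≡ x
xor-involutive false false = refl
xor-involutive false true  = refl
xor-involutive true  false = refl
xor-involutive true  true  = refl

-- A place carries a particle iff it is white and in the plug, or black and not
-- in the plug.  The flag tells whether the lower square of the first column is
-- black.
cols : ∀ n → Bool → Subset (n ℕ.* 2) → List Col
cols zero    σ v           = []
cols (suc n) σ (x ∷ y ∷ v) = (x xor σ , y xor not σ) ∷ cols n (not σ) v

uncols : ∀ n → Bool → List Col → Subset (n ℕ.* 2)
uncols zero    σ _             = []
uncols (suc n) σ []            = Subset.⊥
uncols (suc n) σ ((x , y) ∷ s) = (x xor σ) ∷ (y xor not σ) ∷ uncols n (not σ) s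

cols-uncols : ∀ n σ s → length s ≡ n → cols n σ (uncols n σ s) ≡ s
cols-uncols zero    σ []            _  = refl
cols-uncols (suc n) σ ((x , y) ∷ s) eq =
  cong₂ _∷_ (cong₂ _,_ (xor-involutive x σ) (xor-involutive y (not σ)))
            (cols-uncols n (not σ) s (ℕ.suc-injective eq))

uncols-cols : ∀ n σ v → uncols n σ (cols n σ v) ≡ v
uncols-cols zero    σ []          = refl
uncols-cols (suc n) σ (x ∷ y ∷ v) =
  cong₂ _∷_ (xor-involutive x σ) (cong₂ _∷_ (xor-involutive y (not σ)) (uncols-cols n (not σ) v))

cols-injective : ∀ n σ {v w} → cols n σ v ≡ cols n σ w → v ≡ w
cols-injective n σ {v} {w} eq =
  trans (sym (uncols-cols n σ v)) (trans (cong (uncols n σ) eq) (uncols-cols n σ w))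

length-cols : ∀ n σ v → length (cols n σ v) ≡ n
length-cols zero    σ v           = refl
length-cols (suc n) σ (x ∷ y ∷ v) = cong suc (length-cols n (not σ) v)

-- Complementing a set of squares exchanges particles and vacancies.
total-cols-∁ : ∀ n σ v → total (cols n σ (∁ v)) ≡ ℤ.- total (cols n σ v)
total-cols-∁ zero    σ []          = refl
total-cols-∁ (suc n) σ (x ∷ y ∷ v) = trans
  (cong₂ _+ᶻ_ (col x y σ) (total-cols-∁ n (not σ) v))
  (sym (ℤ.neg-distrib-+ (exc (x xor σ , y xor not σ)) (total (cols n (not σ) v))))
  where
  col : ∀ x y σ → exc (not x xor σ , not y xor not σ) ≡ ℤ.- exc (x xor σ , y xor not σ)
  col false false false = refl
  col false false true  = refl
  col false true  false = refl
  col false true  true  = refl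
  col true  false false = refl
  col true  false true  = refl
  col true  true  false = refl
  col true  true  true  = refl

even : ℕ → Bool
even zero    = true
even (suc n) = not (even n)

2∣?-even : ∀ n → does (2 ∣? n) ≡ even n
2∣?-even zero          = refl
2∣?-even (suc zero)    = refl
2∣?-even (suc (suc n)) = trans
  (does-≡ (2 ∣? suc (suc n)) (map′ (∣m∣n⇒∣m+n (∣-refl {2})) (λ d → ∣m+n∣m⇒∣n d (∣-refl {2})) (2 ∣? n)))
  (trans (2∣?-even n) (sym (not-involutive (even n))))

whites : ∀ n → Bool → Subset (n ℕ.* 2)
whites zero    σ = []
whites (suc n) σ = not σ ∷ σ ∷ whites n (not σ)

whites-from : ∀ n k →
  tabulate (λ s → let (i , j) = remQuot {n} 2 s in does (2 ∣? (k ℕ.+ toℕ i ℕ.+ toℕ j)))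
  ≡ whites n (not (even k))
whites-from zero    k = refl
whites-from (suc n) k = cong₂ _∷_
  (trans (2∣?-even (k ℕ.+ 0 ℕ.+ 0)) (trans (cong even k+0+0) (sym (not-involutive (even k)))))
  (cong₂ _∷_
    (trans (2∣?-even (k ℕ.+ 0 ℕ.+ 1)) (cong even k+0+1))
    (trans (Vec.tabulate-cong (λ s → cong (λ m → does (2 ∣? (m ℕ.+ toℕ (proj₂ (remQuot {n} 2 s)))))
             (ℕ.+-suc k (toℕ (proj₁ (remQuot {n} 2 s))))))
           (whites-from n (suc k))))
  where
  k+0+0 : k ℕ.+ 0 ℕ.+ 0 ≡ k
  k+0+0 = trans (ℕ.+-identityʳ (k ℕ.+ 0)) (ℕ.+-identityʳ k)
  k+0+1 : k ℕ.+ 0 ℕ.+ 1 ≡ suc k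
  k+0+1 = trans (ℕ.+-comm (k ℕ.+ 0) 1) (cong suc (ℕ.+-identityʳ k))

white-rectangle : ∀ n → white (rectangle n 2) ≡ whites n false
white-rectangle n = whites-from n 0

-- The empty set has one particle per column, hence excess 0. Each white square put in adds a
-- particle, each black one takes one away.
size-whites : ∀ n σ v → + size (v ∩ whites n σ) ≡
              + size (v ∩ ∁ (whites n σ)) +ᶻ total (cols n σ v)
size-whites zero    σ []          = refl
size-whites (suc n) σ (x ∷ y ∷ v) = go x y σ
  where
  up : ∀ {i j} σ → + i ≡ + j +ᶻ total (cols n (not σ) v) →
       + suc i ≡ + j +ᶻ (1ℤ +ᶻ total (cols n (not σ) v))
  up {i} {j} σ eq = trans (cong (1ℤ +ᶻ_) eq) (lemma (+ j) (total (cols n (not σ) v)))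
    where
    lemma : ∀ j t → 1ℤ +ᶻ (j +ᶻ t) ≡ j +ᶻ (1ℤ +ᶻ t)
    lemma = ℤ-Ring.solve-∀
  down : ∀ {i j} σ → + i ≡ + j +ᶻ total (cols n (not σ) v) →
       + i ≡ + suc j +ᶻ (-1ℤ +ᶻ total (cols n (not σ) v))
  down {i} {j} σ eq = trans eq (lemma (+ j) (total (cols n (not σ) v)))
    where
    lemma : ∀ j t → j +ᶻ t ≡ 1ℤ +ᶻ j +ᶻ (-1ℤ +ᶻ t)
    lemma = ℤ-Ring.solve-∀
  zer : ∀ {i j} σ → + i ≡ + j +ᶻ total (cols n (not σ) v) →
       + i ≡ + j +ᶻ (0ℤ +ᶻ total (cols n (not σ) v))
  zer {i} {j} σ eq = trans eq (cong (+ j +ᶻ_) (sym (ℤ.+-identityˡ (total (cols n (not σ) v)))))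
  both′ : ∀ {i j} σ → + i ≡ + j +ᶻ total (cols n (not σ) v) →
       + suc i ≡ + suc j +ᶻ (0ℤ +ᶻ total (cols n (not σ) v))
  both′ {i} {j} σ eq = trans (cong (1ℤ +ᶻ_) eq) (lemma (+ j) (total (cols n (not σ) v)))
    where
    lemma : ∀ j t → 1ℤ +ᶻ (j +ᶻ t) ≡ 1ℤ +ᶻ j +ᶻ (0ℤ +ᶻ t)
    lemma = ℤ-Ring.solve-∀
  go : ∀ x y σ → + size ((x ∷ y ∷ v) ∩ whites (suc n) σ) ≡
       + size ((x ∷ y ∷ v) ∩ ∁ (whites (suc n) σ)) +ᶻ total (cols (suc n) σ (x ∷ y ∷ v))
  go false false false = zer false (size-whites n true v)
  go false false true  = zer true (size-whites n false v)
  go false true  false = down false (size-whites n true v)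
  go false true  true  = up true (size-whites n false v)
  go true  false false = up false (size-whites n true v)
  go true  false true  = down true (size-whites n false v)
  go true  true  false = both′ false (size-whites n true v)
  go true  true  true  = both′ true (size-whites n false v)

total⇒size : ∀ n v → total (cols n false v) ≡ 0ℤ →
             size (v ∩ whites n false) ≡ size (v ∩ ∁ (whites n false))
total⇒size n v eq = ℤ.+-injective (trans (size-whites n false v)
  (trans (cong (+ size (v ∩ ∁ (whites n false)) +ᶻ_) eq) (ℤ.+-identityʳ _)))

size⇒total : ∀ n v → size (v ∩ whites n false) ≡ size (v ∩ ∁ (whites n false)) →
             total (cols n false v) ≡ 0ℤ
size⇒total n v eq = begin
  t                ≡⟨ lemma t (+ j) ⟩
  (+ j +ᶻ t) ℤ.- + j ≡⟨ cong (ℤ._- + j) (size-whites n false v) ⟨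
  + size (v ∩ whites n false) ℤ.- + j ≡⟨ cong (λ i → + i ℤ.- + j) eq ⟩
  + j ℤ.- + j      ≡⟨ ℤ.+-inverseʳ (+ j) ⟩
  0ℤ               ∎
  where
  open ≡-Reasoning
  t = total (cols n false v)
  j = size (v ∩ ∁ (whites n false))
  lemma : ∀ t j → t ≡ (j +ᶻ t) ℤ.- j
  lemma = ℤ-Ring.solve-∀

-- Squares of the rectangle and the hops between them

suc² : ∀ {n} → Fin n → Fin (suc (suc n))
suc² s = suc (suc s)

-- The two squares come in a fixed order, left before right and first row before second. Each edge
-- of the ladder thus has one hop and one order, and a domino determines its hop.
data At : ∀ n → Hop → Fin (n ℕ.* 2) → Fin (n ℕ.* 2) → Set where
  vert  : ∀ {n} → At (suc n) vert zero (suc zero)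
  hor₀  : ∀ {n} → At (suc (suc n)) (hor false) zero (suc (suc zero))
  hor₁  : ∀ {n} → At (suc (suc n)) (hor true) (suc zero) (suc (suc (suc zero)))
  there : ∀ {n e s s′} → At n e s s′ → At (suc n) (there e) (suc (suc s)) (suc (suc s′))

At-functional : ∀ {n e s s′ u u′} → At n e s s′ → At n e u u′ → s ≡ u × s′ ≡ u′
At-functional vert      vert      = refl , refl
At-functional hor₀      hor₀      = refl , refl
At-functional hor₁      hor₁      = refl , refl
At-functional (there x) (there y) = map (cong suc²) (cong suc²) (At-functional x y)

At-injective : ∀ {n e f s s′} → At n e s s′ → At n f s s′ → e ≡ f
At-injective vert      vert      = refl
At-injective hor₀      hor₀      = refl
At-injective hor₁      hor₁      = refl
At-injective (there x) (there y) = cong there (At-injective x y)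

At-oriented : ∀ {n e f s s′} → At n e s s′ → ¬ At n f s′ s
At-oriented (there x) (there y) = At-oriented x y

At-distinct : ∀ {n e s s′} → At n e s s′ → s ≢ s′
At-distinct vert ()
At-distinct hor₀ ()
At-distinct hor₁ ()
At-distinct (there x) refl = At-distinct x refl

Apart : ∀ {n} → Fin n → Fin n → Fin n → Fin n → Set
Apart s s′ u u′ = s ≢ u × s ≢ u′ × s′ ≢ u × s′ ≢ u′

Disj⇒Apart : ∀ {n e f s s′ u u′} → Disj e f → At n e s s′ → At n f u u′ → Apart s s′ u u′
Disj⇒Apart d vert      (there y) = (λ ()) , (λ ()) , (λ ()) , (λ ())
Disj⇒Apart d hor₀      hor₀      = ⊥-elim (d refl)
Disj⇒Apart d hor₀      hor₁      = (λ ()) , (λ ()) , (λ ()) , (λ ())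
Disj⇒Apart d hor₁      hor₀      = (λ ()) , (λ ()) , (λ ()) , (λ ())
Disj⇒Apart d hor₁      hor₁      = ⊥-elim (d refl)
Disj⇒Apart d hor₀      (there hor₀) = ⊥-elim (d refl)
Disj⇒Apart d hor₀      (there hor₁) = (λ ()) , (λ ()) , (λ ()) , (λ ())
Disj⇒Apart d hor₁      (there hor₀) = (λ ()) , (λ ()) , (λ ()) , (λ ())
Disj⇒Apart d hor₁      (there hor₁) = ⊥-elim (d refl)
Disj⇒Apart d hor₀      (there (there y)) = (λ ()) , (λ ()) , (λ ()) , (λ ())
Disj⇒Apart d hor₁      (there (there y)) = (λ ()) , (λ ()) , (λ ()) , (λ ())
Disj⇒Apart d (there x) vert      = (λ ()) , (λ ()) , (λ ()) , (λ ())
Disj⇒Apart d (there hor₀) hor₀ = ⊥-elim (d refl)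
Disj⇒Apart d (there hor₀) hor₁ = (λ ()) , (λ ()) , (λ ()) , (λ ())
Disj⇒Apart d (there hor₁) hor₀ = (λ ()) , (λ ()) , (λ ()) , (λ ())
Disj⇒Apart d (there hor₁) hor₁ = ⊥-elim (d refl)
Disj⇒Apart d (there (there x)) hor₀ = (λ ()) , (λ ()) , (λ ()) , (λ ())
Disj⇒Apart d (there (there x)) hor₁ = (λ ()) , (λ ()) , (λ ()) , (λ ())
Disj⇒Apart d (there x) (there y) with Disj⇒Apart d x y
... | ¬p , ¬q , ¬r , ¬t = (λ { refl → ¬p refl }) , (λ { refl → ¬q refl }) ,
                      (λ { refl → ¬r refl }) , (λ { refl → ¬t refl })

Apart⇒Disj : ∀ {n e f s s′ u u′} → At n e s s′ → At n f u u′ → Apart s s′ u u′ → Disj e f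
Apart⇒Disj vert      vert      (¬p , _) = ¬p refl
Apart⇒Disj vert      hor₀      (¬p , _) = ¬p refl
Apart⇒Disj vert      hor₁      (_ , _ , ¬r , _) = ¬r refl
Apart⇒Disj vert      (there y) _ = tt
Apart⇒Disj hor₀      vert      (¬p , _) = ¬p refl
Apart⇒Disj hor₁      vert      (_ , ¬q , _) = ¬q refl
Apart⇒Disj hor₀      hor₀      (¬p , _) = ⊥-elim (¬p refl)
Apart⇒Disj hor₀      hor₁      _ = λ ()
Apart⇒Disj hor₁      hor₀      _ = λ ()
Apart⇒Disj hor₁      hor₁      (¬p , _) = ⊥-elim (¬p refl)
Apart⇒Disj hor₀      (there vert) (_ , _ , ¬r , _) = ¬r refl
Apart⇒Disj hor₁      (there vert) (_ , _ , _ , ¬t) = ¬t refl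
Apart⇒Disj hor₀      (there hor₀) (_ , _ , ¬r , _) = ⊥-elim (¬r refl)
Apart⇒Disj hor₀      (there hor₁) _ = λ ()
Apart⇒Disj hor₁      (there hor₀) _ = λ ()
Apart⇒Disj hor₁      (there hor₁) (_ , _ , ¬r , _) = ⊥-elim (¬r refl)
Apart⇒Disj hor₀      (there (there y)) _ = tt
Apart⇒Disj hor₁      (there (there y)) _ = tt
Apart⇒Disj (there x) vert      _ = tt
Apart⇒Disj (there vert) hor₀   (_ , ¬q , _) = ¬q refl
Apart⇒Disj (there vert) hor₁   (_ , _ , _ , ¬t) = ¬t refl
Apart⇒Disj (there hor₀) hor₀   (_ , ¬q , _) = ⊥-elim (¬q refl)
Apart⇒Disj (there hor₀) hor₁   _ = λ ()
Apart⇒Disj (there hor₁) hor₀   _ = λ ()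
Apart⇒Disj (there hor₁) hor₁   (_ , ¬q , _) = ⊥-elim (¬q refl)
Apart⇒Disj (there (there x)) hor₀ _ = tt
Apart⇒Disj (there (there x)) hor₁ _ = tt
Apart⇒Disj (there x) (there y) (¬p , ¬q , ¬r , ¬t) =
  Apart⇒Disj x y ((¬p ∘ cong suc²) , (¬q ∘ cong suc²) ,
                  (¬r ∘ cong suc²) , (¬t ∘ cong suc²))

flipAt : ∀ {n} → Fin n → Subset n → Subset n
flipAt s v = updateAt v s not

not-xor : ∀ x σ → not x xor σ ≡ not (x xor σ)
not-xor false σ = refl
not-xor true  σ = sym (not-involutive σ)

cols-flipAt : ∀ {n e s s′} σ v → At n e s s′ →
              cols n σ (flipAt s′ (flipAt s v)) ≡ toggle e (cols n σ v)
cols-flipAt σ (x ∷ y ∷ v) vert =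
  cong (_∷ cols _ (not σ) v) (cong₂ _,_ (not-xor x σ) (not-xor y (not σ)))
cols-flipAt σ (x ∷ y ∷ x′ ∷ y′ ∷ v) hor₀ =
  cong₂ (λ x x′ → (x , _) ∷ (x′ , _) ∷ _) (not-xor x σ) (not-xor x′ (not σ))
cols-flipAt σ (x ∷ y ∷ x′ ∷ y′ ∷ v) hor₁ =
  cong₂ (λ y y′ → (_ , y) ∷ (_ , y′) ∷ _) (not-xor y (not σ)) (not-xor y′ (not (not σ)))
cols-flipAt σ (x ∷ y ∷ v) (there at) = cong (_ ∷_) (cols-flipAt (not σ) v at)

xor-not : ∀ x σ → x xor σ ≡ not (x xor not σ)
xor-not false σ = sym (not-involutive σ)
xor-not true  σ = sym (not-involutive (not σ))

xor-cancelʳ : ∀ x y σ → x xor σ ≡ not (y xor not σ) → x ≡ y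
xor-cancelʳ false false σ     eq = refl
xor-cancelʳ true  true  σ     eq = refl
xor-cancelʳ false true  false ()
xor-cancelʳ false true  true  ()
xor-cancelʳ true  false false ()
xor-cancelʳ true  false true  ()

-- Neighbouring squares have opposite colours, so two that are both in or both out of the plug carry
-- one particle between them. This is why a domino is a hop.
≡⇒Active : ∀ {n e s s′} σ v → At n e s s′ → lookup v s ≡ lookup v s′ → Active e (cols n σ v)
≡⇒Active σ (x ∷ y ∷ v)           vert refl = xor-not x σ
≡⇒Active σ (x ∷ y ∷ x′ ∷ y′ ∷ v) hor₀ refl = xor-not x σ
≡⇒Active σ (x ∷ y ∷ x′ ∷ y′ ∷ v) hor₁ refl = xor-not y (not σ)
≡⇒Active σ (x ∷ y ∷ v)           (there at) eq = ≡⇒Active (not σ) v at eq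

Active⇒≡ : ∀ {n e s s′} σ v → At n e s s′ → Active e (cols n σ v) → lookup v s ≡ lookup v s′
Active⇒≡ σ (x ∷ y ∷ v)           vert act = xor-cancelʳ x y σ act
Active⇒≡ σ (x ∷ y ∷ x′ ∷ y′ ∷ v) hor₀ act = xor-cancelʳ x x′ σ act
Active⇒≡ σ (x ∷ y ∷ x′ ∷ y′ ∷ v) hor₁ act = xor-cancelʳ y y′ (not σ) act
Active⇒≡ σ (x ∷ y ∷ v)           (there at) act = Active⇒≡ (not σ) v at act

Active⇒At : ∀ n σ v e → Active e (cols n σ v) → ∃ λ s → ∃ λ s′ → At n e s s′
Active⇒At (suc n)       σ (x ∷ y ∷ v) vert        act = _ , _ , vert
Active⇒At (suc zero)    σ (x ∷ y ∷ []) (hor r)    ()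
Active⇒At (suc (suc n)) σ (x ∷ y ∷ x′ ∷ y′ ∷ v) (hor false) act = _ , _ , hor₀
Active⇒At (suc (suc n)) σ (x ∷ y ∷ x′ ∷ y′ ∷ v) (hor true)  act = _ , _ , hor₁
Active⇒At (suc n)       σ (x ∷ y ∷ v) (there e)   act =
  let s , s′ , at = Active⇒At n (not σ) v e act in _ , _ , there at

-suc-suc : ∀ m n → + suc m ℤ.- + suc n ≡ + m ℤ.- + n
-suc-suc m zero    = cong +_ (sym (ℕ.+-identityʳ m))
-suc-suc m (suc n) = ℤ.[1+m]⊖[1+n]≡m⊖n m (suc n)

dist : ∀ n → Fin (n ℕ.* 2) → Fin (n ℕ.* 2) → ℕ
dist n s s′ = let (x , y) = Region.corner (rectangle n 2) s ; (x′ , y′) = Region.corner (rectangle n 2) s′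
              in abs (x ℤ.- x′) ℕ.+ abs (y ℤ.- y′)

dist-suc² : ∀ n s s′ → dist (suc n) (suc² s) (suc² s′) ≡ dist n s s′
dist-suc² n s s′ =
  cong (λ x → abs x ℕ.+ abs (+ toℕ (proj₂ (remQuot {n} 2 s)) ℤ.- + toℕ (proj₂ (remQuot {n} 2 s′))))
       (-suc-suc (toℕ (proj₁ (remQuot {n} 2 s))) (toℕ (proj₁ (remQuot {n} 2 s′))))

At⇒Adjacent : ∀ {n e s s′} → At n e s s′ → Adjacent (rectangle n 2) s s′
At⇒Adjacent vert = refl
At⇒Adjacent hor₀ = refl
At⇒Adjacent hor₁ = refl
At⇒Adjacent {suc n} {s = suc (suc s)} {s′ = suc (suc s′)} (there at) =
  trans (dist-suc² n s s′) (At⇒Adjacent at)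

Adjacent⇒At : ∀ n s s′ → Adjacent (rectangle n 2) s s′ →
              ∃ λ e → At n e s s′ ⊎ At n e s′ s
Adjacent⇒At (suc n) zero zero ()
Adjacent⇒At (suc n) zero (suc zero) adj = vert , inj₁ vert
Adjacent⇒At (suc n) (suc zero) zero adj = vert , inj₂ vert
Adjacent⇒At (suc n) (suc zero) (suc zero) ()
Adjacent⇒At (suc (suc n)) zero (suc (suc zero)) adj = hor false , inj₁ hor₀
Adjacent⇒At (suc (suc n)) zero (suc (suc (suc zero))) ()
Adjacent⇒At (suc (suc n)) zero (suc (suc (suc (suc s)))) ()
Adjacent⇒At (suc (suc n)) (suc zero) (suc (suc zero)) ()
Adjacent⇒At (suc (suc n)) (suc zero) (suc (suc (suc zero))) adj = hor true , inj₁ hor₁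
Adjacent⇒At (suc (suc n)) (suc zero) (suc (suc (suc (suc s)))) ()
Adjacent⇒At (suc (suc n)) (suc (suc zero)) zero adj = hor false , inj₂ hor₀
Adjacent⇒At (suc (suc n)) (suc (suc (suc zero))) zero ()
Adjacent⇒At (suc (suc n)) (suc (suc (suc (suc s)))) zero ()
Adjacent⇒At (suc (suc n)) (suc (suc zero)) (suc zero) ()
Adjacent⇒At (suc (suc n)) (suc (suc (suc zero))) (suc zero) adj = hor true , inj₂ hor₁
Adjacent⇒At (suc (suc n)) (suc (suc (suc (suc s)))) (suc zero) ()
Adjacent⇒At (suc n) (suc (suc s)) (suc (suc s′)) adj
  with Adjacent⇒At n s s′ (trans (sym (dist-suc² n s s′)) adj)
... | e , inj₁ at = there e , inj₁ (there at)
... | e , inj₂ at = there e , inj₂ (there at)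

∪-⁅⁆ : ∀ {n} (v : Subset n) s → v ∪ ⁅ s ⁆ ≡ v [ s ]≔ true
∪-⁅⁆ (x ∷ v) zero    = cong₂ _∷_ (∨-zeroʳ x) (∪-⊥ v)
  where
  ∪-⊥ : ∀ {n} (v : Subset n) → v ∪ Subset.⊥ ≡ v
  ∪-⊥ []      = refl
  ∪-⊥ (x ∷ v) = cong₂ _∷_ (∨-identityʳ x) (∪-⊥ v)
∪-⁅⁆ (x ∷ v) (suc s) = cong₂ _∷_ (∨-identityʳ x) (∪-⁅⁆ v s)

-- Calculus of edge paths up to homotopy

module Homotopy (K : TwoComplex) where

  open TwoComplex K renaming (Edge to _⟶_; Cell to 2-Cell)

  infix 4 _~_

  _~_ : ∀ {u v} (p q : Path K u v) → Set
  _~_ = _≃_ K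

  ~-setoid : Vertex → Vertex → Setoid 0ℓ 0ℓ
  ~-setoid u v = record
    { Carrier = Path K u v ; _≈_ = _~_
    ; isEquivalence = record { refl = ≃-refl ; sym = ≃-sym ; trans = ≃-trans } }

  module ~-Reasoning {u v : Vertex} where
    open import Relation.Binary.Reasoning.Setoid (~-setoid u v) public

  ≡⇒~ : ∀ {u v} {p q : Path K u v} → p ≡ q → p ~ q
  ≡⇒~ refl = ≃-refl

  ◅◅-congˡ : ∀ {u v w} (p : Path K u v) {q r : Path K v w} → q ~ r → p ◅◅ q ~ p ◅◅ r
  ◅◅-congˡ p = ◅◅-cong (≃-refl {p = p})

  ◅◅-congʳ : ∀ {u v w} {p q : Path K u v} (r : Path K v w) → p ~ q → p ◅◅ r ~ q ◅◅ r
  ◅◅-congʳ r p~q = ◅◅-cong p~q (≃-refl {p = r})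

  ◅◅-identityʳ : ∀ {u v} (p : Path K u v) → p ◅◅ ε ≡ p
  ◅◅-identityʳ ε       = refl
  ◅◅-identityʳ (e ◅ p) = cong (e ◅_) (◅◅-identityʳ p)

  -- Defined without an accumulator, so that its laws go by induction on the path.
  inv : ∀ {u v} → Path K u v → Path K v u
  inv ε       = ε
  inv (e ◅ p) = inv p ◅◅ rev e ◅ ε

  backtrackˡ : ∀ {u v} (e : u ⟶ v) → rev e ◅ e ◅ ε ~ ε
  backtrackˡ e = subst (λ e′ → rev e ◅ e′ ◅ ε ~ ε) (rev-involutive e) (backtrack (rev e))

  inv-inverseʳ : ∀ {u v} (p : Path K u v) → p ◅◅ inv p ~ ε
  inv-inverseʳ ε       = ≃-refl
  inv-inverseʳ (e ◅ p) = begin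
    e ◅ p ◅◅ inv p ◅◅ rev e ◅ ε     ≡⟨ cong (e ◅_) (◅◅-assoc p (inv p) (rev e ◅ ε)) ⟨
    e ◅ (p ◅◅ inv p) ◅◅ rev e ◅ ε   ≈⟨ ◅◅-congˡ (e ◅ ε) (◅◅-congʳ (rev e ◅ ε) (inv-inverseʳ p)) ⟩
    e ◅ rev e ◅ ε                   ≈⟨ backtrack e ⟩
    ε                               ∎
    where open ~-Reasoning

  inv-inverseˡ : ∀ {u v} (p : Path K u v) → inv p ◅◅ p ~ ε
  inv-inverseˡ ε       = ≃-refl
  inv-inverseˡ (e ◅ p) = begin
    (inv p ◅◅ rev e ◅ ε) ◅◅ e ◅ p   ≡⟨ ◅◅-assoc (inv p) (rev e ◅ ε) (e ◅ p) ⟩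
    inv p ◅◅ rev e ◅ e ◅ p          ≈⟨ ◅◅-congˡ (inv p) (◅◅-congʳ p (backtrackˡ e)) ⟩
    inv p ◅◅ p                      ≈⟨ inv-inverseˡ p ⟩
    ε                               ∎
    where open ~-Reasoning

  inv◅◅-cancel : ∀ {u v w} (p : Path K u v) (q : Path K v w) → inv p ◅◅ p ◅◅ q ~ q
  inv◅◅-cancel p q =
    ≃-trans (≡⇒~ (sym (◅◅-assoc (inv p) p q))) (◅◅-congʳ q (inv-inverseˡ p))

  ◅◅inv-cancel : ∀ {u v w} (p : Path K u v) (q : Path K u w) → p ◅◅ inv p ◅◅ q ~ q
  ◅◅inv-cancel p q =
    ≃-trans (≡⇒~ (sym (◅◅-assoc p (inv p) q))) (◅◅-congʳ q (inv-inverseʳ p))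

  moveˡ : ∀ {u v w} (p : Path K u v) {q : Path K v w} {r : Path K u w} →
          p ◅◅ q ~ r → q ~ inv p ◅◅ r
  moveˡ p {q} eq = ≃-trans (≃-sym (inv◅◅-cancel p q)) (◅◅-congˡ (inv p) eq)

  moveʳ : ∀ {u v w} {p : Path K u v} (q : Path K v w) {r : Path K u w} →
          p ◅◅ q ~ r → p ~ r ◅◅ inv q
  moveʳ {p = p} q {r} eq = begin
    p                    ≡⟨ ◅◅-identityʳ p ⟨
    p ◅◅ ε               ≈⟨ ◅◅-congˡ p (inv-inverseʳ q) ⟨
    p ◅◅ q ◅◅ inv q      ≡⟨ ◅◅-assoc p q (inv q) ⟨
    (p ◅◅ q) ◅◅ inv q    ≈⟨ ◅◅-congʳ (inv q) eq ⟩
    r ◅◅ inv q           ∎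
    where open ~-Reasoning

  moveˡ′ : ∀ {u v w} (p : Path K u v) {q : Path K v w} {r : Path K u w} →
           q ~ inv p ◅◅ r → p ◅◅ q ~ r
  moveˡ′ p {q} {r} eq = ≃-trans (◅◅-congˡ p eq) (◅◅inv-cancel p r)

  moveʳ′ : ∀ {u v w} {p : Path K u v} (q : Path K v w) {r : Path K u w} →
           p ~ r ◅◅ inv q → p ◅◅ q ~ r
  moveʳ′ {p = p} q {r} eq = begin
    p ◅◅ q                   ≈⟨ ◅◅-congʳ q eq ⟩
    (r ◅◅ inv q) ◅◅ q        ≡⟨ ◅◅-assoc r (inv q) q ⟩
    r ◅◅ inv q ◅◅ q          ≈⟨ ◅◅-congˡ r (inv-inverseˡ q) ⟩
    r ◅◅ ε                   ≡⟨ ◅◅-identityʳ r ⟩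
    r                        ∎
    where open ~-Reasoning

  inv-unique : ∀ {u v} (p : Path K u v) {q : Path K v u} → p ◅◅ q ~ ε → q ~ inv p
  inv-unique p eq = ≃-trans (moveˡ p eq) (≡⇒~ (◅◅-identityʳ (inv p)))

  inv-cong : ∀ {u v} {p q : Path K u v} → p ~ q → inv p ~ inv q
  inv-cong {p = p} {q} eq =
    inv-unique q (≃-trans (◅◅-congʳ (inv p) (≃-sym eq)) (inv-inverseʳ p))

  inv-involutive : ∀ {u v} (p : Path K u v) → inv (inv p) ~ p
  inv-involutive p = ≃-sym (inv-unique (inv p) (inv-inverseˡ p))

  inv-◅◅ : ∀ {u v w} (p : Path K u v) (q : Path K v w) → inv (p ◅◅ q) ≡ inv q ◅◅ inv p
  inv-◅◅ ε       q = sym (◅◅-identityʳ (inv q))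
  inv-◅◅ (e ◅ p) q =
    trans (cong (_◅◅ rev e ◅ ε) (inv-◅◅ p q)) (◅◅-assoc (inv q) (inv p) (rev e ◅ ε))

  -- The same square read from w to y instead of from x to z.
  rotate : ∀ {x y z w} (a₁ : Path K x y) (a₂ : Path K y z) (b₁ : Path K x w) (b₂ : Path K w z) →
           a₁ ◅◅ a₂ ~ b₁ ◅◅ b₂ → inv b₁ ◅◅ a₁ ~ b₂ ◅◅ inv a₂
  rotate a₁ a₂ b₁ b₂ eq =
    moveʳ a₂ (≃-trans (≡⇒~ (◅◅-assoc (inv b₁) a₁ a₂)) (≃-sym (moveˡ b₁ (≃-sym eq))))

  cancelʳ : ∀ {u v w} {p q : Path K u v} (r : Path K v w) → p ◅◅ r ~ q ◅◅ r → p ~ q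
  cancelʳ {p = p} {q} r eq = begin
    p                    ≈⟨ moveʳ r eq ⟩
    (q ◅◅ r) ◅◅ inv r    ≈⟨ moveʳ r ≃-refl ⟨
    q                    ∎
    where open ~-Reasoning

-- Changing vectors and subsets at two places

module _ {A : Set} where

  set₂ : ∀ {n} → Vec A n → Fin n → Fin n → A → A → Vec A n
  set₂ v s s′ x y = v [ s ]≔ x [ s′ ]≔ y

  lookup-set₂ : ∀ {n} (v : Vec A n) {s s′} x y → s ≢ s′ → lookup (set₂ v s s′ x y) s ≡ x
  lookup-set₂ v {s} x y s≢s′ =
    trans (Vec.lookup∘update′ s≢s′ (v [ s ]≔ x) y) (Vec.lookup∘update s v x)

  lookup-set₂′ : ∀ {n} (v : Vec A n) {s s′} x y → lookup (set₂ v s s′ x y) s′ ≡ y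
  lookup-set₂′ v {s} {s′} x y = Vec.lookup∘update s′ (v [ s ]≔ x) y

  lookup-set₂-≢ : ∀ {n} (v : Vec A n) {s s′ u} x y → u ≢ s → u ≢ s′ →
                  lookup (set₂ v s s′ x y) u ≡ lookup v u
  lookup-set₂-≢ v {s} {s′} x y u≢s u≢s′ =
    trans (Vec.lookup∘update′ u≢s′ (v [ s ]≔ x) y) (Vec.lookup∘update′ u≢s v x)

  set₂-comm : ∀ {n} (v : Vec A n) {s s′ u u′} x y z w → Apart s s′ u u′ →
              set₂ (set₂ v s s′ x y) u u′ z w ≡ set₂ (set₂ v u u′ z w) s s′ x y
  set₂-comm v {s} {s′} {u} {u′} x y z w (s≢u , s≢u′ , s′≢u , s′≢u′) = begin
    v [ s ]≔ x [ s′ ]≔ y [ u ]≔ z [ u′ ]≔ w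
      ≡⟨ cong (_[ u′ ]≔ w) (Vec.[]≔-commutes (v [ s ]≔ x) s′ u s′≢u) ⟩
    v [ s ]≔ x [ u ]≔ z [ s′ ]≔ y [ u′ ]≔ w
      ≡⟨ Vec.[]≔-commutes (v [ s ]≔ x [ u ]≔ z) s′ u′ s′≢u′ ⟩
    v [ s ]≔ x [ u ]≔ z [ u′ ]≔ w [ s′ ]≔ y
      ≡⟨ cong (λ v → v [ u′ ]≔ w [ s′ ]≔ y) (Vec.[]≔-commutes v s u s≢u) ⟩
    v [ u ]≔ z [ s ]≔ x [ u′ ]≔ w [ s′ ]≔ y
      ≡⟨ cong (_[ s′ ]≔ y) (Vec.[]≔-commutes (v [ u ]≔ z) s u′ s≢u′) ⟩
    v [ u ]≔ z [ u′ ]≔ w [ s ]≔ x [ s′ ]≔ y ∎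
    where open ≡-Reasoning

data Position {n} (s s′ : Fin n) : Fin n → Set where
  fst   : Position s s′ s
  snd   : Position s s′ s′
  other : ∀ {u} → u ≢ s → u ≢ s′ → Position s s′ u

position : ∀ {n} (s s′ u : Fin n) → Position s s′ u
position s s′ u with u ≟ s | u ≟ s′
... | yes refl | _        = fst
... | no _     | yes refl = snd
... | no u≢s   | no u≢s′  = other u≢s u≢s′

false≢true : ∀ {x} → x ≡ false → x ≢ true
false≢true refl ()

∈⇒true : ∀ {n} {s : Fin n} {v} → s ∈ v → lookup v s ≡ true
∈⇒true = Vec.[]=⇒lookup

true⇒∈ : ∀ {n} {s : Fin n} v → lookup v s ≡ true → s ∈ v
true⇒∈ {s = s} v = Vec.lookup⇒[]= s v

∉⇒false : ∀ {n} {s : Fin n} v → s ∉ v → lookup v s ≡ false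
∉⇒false v s∉v = ¬-not (s∉v ∘ true⇒∈ v)

false⇒∉ : ∀ {n} {s : Fin n} v → lookup v s ≡ false → s ∉ v
false⇒∉ v eq s∈v = false≢true eq (∈⇒true s∈v)

lookup-∁ : ∀ {n} (v : Subset n) s → lookup (∁ v) s ≡ not (lookup v s)
lookup-∁ v s = Vec.lookup-map s not v

∁-involutive : ∀ {n} (v : Subset n) → ∁ (∁ v) ≡ v
∁-involutive []      = refl
∁-involutive (x ∷ v) = cong₂ _∷_ (not-involutive x) (∁-involutive v)

∁-swap : ∀ {n} {v w : Subset n} → v ≡ ∁ w → w ≡ ∁ v
∁-swap {w = w} eq = trans (sym (∁-involutive w)) (cong ∁ (sym eq))

vec-ext : ∀ {n} {A : Set} (v w : Vec A n) → (∀ s → lookup v s ≡ lookup w s) → v ≡ w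
vec-ext []      []      eq = refl
vec-ext (x ∷ v) (y ∷ w) eq = cong₂ _∷_ (eq zero) (vec-ext v w (eq ∘ suc))

∪-⁅⁆∪⁅⁆ : ∀ {n} (v : Subset n) s s′ → v ∪ (⁅ s ⁆ ∪ ⁅ s′ ⁆) ≡ set₂ v s s′ true true
∪-⁅⁆∪⁅⁆ v s s′ = begin
  v ∪ (⁅ s ⁆ ∪ ⁅ s′ ⁆)      ≡⟨ Subset.∪-assoc v ⁅ s ⁆ ⁅ s′ ⁆ ⟨
  (v ∪ ⁅ s ⁆) ∪ ⁅ s′ ⁆      ≡⟨ ∪-⁅⁆ (v ∪ ⁅ s ⁆) s′ ⟩
  (v ∪ ⁅ s ⁆) [ s′ ]≔ true  ≡⟨ cong (_[ s′ ]≔ true) (∪-⁅⁆ v s) ⟩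
  set₂ v s s′ true true     ∎
  where open ≡-Reasoning

size-≔ : ∀ {n} (v : Subset n) s → size (v [ s ]≔ true) ≤ suc (size v)
size-≔ (true  ∷ v) zero    = ℕ.n≤1+n _
size-≔ (false ∷ v) zero    = ℕ.≤-refl
size-≔ (true  ∷ v) (suc s) = s≤s (size-≔ v s)
size-≔ (false ∷ v) (suc s) = size-≔ v s

size-set₂ : ∀ {n} (v : Subset n) s s′ → size (set₂ v s s′ true true) ≤ 2 ℕ.+ size v
size-set₂ v s s′ = ℕ.≤-trans (size-≔ (v [ s ]≔ true) s′) (s≤s (size-≔ v s))

-- Adding a domino to a tiling and removing one

module Fitting (D : Region) where
  open Region D

  Adjacent-sym : ∀ {s s′} → Adjacent D s s′ → Adjacent D s′ s
  Adjacent-sym {s} {s′} adj =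
    let (x , y) = corner s ; (x′ , y′) = corner s′
    in trans (cong₂ ℕ._+_ (ℤ.∣i-j∣≡∣j-i∣ x′ x) (ℤ.∣i-j∣≡∣j-i∣ y′ y)) adj

  Adjacent-irrefl : ∀ {s} → ¬ Adjacent D s s
  Adjacent-irrefl {s} adj with corner s
  ... | x , y rewrite ℤ.+-inverseʳ x | ℤ.+-inverseʳ y with () ← adj

  id-pairing : Pairing D
  id-pairing = allFin area

  -- Disjointness of v and w and tiling of what they leave free, in one record of pointwise
  -- equations. In this form both conditions can be followed when a plug and a pairing change at two
  -- squares.
  record Fits (v w : Subset area) (t : Pairing D) : Set where
    constructor fits
    field
      involutive : ∀ s → lookup t (lookup t s) ≡ s
      covers     : ∀ s → lookup v s ≡ false → lookup w s ≡ false → Adjacent D s (lookup t s)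
      avoids     : ∀ s → lookup v s ≡ true ⊎ lookup w s ≡ true → lookup t s ≡ s
      disjoint   : ∀ s → lookup v s ≡ true → lookup w s ≢ true

  Fits⇒IsTiling : ∀ {v w t} → Fits v w t → IsTiling D (∁ (v ∪ w)) t
  Fits⇒IsTiling {v} {w} {t} f = record
    { involutive = involutive
    ; covers = λ {s} s∈ → covers s
        (∉⇒false v (λ s∈v → Subset.x∈∁p⇒x∉p s∈ (Subset.x∈p∪q⁺ (inj₁ s∈v))))
        (∉⇒false w (λ s∈w → Subset.x∈∁p⇒x∉p s∈ (Subset.x∈p∪q⁺ (inj₂ s∈w))))
    ; avoids = λ {s} s∉ → avoids s
        ([ inj₁ ∘ ∈⇒true , inj₂ ∘ ∈⇒true ]′ (Subset.x∈p∪q⁻ v w (Subset.x∉∁p⇒x∈p s∉)))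
    }
    where open Fits f

  Fits⇒Disjoint : ∀ {v w t} → Fits v w t → Subset.Empty (v ∩ w)
  Fits⇒Disjoint {v} {w} f (s , s∈) =
    let s∈v , s∈w = Subset.x∈p∩q⁻ v w s∈ in Fits.disjoint f s (∈⇒true s∈v) (∈⇒true s∈w)

  ⇒Fits : ∀ {v w t} → IsTiling D (∁ (v ∪ w)) t → Subset.Empty (v ∩ w) → Fits v w t
  ⇒Fits {v} {w} {t} isT disj = record
    { involutive = involutive
    ; covers = λ s v≡ w≡ → covers (Subset.x∉p⇒x∈∁p
        ([ false⇒∉ v v≡ , false⇒∉ w w≡ ]′ ∘ Subset.x∈p∪q⁻ v w))
    ; avoids = λ s h → avoids (Subset.x∈p⇒x∉∁p (Subset.x∈p∪q⁺
        ([ inj₁ ∘ true⇒∈ v , inj₂ ∘ true⇒∈ w ]′ h)))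
    ; disjoint = λ s v≡ w≡ → disj (s , Subset.x∈p∩q⁺ (true⇒∈ v v≡ , true⇒∈ w w≡))
    }
    where open IsTiling isT

  Fits-id : ∀ {v w} → w ≡ ∁ v → Fits v w id-pairing
  Fits-id {v} refl = record
    { involutive = λ s → trans (cong (lookup id-pairing) (Vec.lookup-allFin s)) (Vec.lookup-allFin s)
    ; covers = λ s v≡ w≡ → contradiction (trans (lookup-∁ v s) (cong not v≡)) (false≢true w≡)
    ; avoids = λ s _ → Vec.lookup-allFin s
    ; disjoint = λ s v≡ w≡ → false≢true (trans (lookup-∁ v s) (cong not v≡)) w≡ }

  module _ {v w t s s′} (adj : Adjacent D s s′) (v-s : lookup v s ≡ false) (v-s′ : lookup v s′ ≡ false)
           (f : Fits (set₂ v s s′ true true) w t) where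
    private
      open Fits f
      s≢s′ : s ≢ s′
      s≢s′ refl = Adjacent-irrefl adj
      v′ = set₂ v s s′ true true
      t-s : lookup t s ≡ s
      t-s = avoids s (inj₁ (lookup-set₂ v true true s≢s′))
      t-s′ : lookup t s′ ≡ s′
      t-s′ = avoids s′ (inj₁ (lookup-set₂′ v true true))
      t′ = addDomino D s s′ t
      t′-s : lookup t′ s ≡ s′
      t′-s = lookup-set₂ t s′ s s≢s′
      t′-s′ : lookup t′ s′ ≡ s
      t′-s′ = lookup-set₂′ t s′ s

    Fits-add : Fits v w (addDomino D s s′ t)
    Fits-add = record { involutive = invol ; covers = cov ; avoids = av ; disjoint = dis }
      where
      invol : ∀ u → lookup t′ (lookup t′ u) ≡ u
      invol u with position s s′ u
      ... | fst = trans (cong (lookup t′) t′-s) t′-s′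
      ... | snd = trans (cong (lookup t′) t′-s′) t′-s
      ... | other u≢s u≢s′ = trans (cong (lookup t′) t′-u)
              (trans (lookup-set₂-≢ t s′ s
                (λ eq → u≢s (trans (sym (involutive u)) (trans (cong (lookup t) eq) t-s)))
                (λ eq → u≢s′ (trans (sym (involutive u)) (trans (cong (lookup t) eq) t-s′))))
                (involutive u))
        where
        t′-u : lookup t′ u ≡ lookup t u
        t′-u = lookup-set₂-≢ t s′ s u≢s u≢s′
      cov : ∀ u → lookup v u ≡ false → lookup w u ≡ false → Adjacent D u (lookup t′ u)
      cov u v-u w-u with position s s′ u
      ... | fst = subst (Adjacent D s) (sym t′-s) adj
      ... | snd = subst (Adjacent D s′) (sym t′-s′) (Adjacent-sym adj)
      ... | other u≢s u≢s′ = subst (Adjacent D u) (sym (lookup-set₂-≢ t s′ s u≢s u≢s′))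
              (covers u (trans (lookup-set₂-≢ v true true u≢s u≢s′) v-u) w-u)
      dis : ∀ u → lookup v u ≡ true → lookup w u ≢ true
      dis u v-u with position s s′ u
      ... | fst = contradiction v-u (false≢true v-s)
      ... | snd = contradiction v-u (false≢true v-s′)
      ... | other u≢s u≢s′ = disjoint u (trans (lookup-set₂-≢ v true true u≢s u≢s′) v-u)
      av : ∀ u → lookup v u ≡ true ⊎ lookup w u ≡ true → lookup t′ u ≡ u
      av u h with position s s′ u
      ... | other u≢s u≢s′ = trans (lookup-set₂-≢ t s′ s u≢s u≢s′)
              (avoids u ([ inj₁ ∘ trans (lookup-set₂-≢ v true true u≢s u≢s′) , inj₂ ]′ h))
      av u (inj₁ v-u) | fst = contradiction v-u (false≢true v-s)
      av u (inj₁ v-u) | snd = contradiction v-u (false≢true v-s′)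
      av u (inj₂ w-u) | fst = contradiction w-u (disjoint s (lookup-set₂ v true true s≢s′))
      av u (inj₂ w-u) | snd = contradiction w-u (disjoint s′ (lookup-set₂′ v true true))

  module _ {v w t s s′} (f : Fits v w t) (t-s : lookup t s ≡ s′) (s≢s′ : s ≢ s′) where
    private
      open Fits f
      t-s′ : lookup t s′ ≡ s
      t-s′ = trans (cong (lookup t) (sym t-s)) (involutive s)
      v′ = set₂ v s s′ true true
      t′ = set₂ t s s′ s s′

    Fits-uncovered : lookup v s ≡ false × lookup v s′ ≡ false × lookup w s ≡ false × lookup w s′ ≡ false
    Fits-uncovered =
      ¬-not (λ eq → s≢s′ (trans (sym (avoids s (inj₁ eq))) t-s)) ,
      ¬-not (λ eq → s≢s′ (trans (sym t-s′) (avoids s′ (inj₁ eq)))) ,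
      ¬-not (λ eq → s≢s′ (trans (sym (avoids s (inj₂ eq))) t-s)) ,
      ¬-not (λ eq → s≢s′ (trans (sym t-s′) (avoids s′ (inj₂ eq))))

    Fits-adjacent : Adjacent D s s′
    Fits-adjacent = let v-s , _ , w-s , _ = Fits-uncovered in subst (Adjacent D s) t-s (covers s v-s w-s)

    Fits-remove : Fits v′ w t′
    Fits-remove = record { involutive = invol ; covers = cov ; avoids = av ; disjoint = dis }
      where
      invol : ∀ u → lookup t′ (lookup t′ u) ≡ u
      invol u with position s s′ u
      ... | fst = trans (cong (lookup t′) (lookup-set₂ t s s′ s≢s′)) (lookup-set₂ t s s′ s≢s′)
      ... | snd = trans (cong (lookup t′) (lookup-set₂′ t s s′)) (lookup-set₂′ t s s′)
      ... | other u≢s u≢s′ = trans (cong (lookup t′) (lookup-set₂-≢ t s s′ u≢s u≢s′))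
              (trans (lookup-set₂-≢ t s s′
                (λ eq → u≢s′ (trans (sym (involutive u)) (trans (cong (lookup t) eq) t-s)))
                (λ eq → u≢s (trans (sym (involutive u)) (trans (cong (lookup t) eq) t-s′))))
                (involutive u))
      cov : ∀ u → lookup v′ u ≡ false → lookup w u ≡ false → Adjacent D u (lookup t′ u)
      cov u v-u w-u with position s s′ u
      ... | fst = contradiction (lookup-set₂ v true true s≢s′) (false≢true v-u)
      ... | snd = contradiction (lookup-set₂′ v true true) (false≢true v-u)
      ... | other u≢s u≢s′ = subst (Adjacent D u) (sym (lookup-set₂-≢ t s s′ u≢s u≢s′))
              (covers u (trans (sym (lookup-set₂-≢ v true true u≢s u≢s′)) v-u) w-u)
      av : ∀ u → lookup v′ u ≡ true ⊎ lookup w u ≡ true → lookup t′ u ≡ u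
      av u h with position s s′ u
      ... | fst = lookup-set₂ t s s′ s≢s′
      ... | snd = lookup-set₂′ t s s′
      ... | other u≢s u≢s′ = trans (lookup-set₂-≢ t s s′ u≢s u≢s′)
              (avoids u ([ inj₁ ∘ trans (sym (lookup-set₂-≢ v true true u≢s u≢s′)) , inj₂ ]′ h))
      dis : ∀ u → lookup v′ u ≡ true → lookup w u ≢ true
      dis u v-u with position s s′ u
      ... | fst = false≢true (proj₁ (proj₂ (proj₂ Fits-uncovered)))
      ... | snd = false≢true (proj₂ (proj₂ (proj₂ Fits-uncovered)))
      ... | other u≢s u≢s′ = disjoint u (trans (sym (lookup-set₂-≢ v true true u≢s u≢s′)) v-u)

    addDomino-remove : t ≡ addDomino D s s′ t′
    addDomino-remove = vec-ext t (addDomino D s s′ t′) λ u → sym (eq u)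
      where
      eq : ∀ u → lookup (addDomino D s s′ t′) u ≡ lookup t u
      eq u with position s s′ u
      ... | fst = trans (lookup-set₂ t′ s′ s s≢s′) (sym t-s)
      ... | snd = trans (lookup-set₂′ t′ s′ s) (sym t-s′)
      ... | other u≢s u≢s′ = trans (lookup-set₂-≢ t′ s′ s u≢s u≢s′) (lookup-set₂-≢ t s s′ u≢s u≢s′)

-- Edges with at most two dominoes

module Dominoes (L : ℕ) (3≤L : 3 ≤ L) where

  Rect : Region
  Rect = rectangle L 2

  K : TwoComplex
  K = dominoComplex Rect

  open Homotopy K public
  open Fitting Rect public
  open Weights L public using (Valid)

  N : ℕ
  N = L ℕ.* 2

  6≤N : 6 ≤ N
  6≤N = ℕ.*-monoˡ-≤ 2 3≤L

  π : Plug Rect → List Col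
  π p = cols L false (squares p)

  mkPlug : (v : Subset N) → .(total (cols L false v) ≡ 0ℤ) → Plug Rect
  mkPlug v tot = plug v (subst (λ w → size (v ∩ w) ≡ size (v ∩ ∁ w)) (sym (white-rectangle L))
                              (total⇒size L v tot))

  total-π : ∀ p → total (π p) ≡ 0ℤ
  -- The balance of a plug is an irrelevant field; deciding the equation in ℤ makes it usable.
  total-π (plug v bal) = recompute (total (cols L false v) ℤ.≟ 0ℤ)
    (size⇒total L v (subst (λ w → size (v ∩ w) ≡ size (v ∩ ∁ w)) (white-rectangle L) bal))

  Valid-π : ∀ p → Valid (π p)
  Valid-π p = length-cols L false (squares p) , total-π p

  plug-≡ : ∀ {p q : Plug Rect} → squares p ≡ squares q → p ≡ q
  plug-≡ {plug v _} {plug .v _} refl = refl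

  π-injective : ∀ {p q} → π p ≡ π q → p ≡ q
  π-injective eq = plug-≡ (cols-injective L false eq)

  abstract
    plugOf : ∀ s → Valid s → Plug Rect
    plugOf s (len , tot) = mkPlug (uncols L false s) (trans (cong total (cols-uncols L false s len)) tot)

    π-plugOf : ∀ s (val : Valid s) → π (plugOf s val) ≡ s
    π-plugOf s (len , _) = cols-uncols L false s len

  co : Plug Rect → Plug Rect
  co p = mkPlug (∁ (squares p)) (trans (total-cols-∁ L false (squares p)) (cong ℤ.-_ (total-π p)))

  -- If p = r = ∁ v, then p ⊆ v makes p empty and v everything, but N ≥ 6 > 4.
  distinct : ∀ {p r : Plug Rect} (v : Subset N) → (∀ s → lookup (squares p) s ≡ true → lookup v s ≡ true) →
             size v ≤ 4 ℕ.+ size (squares p) → squares r ≡ ∁ v → p ≢ r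
  distinct {p} v p⊆v le eq refl = ℕ.<⇒≱ (s≤s (s≤s (s≤s (s≤s (s≤s z≤n)))))
    (ℕ.≤-trans 6≤N (subst₂ (λ m n → m ≤ 4 ℕ.+ n) size-v size-p le))
    where
    p-false : ∀ s → lookup (squares p) s ≡ false
    p-false s = ¬-not λ p-s → contradiction
      (trans (cong (λ w → lookup w s) eq) (trans (lookup-∁ v s) (cong not (p⊆v s p-s))))
      (λ p-s′ → false≢true p-s′ p-s)
    p≡⊥ : squares p ≡ Subset.⊥
    p≡⊥ = vec-ext _ _ λ s → trans (p-false s) (sym (Vec.lookup-replicate s false))
    v≡⊤ : v ≡ Subset.⊤
    v≡⊤ = vec-ext _ _ λ s → trans (not-injective
      (trans (sym (lookup-∁ v s)) (trans (cong (λ w → lookup w s) (sym eq)) (p-false s))))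
      (sym (Vec.lookup-replicate s true))
    size-p : size (squares p) ≡ 0
    size-p = trans (cong size p≡⊥) (Subset.∣⊥∣≡0 N)
    size-v : size v ≡ N
    size-v = trans (cong size v≡⊤) (Subset.∣⊤∣≡n N)

  mkEdge : ∀ {p q} t → .(p ≢ q) → .(Fits (squares p) (squares q) t) → Edge Rect p q
  mkEdge t p≢q f = edge p≢q (Fits⇒Disjoint f) (tiling t (Fits⇒IsTiling f))

  edgePairing-rev : ∀ {p q} (e : Edge Rect p q) → edgePairing Rect (revEdge Rect e) ≡ edgePairing Rect e
  edgePairing-rev (edge _ _ (tiling _ _)) = refl
  edgePairing-rev (loop _ _)   = refl

  full : ∀ {p q} → .(squares q ≡ ∁ (squares p)) → Edge Rect p q
  full {p} {q} eq = mkEdge id-pairing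
    (distinct (squares p) (λ s eq → eq) (ℕ.m≤n+m _ 4) eq) (Fits-id eq)

  record Adds (e : Hop) (p q : Plug Rect) : Set where
    constructor adds
    field
      {s s′} : Fin N
      at    : At L e s s′
      free  : lookup (squares p) s ≡ false
      free′ : lookup (squares p) s′ ≡ false
      added : squares q ≡ set₂ (squares p) s s′ true true

    s≢s′ : s ≢ s′
    s≢s′ = At-distinct at

    adjacent : Adjacent Rect s s′
    adjacent = At⇒Adjacent at

    ⊆-added : ∀ u → lookup (squares p) u ≡ true → lookup (squares q) u ≡ true
    ⊆-added u p-u with position s s′ u
    ... | fst = contradiction p-u (false≢true free)
    ... | snd = contradiction p-u (false≢true free′)
    ... | other u≢s u≢s′ = trans (cong (λ v → lookup v u) added)
            (trans (lookup-set₂-≢ (squares p) true true u≢s u≢s′) p-u)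

    size-added : size (squares q) ≤ 2 ℕ.+ size (squares p)
    size-added = subst (λ v → size v ≤ 2 ℕ.+ size (squares p)) (sym added) (size-set₂ (squares p) s s′)

    added-s : lookup (squares q) s ≡ true
    added-s = trans (cong (λ v → lookup v s) added) (lookup-set₂ (squares p) true true s≢s′)

    added-s′ : lookup (squares q) s′ ≡ true
    added-s′ = trans (cong (λ v → lookup v s′) added) (lookup-set₂′ (squares p) true true)

    Fits-added : ∀ {w t} → Fits (squares q) w t → Fits (squares p) w (addDomino Rect s s′ t)
    Fits-added f = Fits-add adjacent free free′ (subst (λ v → Fits v _ _) added f)

  single : ∀ {e p q r} → Adds e p q → .(squares r ≡ ∁ (squares q)) → Edge Rect p r
  single {p = p} {q} {r} x eq = mkEdge (addDomino Rect s s′ id-pairing)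
    (distinct (squares q) ⊆-added (ℕ.≤-trans size-added (ℕ.m≤n+m _ 2)) eq)
    (Fits-added (Fits-id eq))
    where open Adds x

  -- Both p and q stand for even vertices, so adding a domino takes two edges: the domino lies on
  -- the first one, which ends at the odd vertex over `co q`, and the contracted edge leads on to q.
  add : ∀ {e p q} → Adds e p q → Path K p q
  add {q = q} x = single {r = co q} x refl ◅ full (sym (∁-involutive (squares q))) ◅ ε

  add-unique : ∀ {e p q} (x y : Adds e p q) → add x ≡ add y
  add-unique {e} {p} {q} x y = go x y (At-functional (Adds.at x) (Adds.at y))
    where
    go : (x y : Adds e p q) → Adds.s x ≡ Adds.s y × Adds.s′ x ≡ Adds.s′ y → add x ≡ add y
    go (adds _ _ _ _) (adds _ _ _ _) (refl , refl) = refl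

  -- The quadrilateral cell with corners `co q`, q, r, p. Its first edge carries no domino, so the
  -- cell splits the chosen domino off ϕ.
  peel : ∀ {e p q r} (x : Adds e p q) (ϕ : Edge Rect p r) (ψ : Edge Rect q r) →
         edgePairing Rect ϕ ≡ addDomino Rect (Adds.s x) (Adds.s′ x) (edgePairing Rect ψ) →
         ϕ ◅ ε ~ add x ◅◅ ψ ◅ ε
  peel {p = p} {q} {r} x ϕ ψ eq = ≃-sym (begin
    A ◅◅ V ◅◅ ψ ◅ ε             ≈⟨ ◅◅-congˡ A (moveʳ (A⁻¹ϕ) (≃-trans (≡⇒~ refl) (cell quad′))) ⟩
    A ◅◅ ε ◅◅ inv A⁻¹ϕ          ≈⟨ ◅◅-congˡ A (≃-sym (inv-unique A⁻¹ϕ ϕ⁻¹A)) ⟩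
    A ◅◅ inv A ◅◅ ϕ ◅ ε         ≈⟨ ◅◅inv-cancel A (ϕ ◅ ε) ⟩
    ϕ ◅ ε                       ∎)
    where
    open ~-Reasoning
    open Adds x
    A = single x refl ◅ ε
    V = full {co q} {q} (sym (∁-involutive (squares q))) ◅ ε
    A⁻¹ϕ = revEdge Rect ϕ ◅ A
    ϕ⁻¹A : A⁻¹ϕ ◅◅ inv A ◅◅ ϕ ◅ ε ~ ε
    ϕ⁻¹A = ≃-trans (◅◅-congˡ (revEdge Rect ϕ ◅ ε) (◅◅inv-cancel A (ϕ ◅ ε))) (backtrackˡ ϕ)
    quad′ = quad adjacent (false⇒∉ (squares p) free) (false⇒∉ (squares p) free′)
      (trans added (sym (∪-⁅⁆∪⁅⁆ (squares p) s s′)))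
      (full {co q} {q} (sym (∁-involutive (squares q)))) ψ (revEdge Rect ϕ) (single x refl)
      (trans (edgePairing-rev ϕ) eq) refl

  double : ∀ {e f p q r} t → Adds e p q → Adds f q t → .(squares r ≡ ∁ (squares t)) → Edge Rect p r
  double t x y eq = mkEdge
    (addDomino Rect (Adds.s x) (Adds.s′ x) (addDomino Rect (Adds.s y) (Adds.s′ y) id-pairing))
    (distinct (squares t) (λ u → Adds.⊆-added y u ∘ Adds.⊆-added x u)
      (ℕ.≤-trans (Adds.size-added y) (s≤s (s≤s (Adds.size-added x)))) eq)
    (Adds.Fits-added x (Adds.Fits-added y (Fits-id eq)))

  -- `peel` read backwards merges two additions into one edge that carries both dominoes.
  add-add : ∀ {e f p q t} (x : Adds e p q) (y : Adds f q t) (ϕ : Edge Rect p (co t)) →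
            edgePairing Rect ϕ ≡ edgePairing Rect (double {r = co t} t x y refl) →
            add x ◅◅ add y ~ ϕ ◅ full (sym (∁-involutive (squares t))) ◅ ε
  add-add {t = t} x y ϕ eq = ◅◅-congʳ (full (sym (∁-involutive (squares t))) ◅ ε)
    (≃-sym (peel x ϕ (single y refl) eq))

  -- A pairing does not record the order of its dominoes: both sides are the same edge with two
  -- dominoes, continued by the same edge back.
  add-comm : ∀ {e f p q q′ t} → Disj e f → (x : Adds e p q) (y : Adds f q t) (z : Adds f p q′) (w : Adds e q′ t) →
             add x ◅◅ add y ~ add z ◅◅ add w
  add-comm {t = t} d x y z w = ≃-trans
    (add-add x y (double t x y refl) refl)
    (≃-sym (add-add z w (double t x y refl) pairing≡))
    where
    pairing≡ : edgePairing Rect (double {r = co t} t x y refl) ≡ edgePairing Rect (double {r = co t} t z w refl)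
    pairing≡ with refl , refl ← At-functional (Adds.at x) (Adds.at w)
                | refl , refl ← At-functional (Adds.at y) (Adds.at z) =
      sym (set₂-comm id-pairing _ _ _ _ (Disj⇒Apart d (Adds.at x) (Adds.at y)))

-- Blocks of 2×2 squares, flips, and hops as paths

sq-corner : ∀ n → Fin (n ℕ.* 2) → ℤ × ℤ
sq-corner n = Region.corner (rectangle n 2)

shift : Bool → ℤ → ℤ
shift false x = x
shift true  x = x +ᶻ 1ℤ

shift² : Bool → Bool → ℤ × ℤ → ℤ × ℤ
shift² i j (x , y) = shift i x , shift j y

-- A 2×2 block of squares sq i j in column i and row j, with its horizontal
-- dominoes h j and its vertical dominoes v i.
record Block (n : ℕ) (h v : Bool → Hop) : Set where
  field
    sq      : Bool → Bool → Fin (n ℕ.* 2)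
    at-h    : ∀ j → At n (h j) (sq false j) (sq true j)
    at-v    : ∀ i → At n (v i) (sq i false) (sq i true)
    corners : ∀ i j → sq-corner n (sq i j) ≡ shift² i j (sq-corner n (sq false false))
    sq-≢₁   : ∀ i j {i′ j′} → i ≢ i′ → sq i j ≢ sq i′ j′
    sq-≢₂   : ∀ i j {i′ j′} → j ≢ j′ → sq i j ≢ sq i′ j′

Block-base : ∀ n → Block (suc (suc n)) hor side
Block-base n = record
  { sq = sq
  ; at-h = λ { false → hor₀ ; true → hor₁ }
  ; at-v = λ { false → vert ; true → there vert }
  ; corners = λ { false false → refl ; false true → refl ; true false → refl ; true true → refl }
  ; sq-≢₁ = ≢₁ ; sq-≢₂ = ≢₂ }
  where
  sq : Bool → Bool → Fin (suc (suc n) ℕ.* 2)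
  sq false false = zero
  sq false true  = suc zero
  sq true  false = suc² zero
  sq true  true  = suc² (suc zero)
  ≢₁ : ∀ i j {i′ j′} → i ≢ i′ → sq i j ≢ sq i′ j′
  ≢₁ false _     {false} ne _ = ne refl
  ≢₁ true  _     {true}  ne _ = ne refl
  ≢₁ false false {true} {false} ne ()
  ≢₁ false false {true} {true}  ne ()
  ≢₁ false true  {true} {false} ne ()
  ≢₁ false true  {true} {true}  ne ()
  ≢₁ true  false {false} {false} ne ()
  ≢₁ true  false {false} {true}  ne ()
  ≢₁ true  true  {false} {false} ne ()
  ≢₁ true  true  {false} {true}  ne ()
  ≢₂ : ∀ i j {i′ j′} → j ≢ j′ → sq i j ≢ sq i′ j′
  ≢₂ _     false {j′ = false} ne _ = ne refl
  ≢₂ _     true  {j′ = true}  ne _ = ne refl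
  ≢₂ false false {false} {true} ne ()
  ≢₂ false false {true}  {true} ne ()
  ≢₂ true  false {false} {true} ne ()
  ≢₂ true  false {true}  {true} ne ()
  ≢₂ false true  {false} {false} ne ()
  ≢₂ false true  {true}  {false} ne ()
  ≢₂ true  true  {false} {false} ne ()
  ≢₂ true  true  {true}  {false} ne ()

Block-there : ∀ {n h v} → Block n h v → Block (suc n) (there ∘ h) (there ∘ v)
Block-there {n} B = record
  { sq = λ i j → suc² (sq i j)
  ; at-h = there ∘ at-h ; at-v = there ∘ at-v
  ; corners = λ i j → trans (cong up (corners i j)) (up-shift i {j} (sq-corner n (sq false false)))
  ; sq-≢₁ = λ i j ne eq → sq-≢₁ i j ne (suc-injective (suc-injective eq))
  ; sq-≢₂ = λ i j ne eq → sq-≢₂ i j ne (suc-injective (suc-injective eq)) }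
  where
  open Block B
  up : ℤ × ℤ → ℤ × ℤ
  up (x , y) = 1ℤ +ᶻ x , y
  up-shift : ∀ i {j} xy → up (shift² i j xy) ≡ shift² i j (up xy)
  up-shift false (x , y) = refl
  up-shift true  (x , y) = cong (_, _) (sym (ℤ.+-assoc 1ℤ x 1ℤ))

record TurnIn (n : ℕ) (e e′ f f′ : Hop) : Set where
  constructor turnIn
  field
    {h v} : Bool → Hop
    block : Block n h v
    r c   : Bool
    e≡ : e ≡ h r
    e′≡ : e′ ≡ v c
    f≡ : f ≡ h (not r)
    f′≡ : f′ ≡ v (not c)

Turn⇒TurnIn : ∀ {n e e′ f f′ s s′} → Turn e e′ f f′ → At n e s s′ → TurnIn n e e′ f f′
Turn⇒TurnIn (turn r c) hor₀ = turnIn (Block-base _) r c refl refl refl refl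
Turn⇒TurnIn (turn r c) hor₁ = turnIn (Block-base _) r c refl refl refl refl
Turn⇒TurnIn (there t) (there at) with Turn⇒TurnIn t at
... | turnIn B r c refl refl refl refl = turnIn (Block-there B) r c refl refl refl refl

not-≢ : ∀ x → not x ≢ x
not-≢ false ()
not-≢ true  ()

flipAt-false : ∀ {n} (v : Subset n) s → lookup v s ≡ false → flipAt s v ≡ v [ s ]≔ true
flipAt-false v s eq = Vec.updateAt-cong-local s v (cong not eq)

module Moves (L : ℕ) (3≤L : 3 ≤ L) where

  open Dominoes L 3≤L public

  Adds-at : ∀ {e p q s s′} → Adds e p q → At L e s s′ →
            lookup (squares p) s ≡ false × lookup (squares p) s′ ≡ false ×
            squares q ≡ set₂ (squares p) s s′ true true
  Adds-at (adds at x y z) at′ with refl , refl ← At-functional at at′ = x , y , z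

  pairing-at : ∀ {e f p q t s s′ u u′} (x : Adds e p q) (y : Adds f q t) →
               At L e s s′ → At L f u u′ →
               edgePairing Rect (double {r = co t} t x y refl) ≡
               addDomino Rect s s′ (addDomino Rect u u′ id-pairing)
  pairing-at (adds at _ _ _) (adds at′ _ _ _) at₁ at₂
    with refl , refl ← At-functional at at₁ | refl , refl ← At-functional at′ at₂ = refl

  module _ {h v} (B : Block L h v) where
    open Block B
    private
      ≢ᵢ : ∀ {i j j′} → sq i j ≢ sq (not i) j′
      ≢ᵢ {i} {j} = sq-≢₁ i j (not-≢ i ∘ sym)
      ≢ⱼ : ∀ {i i′ j} → sq i j ≢ sq i′ (not j)
      ≢ⱼ {i} {i′} {j} = sq-≢₂ i j (not-≢ j ∘ sym)

    H-pairing V-pairing : Pairing Rect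
    H-pairing = addDomino Rect (sq false false) (sq true false)
                  (addDomino Rect (sq false true) (sq true true) id-pairing)
    V-pairing = addDomino Rect (sq false false) (sq false true)
                  (addDomino Rect (sq true false) (sq true true) id-pairing)

    pairing-H : ∀ r {p q t} (x : Adds (h r) p q) (y : Adds (h (not r)) q t) →
                edgePairing Rect (double {r = co t} t x y refl) ≡ H-pairing
    pairing-H false x y = pairing-at x y (at-h false) (at-h true)
    pairing-H true  x y = trans (pairing-at x y (at-h true) (at-h false))
      (set₂-comm id-pairing _ _ _ _ (≢ⱼ , ≢ⱼ , ≢ⱼ , ≢ⱼ))

    pairing-V : ∀ c {p q t} (x : Adds (v c) p q) (y : Adds (v (not c)) q t) →
                edgePairing Rect (double {r = co t} t x y refl) ≡ V-pairing
    pairing-V false x y = pairing-at x y (at-v false) (at-v true)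
    pairing-V true  x y = trans (pairing-at x y (at-v true) (at-v false))
      (set₂-comm id-pairing _ _ _ _ (≢ᵢ , ≢ᵢ , ≢ᵢ , ≢ᵢ))

    H-V-flip : Flip Rect H-pairing V-pairing
    H-V-flip = record
      { s₀₀ = sq false false ; s₁₀ = sq true false ; s₀₁ = sq false true ; s₁₁ = sq true true
      ; corner₁₀ = corners true false ; corner₀₁ = corners false true ; corner₁₁ = corners true true
      ; h-bottom = lookup-set₂ (addDomino Rect (sq false true) (sq true true) id-pairing) _ _ ≢ᵢ
      ; h-top    = trans (lookup-set₂-≢ (addDomino Rect (sq false true) (sq true true) id-pairing) _ _ ≢ⱼ ≢ⱼ)
                         (lookup-set₂ id-pairing _ _ ≢ᵢ)
      ; v-left   = lookup-set₂ (addDomino Rect (sq true false) (sq true true) id-pairing) _ _ ≢ⱼ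
      ; v-right  = trans (lookup-set₂-≢ (addDomino Rect (sq true false) (sq true true) id-pairing) _ _ ≢ᵢ ≢ᵢ)
                         (lookup-set₂ id-pairing _ _ ≢ⱼ)
      ; agree    = λ s n₀₀ n₁₀ n₀₁ n₁₁ → trans
          (trans (lookup-set₂-≢ (addDomino Rect (sq false true) (sq true true) id-pairing) _ _ n₀₀ n₁₀)
                 (lookup-set₂-≢ id-pairing _ _ n₀₁ n₁₁))
          (sym (trans (lookup-set₂-≢ (addDomino Rect (sq true false) (sq true true) id-pairing) _ _ n₀₀ n₀₁)
                      (lookup-set₂-≢ id-pairing _ _ n₁₀ n₁₁)))
      }

    -- Each side is one edge from p to `co t` with two dominoes filling the block, and these two
    -- edges bound a bigon. Its end points must differ, which is what `distinct` provides.
    add-flip : ∀ {r r′ c c′} → r′ ≡ not r → c′ ≡ not c →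
               ∀ {p q q′ t} (x : Adds (h r) p q) (y : Adds (h r′) q t)
               (z : Adds (v c) p q′) (w : Adds (v c′) q′ t) →
               add x ◅◅ add y ~ add z ◅◅ add w
    add-flip {r} {_} {c} refl refl {p} {q} {q′} {t} x y z w = begin
      add x ◅◅ add y   ≈⟨ add-add x y (double t x y refl) refl ⟩
      ϕ ◅ back ◅ ε     ≈⟨ ◅◅-congʳ (back ◅ ε) ϕ~ψ ⟩
      ψ ◅ back ◅ ε     ≈⟨ add-add z w (double t z w refl) refl ⟨
      add z ◅◅ add w   ∎
      where
      open ~-Reasoning
      back = full {co t} {t} (sym (∁-involutive (squares t)))
      ϕ ψ : Edge Rect p (co t)
      ϕ = double t x y refl
      ψ = double t z w refl
      p≢co-t : p ≢ co t
      p≢co-t = distinct (squares t) (λ u → Adds.⊆-added y u ∘ Adds.⊆-added x u)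
        (ℕ.≤-trans (Adds.size-added y) (s≤s (s≤s (Adds.size-added x)))) refl
      ϕ~ψ : ϕ ◅ ε ~ ψ ◅ ε
      ϕ~ψ = ≃-trans (moveʳ {p = ϕ ◅ ε} (revEdge Rect ψ ◅ ε)
              (cell (bigon p≢co-t ϕ ψ (subst₂ (Flip Rect) (sym (pairing-H r x y)) (sym (pairing-V c z w)) H-V-flip))))
            (≃-trans (≡⇒~ refl) (≃-sym (inv-unique (revEdge Rect ψ ◅ ε) (backtrackˡ ψ))))

  -- Unlike `Adds`, symmetric in p and q: the plug itself decides whether the domino is added or
  -- removed.
  record Move (e : Hop) (p q : Plug Rect) : Set where
    constructor move
    field
      active : Active e (π p)
      moved  : π q ≡ toggle e (π p)

    squares-moved : ∀ {s s′} → At L e s s′ → squares q ≡ flipAt s′ (flipAt s (squares p))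
    squares-moved at = cols-injective L false (trans moved (sym (cols-flipAt false (squares p) at)))

    lookup-moved-≢ : ∀ {s s′} u → At L e s s′ → u ≢ s → u ≢ s′ → lookup (squares q) u ≡ lookup (squares p) u
    lookup-moved-≢ {s} {s′} u at u≢s u≢s′ = trans (cong (λ v → lookup v u) (squares-moved at))
      (trans (Vec.lookup∘updateAt′ u s′ u≢s′ (flipAt s (squares p)))
             (Vec.lookup∘updateAt′ u s u≢s (squares p)))

    lookup-moved : ∀ {s s′} → At L e s s′ → lookup (squares q) s ≡ not (lookup (squares p) s)
    lookup-moved {s} {s′} at = trans (cong (λ v → lookup v s) (squares-moved at))
      (trans (Vec.lookup∘updateAt′ s s′ (At-distinct at) (flipAt s (squares p)))
             (Vec.lookup∘updateAt s (squares p)))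

    lookup-≡ : ∀ {s s′} → At L e s s′ → lookup (squares p) s ≡ lookup (squares p) s′
    lookup-≡ at = Active⇒≡ false (squares p) at active

    at-active : ∃ λ s → ∃ λ s′ → At L e s s′
    at-active = Active⇒At L false (squares p) e active

  open Move

  Move-sym : ∀ {e p q} → Move e p q → Move e q p
  Move-sym {e} {p} (move act eq) = move
    (subst (Active e) (sym eq) (Active-toggle e (π p) act))
    (trans (sym (toggle-involutive e (π p))) (cong (toggle e) (sym eq)))

  Move⇒Adds : ∀ {e p q s s′} → Move e p q → At L e s s′ → lookup (squares p) s ≡ false → Adds e p q
  Move⇒Adds {p = p} {s = s} {s′} m at eq = adds at eq eq′
    (trans (squares-moved m at)
    (trans (cong (flipAt s′) (flipAt-false (squares p) s eq))
           (flipAt-false (squares p [ s ]≔ true) s′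
             (trans (Vec.lookup∘update′ (At-distinct at ∘ sym) (squares p) true) eq′))))
    where
    eq′ = trans (sym (lookup-≡ m at)) eq

  Adds⇒Move : ∀ {e p q} → Adds e p q → Move e p q
  Adds⇒Move {e} {p} {q} (adds {s} {s′} at x y z) = move
    (≡⇒Active false (squares p) at (trans x (sym y)))
    (trans (cong (cols L false) (trans z (sym flips))) (cols-flipAt false (squares p) at))
    where
    flips : flipAt s′ (flipAt s (squares p)) ≡ set₂ (squares p) s s′ true true
    flips = trans (cong (flipAt s′) (flipAt-false (squares p) s x))
      (flipAt-false (squares p [ s ]≔ true) s′
        (trans (Vec.lookup∘update′ (At-distinct at ∘ sym) (squares p) true) y))

  Valid-toggle : ∀ e s → Active e s → Valid s → Valid (toggle e s)
  Valid-toggle e s act (len , tot) = trans (length-toggle e s) len , trans (total-toggle e s act) tot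

  abstract
    movePlug : ∀ e p → Active e (π p) → Plug Rect
    movePlug e p act = plugOf (toggle e (π p)) (Valid-toggle e (π p) act (Valid-π p))

    moveTo : ∀ e p (act : Active e (π p)) → Move e p (movePlug e p act)
    moveTo e p act = move act (π-plugOf _ (Valid-toggle e (π p) act (Valid-π p)))

  -- The flag tells whether the squares of the hop lie in p; if so, the domino is removed, and
  -- otherwise it is added.
  Dir : Bool → Hop → Plug Rect → Plug Rect → Set
  Dir false e p q = Adds e p q
  Dir true  e p q = Adds e q p

  mvD : ∀ x {e p q} → Dir x e p q → Path K p q
  mvD false d = add d
  mvD true  d = inv (add d)

  mvD-unique : ∀ x {e p q} (d d′ : Dir x e p q) → mvD x d ≡ mvD x d′
  mvD-unique false d d′ = add-unique d d′
  mvD-unique true  d d′ = cong inv (add-unique d d′)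

  dir : ∀ x {e p q s s′} → Move e p q → At L e s s′ → lookup (squares p) s ≡ x → Dir x e p q
  dir false m at eq = Move⇒Adds m at eq
  dir true  m at eq = Move⇒Adds (Move-sym m) at (trans (lookup-moved m at) (cong not eq))

  abstract
    mv : ∀ {e p q} → Move e p q → Path K p q
    mv {e} {p} m = let s , _ , at = at-active m in mvD (lookup (squares p) s) (dir _ m at refl)

    mv≡mvD : ∀ x {e p q s s′} (m : Move e p q) → At L e s s′ → lookup (squares p) s ≡ x →
             (d : Dir x e p q) → mv m ≡ mvD x d
    mv≡mvD x m at eq d with at-active m
    ... | _ , _ , at′ with refl , refl ← At-functional at at′ | refl ← eq = mvD-unique _ _ d

  mv-sym : ∀ {e p q} (m : Move e p q) (m′ : Move e q p) → mv m′ ~ inv (mv m)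
  mv-sym {e} {p} {q} m m′ = go (lookup (squares p) s) refl
    where
    s = proj₁ (at-active m)
    at = proj₂ (proj₂ (at-active m))
    go : ∀ x → lookup (squares p) s ≡ x → mv m′ ~ inv (mv m)
    go false eq = ≡⇒~ (trans
      (mv≡mvD true m′ at (trans (lookup-moved m at) (cong not eq)) (dir false m at eq))
      (cong inv (sym (mv≡mvD false m at eq (dir false m at eq)))))
    go true eq = ≃-trans
      (≡⇒~ (mv≡mvD false m′ at (trans (lookup-moved m at) (cong not eq)) (dir true m at eq)))
      (≃-trans (≃-sym (inv-involutive (add (dir true m at eq))))
               (≡⇒~ (cong inv (sym (mv≡mvD true m at eq (dir true m at eq))))))

  -- All cases are the square of `add-comm`, read from the corner that the two flags make the start.
  mvD-comm : ∀ x y {e f p q q′ t} → Disj e f →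
             (d₁ : Dir x e p q) (d₂ : Dir y f q t) (d₃ : Dir y f p q′) (d₄ : Dir x e q′ t) →
             mvD x d₁ ◅◅ mvD y d₂ ~ mvD y d₃ ◅◅ mvD x d₄
  mvD-comm false false d d₁ d₂ d₃ d₄ = add-comm d d₁ d₂ d₃ d₄
  mvD-comm true  true {e} {f} d d₁ d₂ d₃ d₄ = begin
    inv (add d₁) ◅◅ inv (add d₂)   ≡⟨ inv-◅◅ (add d₂) (add d₁) ⟨
    inv (add d₂ ◅◅ add d₁)         ≈⟨ inv-cong (add-comm (Disj-sym e f d) d₂ d₁ d₄ d₃) ⟩
    inv (add d₄ ◅◅ add d₃)         ≡⟨ inv-◅◅ (add d₄) (add d₃) ⟩
    inv (add d₃) ◅◅ inv (add d₄)   ∎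
    where open ~-Reasoning
  mvD-comm false true d d₁ d₂ d₃ d₄ = ≃-sym (rotate (add d₄) (add d₂) (add d₃) (add d₁) (add-comm d d₄ d₂ d₃ d₁))
  mvD-comm true  false {e} {f} d d₁ d₂ d₃ d₄ = rotate (add d₂) (add d₄) (add d₁) (add d₃) (add-comm (Disj-sym e f d) d₂ d₄ d₁ d₃)

  mv-comm : ∀ {e f p q q′ t} → Disj e f →
            (m₁ : Move e p q) (m₂ : Move f q t) (m₃ : Move f p q′) (m₄ : Move e q′ t) →
            mv m₁ ◅◅ mv m₂ ~ mv m₃ ◅◅ mv m₄
  mv-comm {e} {f} {p} {q} {q′} d m₁ m₂ m₃ m₄ = begin
    mv m₁ ◅◅ mv m₂       ≡⟨ cong₂ _◅◅_ (mv≡mvD x m₁ at refl d₁) (mv≡mvD y m₂ at′ q-u d₂) ⟩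
    mvD x d₁ ◅◅ mvD y d₂ ≈⟨ mvD-comm x y d d₁ d₂ d₃ d₄ ⟩
    mvD y d₃ ◅◅ mvD x d₄ ≡⟨ cong₂ _◅◅_ (mv≡mvD y m₃ at′ refl d₃) (mv≡mvD x m₄ at q′-s d₄) ⟨
    mv m₃ ◅◅ mv m₄       ∎
    where
    open ~-Reasoning
    s = proj₁ (at-active m₁)
    u = proj₁ (at-active m₃)
    at = proj₂ (proj₂ (at-active m₁))
    at′ = proj₂ (proj₂ (at-active m₃))
    x = lookup (squares p) s
    y = lookup (squares p) u
    q-u : lookup (squares q) u ≡ y
    q-u = let s≢u , _ , s′≢u , _ = Disj⇒Apart d at at′
          in lookup-moved-≢ m₁ u at (s≢u ∘ sym) (s′≢u ∘ sym)
    q′-s : lookup (squares q′) s ≡ x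
    q′-s = let s≢u , s≢u′ , _ = Disj⇒Apart d at at′ in lookup-moved-≢ m₃ s at′ s≢u s≢u′
    d₁ = dir x m₁ at refl
    d₂ = dir y m₂ at′ q-u
    d₃ = dir y m₃ at′ refl
    d₄ = dir x m₄ at q′-s

  module _ {h v} (B : Block L h v) where
    open Block B

    row : ∀ j {p q} → Move (h j) p q → ∀ i → lookup (squares p) (sq i j) ≡ lookup (squares p) (sq false j)
    row j m false = refl
    row j m true  = sym (lookup-≡ m (at-h j))

    col : ∀ i {p q} → Move (v i) p q → ∀ j → lookup (squares p) (sq i j) ≡ lookup (squares p) (sq i false)
    col i m false = refl
    col i m true  = sym (lookup-≡ m (at-v i))

    row-moved : ∀ j {p q} → Move (h j) p q → ∀ i →
                lookup (squares q) (sq i j) ≡ not (lookup (squares p) (sq false j))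
    row-moved j m i = trans (row j (Move-sym m) i) (lookup-moved m (at-h j))

    module _ {r r′ c c′} (r′≡ : r′ ≡ not r) (c′≡ : c′ ≡ not c) {p q q′ t}
             (m₁ : Move (h r) p q) (m₂ : Move (v c) q t)
             (m₃ : Move (h r′) p q′) (m₄ : Move (v c′) q′ t) where
      private
        r′≢r : r′ ≢ r
        r′≢r eq = not-≢ r (trans (sym r′≡) eq)

        q-c : ∀ j → lookup (squares q) (sq c j) ≡ not (lookup (squares p) (sq false r))
        q-c j = trans (col c m₂ j) (trans (sym (col c m₂ r)) (row-moved r m₁ c))

      -- After the first hop the column c admits a vertical hop, so its two squares agree; the first
      -- hop has changed exactly one of them.
      opposite-rows : lookup (squares p) (sq false r′) ≡ not (lookup (squares p) (sq false r))
      opposite-rows = trans (sym (row r′ m₃ c)) (trans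
        (sym (lookup-moved-≢ m₁ (sq c r′) (at-h r) (sq-≢₂ c r′ r′≢r) (sq-≢₂ c r′ r′≢r)))
        (q-c r′))

      -- Here q′ misses the whole block and q contains it, while p contains one row of it and t one
      -- column. The claim is `add-flip` from q′ to q, read from p to t.
      turn-false : lookup (squares p) (sq false r) ≡ false → mv m₁ ◅◅ mv m₂ ~ mv m₃ ◅◅ mv m₄
      turn-false p-r = begin
        mv m₁ ◅◅ mv m₂            ≡⟨ cong₂ _◅◅_ (mv≡mvD false m₁ (at-h r) p-r d₁)
                                                (mv≡mvD true m₂ (at-v c) q-c′ d₂) ⟩
        add d₁ ◅◅ inv (add d₂)    ≈⟨ rotate (add d₄) (add d₂) (add d₃) (add d₁)
                                      (≃-sym (add-flip B (swap r′≡) (swap c′≡) d₃ d₁ d₄ d₂)) ⟨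
        inv (add d₃) ◅◅ add d₄    ≡⟨ cong₂ _◅◅_ (mv≡mvD true m₃ (at-h r′) p-r′ d₃)
                                                (mv≡mvD false m₄ (at-v c′) q′-c′ d₄) ⟨
        mv m₃ ◅◅ mv m₄            ∎
        where
        open ~-Reasoning
        swap : ∀ {x y} → y ≡ not x → x ≡ not y
        swap {x} eq = trans (sym (not-involutive x)) (cong not (sym eq))
        q-c′ : lookup (squares q) (sq c false) ≡ true
        q-c′ = trans (q-c false) (cong not p-r)
        p-r′ : lookup (squares p) (sq false r′) ≡ true
        p-r′ = trans opposite-rows (cong not p-r)
        q′-c′ : lookup (squares q′) (sq c′ false) ≡ false
        q′-c′ = trans (sym (col c′ m₄ r′)) (trans (row-moved r′ m₃ c′) (cong not p-r′))
        d₁ : Adds (h r) p q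
        d₁ = dir false m₁ (at-h r) p-r
        d₂ : Adds (v c) t q
        d₂ = dir true m₂ (at-v c) q-c′
        d₃ : Adds (h r′) q′ p
        d₃ = dir true m₃ (at-h r′) p-r′
        d₄ : Adds (v c′) q′ t
        d₄ = dir false m₄ (at-v c′) q′-c′

  mv-turn : ∀ {e e′ f f′ p q q′ t} → Turn e e′ f f′ →
            (m₁ : Move e p q) (m₂ : Move e′ q t) (m₃ : Move f p q′) (m₄ : Move f′ q′ t) →
            mv m₁ ◅◅ mv m₂ ~ mv m₃ ◅◅ mv m₄
  mv-turn {p = p} T m₁ m₂ m₃ m₄ with Turn⇒TurnIn T (proj₂ (proj₂ (at-active m₁)))
  ... | turnIn B r c refl refl refl refl with lookup (squares p) (Block.sq B false r) in eq
  ...   | false = turn-false B refl refl m₁ m₂ m₃ m₄ eq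
  -- Now row `not r` is the one outside the plug, so the two ways around the block exchange their
  -- roles.
  ...   | true  = ≃-sym (turn-false B (sym (not-involutive r)) (sym (not-involutive c)) m₃ m₄ m₁ m₂
                          (trans (opposite-rows B refl refl m₁ m₂ m₃ m₄) (cong not eq)))

-- Contraction of the flat hops

total-D : ∀ n → total (replicate n D) ≡ 0ℤ
total-D zero    = refl
total-D (suc n) = cong (0ℤ +ᶻ_) (total-D n)

¬Red-D : ∀ h n e → h ≡ 0ℤ → ¬ Red h e (replicate n D)
¬Red-D h (suc n)       vert      h≡0 (_ , () , _)
¬Red-D h (suc zero)    (hor r)   h≡0 ()
¬Red-D h (suc (suc n)) (hor r)   refl ()
¬Red-D h (suc n)       (there e) refl red = ¬Red-D 0ℤ n e refl red

module Reduction (L : ℕ) (3≤L : 3 ≤ L) where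

  open Moves L 3≤L public
  open Move public

  mv-unique : ∀ {e p q} (m m′ : Move e p q) → mv m ≡ mv m′
  mv-unique m m′ = let s , s′ , at = at-active m
    in trans (mv≡mvD _ m at refl (dir _ m at refl)) (sym (mv≡mvD _ m′ at refl (dir _ m at refl)))

  Move-unique : ∀ {e p q q′} → Move e p q → Move e p q′ → q ≡ q′
  Move-unique m m′ = π-injective (trans (moved m) (sym (moved m′)))

  bottom : Plug Rect
  bottom = plugOf (replicate L D) (length-replicate L , total-D L)

  D⇒bottom : ∀ {p} → π p ≡ replicate (length (π p)) D → p ≡ bottom
  D⇒bottom {p} eq = π-injective (trans eq
    (trans (cong (λ n → replicate n D) (proj₁ (Valid-π p)))
           (sym (π-plugOf (replicate L D) (length-replicate L , total-D L)))))

  measure : Plug Rect → ℕ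
  measure p = μ 0ℤ (π p)

  measure-Red : ∀ {e p q} → Move e p q → Red 0ℤ e (π p) → measure q < measure p
  measure-Red {e} {p} m red = subst (λ s → μ 0ℤ s < measure p) (sym (moved m)) (μ-Red 0ℤ e (π p) red)

  next : ∀ p → p ≡ bottom ⊎ ∃ λ e → ∃ λ q → Move e p q × Red 0ℤ e (π p)
  next p with Red-or-D 0ℤ (π p) refl (total-π p)
  ... | inj₁ eq        = inj₁ (D⇒bottom eq)
  ... | inj₂ (e , red) = inj₂ (e , _ , moveTo e p (Red⇒Active 0ℤ e (π p) red) , red)

  reduceAcc : ∀ p → Acc _<_ (measure p) → Path K p bottom
  reduceAcc p (acc rs) with next p
  ... | inj₁ refl              = ε
  ... | inj₂ (e , q , m , red) = mv m ◅◅ reduceAcc q (rs (measure-Red m red))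

  reduceAcc-irrelevant : ∀ p ac ac′ → reduceAcc p ac ≡ reduceAcc p ac′
  reduceAcc-irrelevant p (acc rs) (acc rs′) with next p
  ... | inj₁ refl              = refl
  ... | inj₂ (e , q , m , red) = cong (mv m ◅◅_)
    (reduceAcc-irrelevant q (rs (measure-Red m red)) (rs′ (measure-Red m red)))

  reduce : ∀ p → Path K p bottom
  reduce p = reduceAcc p (<-wellFounded (measure p))

  reduceAcc-next : ∀ p ac → p ≡ bottom ⊎ ∃ λ e → ∃ λ q → Σ (Move e p q) λ m →
                   Red 0ℤ e (π p) × reduceAcc p ac ≡ mv m ◅◅ reduce q
  reduceAcc-next p (acc rs) with next p
  ... | inj₁ eq                = inj₁ eq
  ... | inj₂ (e , q , m , red) = inj₂ (e , q , m , red ,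
    cong (mv m ◅◅_) (reduceAcc-irrelevant q (rs (measure-Red m red)) (<-wellFounded (measure q))))

  bottom-irreducible : ∀ e → ¬ Red 0ℤ e (π bottom)
  bottom-irreducible e red = ¬Red-D 0ℤ L e refl
    (subst (Red 0ℤ e) (π-plugOf (replicate L D) (length-replicate L , total-D L)) red)

  Red-moved : ∀ {e} f {p q} → Move e p q → Red 0ℤ f (toggle e (π p)) → Red 0ℤ f (π q)
  Red-moved f m = subst (Red 0ℤ f) (sym (moved m))

  Confluent : Plug Rect → Set
  Confluent p = ∀ {e q} (m : Move e p q) → Red 0ℤ e (π p) → mv m ◅◅ reduce q ~ reduce p

  -- The square that closes the peak is pasted with the homotopies already known below q and q₀.
  confluent-join : ∀ {e e₀ p q q₀} (m : Move e p q) (m₀ : Move e₀ p q₀) → Join 0ℤ (π p) e e₀ →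
                   Confluent q → Confluent q₀ → mv m ◅◅ reduce q ~ mv m₀ ◅◅ reduce q₀
  confluent-join {e} {e₀} {p} {q} {q₀} m m₀ join conf conf₀ = go join
    where
    close : ∀ {e₁ e₂ t} (m₁ : Move e₁ q t) (m₂ : Move e₂ q₀ t) → Red 0ℤ e₁ (π q) → Red 0ℤ e₂ (π q₀) →
            mv m ◅◅ mv m₁ ~ mv m₀ ◅◅ mv m₂ → mv m ◅◅ reduce q ~ mv m₀ ◅◅ reduce q₀
    close {t = t} m₁ m₂ red₁ red₂ square = begin
      mv m ◅◅ reduce q              ≈⟨ ◅◅-congˡ (mv m) (conf m₁ red₁) ⟨
      mv m ◅◅ mv m₁ ◅◅ reduce t     ≡⟨ ◅◅-assoc (mv m) (mv m₁) (reduce t) ⟨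
      (mv m ◅◅ mv m₁) ◅◅ reduce t   ≈⟨ ◅◅-congʳ (reduce t) square ⟩
      (mv m₀ ◅◅ mv m₂) ◅◅ reduce t  ≡⟨ ◅◅-assoc (mv m₀) (mv m₂) (reduce t) ⟩
      mv m₀ ◅◅ mv m₂ ◅◅ reduce t    ≈⟨ ◅◅-congˡ (mv m₀) (conf₀ m₂ red₂) ⟩
      mv m₀ ◅◅ reduce q₀            ∎
      where open ~-Reasoning
    go : Join 0ℤ (π p) e e₀ → mv m ◅◅ reduce q ~ mv m₀ ◅◅ reduce q₀
    go (commuting d x y) = close m₁ m₂ red₁ red₂ (mv-comm d m m₁ m₀ m₂)
      where
      red₁ = Red-moved e₀ m x
      red₂ = Red-moved e m₀ y
      m₁ = moveTo e₀ q (Red⇒Active 0ℤ e₀ (π q) red₁)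
      m₂ : Move e q₀ _
      m₂ = move (Red⇒Active 0ℤ e (π q₀) red₂)
        (trans (moved m₁) (trans (cong (toggle e₀) (moved m))
          (trans (sym (toggle-comm e e₀ (π p) d)) (cong (toggle e) (sym (moved m₀))))))
    go (turning {e′} {f′} τ x y) = close m₁ m₂ red₁ red₂ (mv-turn τ m m₁ m₀ m₂)
      where
      red₁ = Red-moved e′ m x
      red₂ = Red-moved f′ m₀ y
      m₁ = moveTo e′ q (Red⇒Active 0ℤ e′ (π q) red₁)
      m₂ : Move f′ q₀ _
      m₂ = move (Red⇒Active 0ℤ f′ (π q₀) red₂)
        (trans (moved m₁) (trans (cong (toggle e′) (moved m))
          (trans (toggle-turn (π p) τ (active m)) (cong (toggle f′) (sym (moved m₀))))))

  confluent-step : ∀ {p} → (∀ q → measure q < measure p → Confluent q) → ∀ {e q} (m : Move e p q) →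
                   Red 0ℤ e (π p) → (p ≡ bottom ⊎ ∃ λ e₀ → ∃ λ q₀ → Σ (Move e₀ p q₀) λ m₀ →
                   Red 0ℤ e₀ (π p) × reduce p ≡ mv m₀ ◅◅ reduce q₀) →
                   mv m ◅◅ reduce q ~ reduce p
  confluent-step conf {e} m red (inj₁ p≡bottom) =
    contradiction (subst (λ p → Red 0ℤ e (π p)) p≡bottom red) (bottom-irreducible e)
  confluent-step {p} conf {e} {q} m red (inj₂ (e₀ , q₀ , m₀ , red₀ , eq)) =
    go (conflict 0ℤ e e₀ (π p) red red₀)
    where
    same : ∀ {q} (m : Move e₀ p q) → q ≡ q₀ → mv m ◅◅ reduce q ~ mv m₀ ◅◅ reduce q₀
    same m refl = ≡⇒~ (cong (_◅◅ reduce q₀) (mv-unique m m₀))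
    go : e ≡ e₀ ⊎ Join 0ℤ (π p) e e₀ → mv m ◅◅ reduce q ~ reduce p
    go (inj₁ refl) = ≃-trans (same m (Move-unique m m₀)) (≡⇒~ (sym eq))
    go (inj₂ join) = ≃-trans
      (confluent-join m m₀ join (conf q (measure-Red m red)) (conf q₀ (measure-Red m₀ red₀)))
      (≡⇒~ (sym eq))

  -- Newman's lemma: local confluence up to homotopy makes the reduction to the
  -- bottom plug independent of the choices made.
  confluent : ∀ p → Acc _<_ (measure p) → Confluent p
  confluent p (acc rs) m red = confluent-step (λ q lt → confluent q (rs lt)) m red
    (reduceAcc-next p (<-wellFounded (measure p)))

  reduce-Red : ∀ {p} → Confluent p
  reduce-Red {p} = confluent p (<-wellFounded (measure p))

  module Inductive (Pr : ∀ {p q} → Path K p q → Set) (Pr-ε : ∀ {p} → Pr {p} ε)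
                   (Pr-◅◅ : ∀ {p q r} {γ : Path K p q} {δ : Path K q r} → Pr γ → Pr δ → Pr (γ ◅◅ δ))
                   (Pr-inv : ∀ {p q} {γ : Path K p q} → Pr γ → Pr (inv γ))
                   (Pr-mv : ∀ {e p q} (m : Move e p q) → Flat 0ℤ e (π p) → Pr (mv m)) where

    reduceAcc-inductive : ∀ p ac → Pr (reduceAcc p ac)
    reduceAcc-inductive p (acc rs) with next p
    ... | inj₁ refl              = Pr-ε
    ... | inj₂ (e , q , m , red) =
      Pr-◅◅ (Pr-mv m (Red⇒Flat 0ℤ e (π p) red)) (reduceAcc-inductive q (rs (measure-Red m red)))

  base : Plug Rect
  base = p∘ Rect

  abstract
    -- A path along flat hops, by way of `bottom`. It acts as a spanning tree up to homotopy:
    -- continued by a hop and brought back by another such path, it turns the hop into a loop at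
    -- `base`.
    T : ∀ p → Path K base p
    T p = reduce base ◅◅ inv (reduce p)

    T-base : T base ~ ε
    T-base = inv-inverseʳ (reduce base)

    -- One direction of a flat hop is a reduction, and by confluence `reduce` absorbs it; hence flat
    -- hops become trivial loops.
    T-flat : ∀ {e p q} (m : Move e p q) → Flat 0ℤ e (π p) → T p ◅◅ mv m ~ T q
    T-flat {e} {p} {q} m flat = begin
      (reduce base ◅◅ inv (reduce p)) ◅◅ mv m  ≡⟨ ◅◅-assoc (reduce base) _ (mv m) ⟩
      reduce base ◅◅ inv (reduce p) ◅◅ mv m    ≈⟨ ◅◅-congˡ (reduce base) rotated ⟩
      reduce base ◅◅ inv (reduce q)            ∎
      where
      open ~-Reasoning
      reduced : mv m ◅◅ reduce q ~ reduce p
      reduced with Red-orient 0ℤ e (π p) (active m) flat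
      ... | inj₁ red = reduce-Red m red
      ... | inj₂ red = moveˡ′ (mv m) (≃-trans
        (≃-sym (reduce-Red (Move-sym m) (Red-moved e m red)))
        (◅◅-congʳ (reduce p) (mv-sym m (Move-sym m))))
      rotated : inv (reduce p) ◅◅ mv m ~ inv (reduce q)
      rotated = rotate (mv m) (reduce q) (reduce p) ε
        (≃-trans reduced (≡⇒~ (sym (◅◅-identityʳ (reduce p)))))

    -- Access to the inside of the abstract `T`, through which its weight is computed later.
    T-inductive : (Pr : ∀ {p q} → Path K p q → Set) → (∀ {p} → Pr {p} ε) →
                  (∀ {p q r} {γ : Path K p q} {δ : Path K q r} → Pr γ → Pr δ → Pr (γ ◅◅ δ)) →
                  (∀ {p q} {γ : Path K p q} → Pr γ → Pr (inv γ)) →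
                  (∀ {e p q} (m : Move e p q) → Flat 0ℤ e (π p) → Pr (mv m)) → ∀ p → Pr (T p)
    T-inductive Pr Pr-ε Pr-◅◅ Pr-inv Pr-mv p =
      Pr-◅◅ {γ = reduce base} (reduceAcc-inductive base (<-wellFounded (measure base)))
            (Pr-inv {γ = reduce p} (reduceAcc-inductive p (<-wellFounded (measure p))))
      where open Inductive Pr Pr-ε Pr-◅◅ Pr-inv Pr-mv

-- Normal forms of columns under horizontal hops

lift : List Col → Hop → Hop
lift []      e = e
lift (_ ∷ l) e = there (lift l e)

toggle-lift : ∀ l e s → toggle (lift l e) (l ++ s) ≡ l ++ toggle e s
toggle-lift []      e s = refl
toggle-lift (c ∷ l) e s = cong (c ∷_) (toggle-lift l e s)

Active-lift : ∀ l e s → Active e s → Active (lift l e) (l ++ s)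
Active-lift []      e s act = act
Active-lift (c ∷ l) e s act = Active-lift l e s act

Flat-lift : ∀ h l e s → Flat (h +ᶻ total l) e s → Flat h (lift l e) (l ++ s)
Flat-lift h []      e s flat = subst (λ h → Flat h e s) (ℤ.+-identityʳ h) flat
Flat-lift h (c ∷ l) e s flat =
  Flat-lift (h +ᶻ exc c) l e s (subst (λ h → Flat h e s) (height-∷ h c l) flat)

Disj-lift : ∀ l e f → Disj e f → Disj (lift l e) (lift l f)
Disj-lift []      e f d = d
Disj-lift (_ ∷ l) e f d = Disj-lift l e f d

Turn-lift : ∀ l {e e′ f f′} → Turn e e′ f f′ → Turn (lift l e) (lift l e′) (lift l f) (lift l f′)
Turn-lift []      t = t
Turn-lift (_ ∷ l) t = there (Turn-lift l t)

lift-∷ʳ : ∀ l c e → lift (l ++ c ∷ []) e ≡ lift l (there e)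
lift-∷ʳ []      c e = refl
lift-∷ʳ (_ ∷ l) c e = cong there (lift-∷ʳ l c e)

lift-length : ∀ l l′ e → length l ≡ length l′ → lift l e ≡ lift l′ e
lift-length []      []       e eq = refl
lift-length (_ ∷ l) (_ ∷ l′) e eq = cong there (lift-length l l′ e (ℕ.suc-injective eq))

total-++ : ∀ l r → total (l ++ r) ≡ total l +ᶻ total r
total-++ []      r = sym (ℤ.+-identityˡ (total r))
total-++ (c ∷ l) r = trans (cong (exc c +ᶻ_) (total-++ l r)) (sym (ℤ.+-assoc (exc c) (total l) (total r)))

toggle-++ : ∀ e l s → Active e l → toggle e (l ++ s) ≡ toggle e l ++ s
toggle-++ vert      (c ∷ l)     s act = refl
toggle-++ (hor r)   (c ∷ d ∷ l) s act = refl
toggle-++ (there e) (c ∷ l)     s act = cong (c ∷_) (toggle-++ e l s act)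

Active-++ : ∀ e l s → Active e l → Active e (l ++ s)
Active-++ vert      (c ∷ l)     s act = act
Active-++ (hor r)   (c ∷ d ∷ l) s act = act
Active-++ (there e) (c ∷ l)     s act = Active-++ e l s act

Disj-++ : ∀ e l f → Active e l → Disj e (lift l f)
Disj-++ vert      (c ∷ l)     f act = tt
Disj-++ (hor r)   (c ∷ d ∷ l) f act = tt
Disj-++ (there e) (c ∷ l)     f act = Disj-++ e l f act

data Horizontal : Hop → Set where
  hor   : ∀ r → Horizontal (hor r)
  there : ∀ {e} → Horizontal e → Horizontal (there e)

Horizontal⇒Flat : ∀ {e} h s → Horizontal e → Active e s → Flat h e s
Horizontal⇒Flat h s       (hor r)   act = tt
Horizontal⇒Flat h (c ∷ s) (there x) act = Horizontal⇒Flat (h +ᶻ exc c) s x act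

infix 4 _↝_

-- Horizontal hops are flat at every height, so these rewritings are valid wherever the list stands
-- within a plug.
data _↝_ : List Col → List Col → Set where
  done : ∀ {s} → s ↝ s
  step : ∀ {e s t} → Horizontal e → Active e s → toggle e s ↝ t → s ↝ t

↝-trans : ∀ {s t u} → s ↝ t → t ↝ u → s ↝ u
↝-trans done           y = y
↝-trans (step h act x) y = step h act (↝-trans x y)

↝-∷ : ∀ c {s t} → s ↝ t → c ∷ s ↝ c ∷ t
↝-∷ c done           = done
↝-∷ c (step h act x) = step (there h) act (↝-∷ c x)

total-↝ : ∀ {s t} → s ↝ t → total s ≡ total t
total-↝ done = refl
total-↝ (step {e} {s} h act x) = trans (sym (total-toggle e s act)) (total-↝ x)

length-↝ : ∀ {s t} → s ↝ t → length s ≡ length t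
length-↝ done = refl
length-↝ (step {e} {s} h act x) = trans (sym (length-toggle e s)) (length-↝ x)

Single : Col → Set
Single (x , y) = x ≡ not y

double-col : Bool → Col
double-col x = x , x

-- A single column and a double one differ in exactly one row, and the hop in that row exchanges
-- them.
single-past : ∀ k x {c} s → Single c → c ∷ replicate k (double-col x) ++ s ↝ replicate k (double-col x) ++ c ∷ s
single-past zero    x     s sing = done
single-past (suc k) false {U} s sing = step (hor false) refl (↝-∷ _ (single-past k false s refl))
single-past (suc k) false {D} s sing = step (hor true)  refl (↝-∷ _ (single-past k false s refl))
single-past (suc k) true  {U} s sing = step (hor true)  refl (↝-∷ _ (single-past k true s refl))
single-past (suc k) true  {D} s sing = step (hor false) refl (↝-∷ _ (single-past k true s refl))

record Normalised (s : List Col) : Set where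
  constructor normalised
  field
    k       : ℕ
    x       : Bool
    singles : List Col
    all-single : All Single singles
    hops    : s ↝ replicate k (double-col x) ++ singles

singles-past : ∀ k x c d s → Single c → Single d →
               c ∷ d ∷ replicate k (double-col x) ++ s ↝ replicate k (double-col x) ++ c ∷ d ∷ s
singles-past k x c d s sc sd = ↝-trans (↝-∷ c (single-past k x s sd)) (single-past k x (d ∷ s) sc)

-- Doubles of one kind gather in front; opposite ones annihilate, since one horizontal hop turns an
-- adjacent `E₂` and `E₀` into two singles.
normalise : ∀ s → Normalised s
normalise []      = normalised 0 true [] [] done
normalise (c ∷ s) with normalise s
... | normalised k x ss sing hops = insert c k x ss sing (↝-∷ c hops)
  where
  insert : ∀ c k x ss → All Single ss → ∀ {s} → s ↝ c ∷ replicate k (double-col x) ++ ss → Normalised s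
  insert U  k       x ss sing hops =
    normalised k x (U ∷ ss) (refl ∷ sing) (↝-trans hops (single-past k x ss refl))
  insert D  k       x ss sing hops =
    normalised k x (D ∷ ss) (refl ∷ sing) (↝-trans hops (single-past k x ss refl))
  insert E₂ zero    x ss sing hops = normalised 1 true ss sing hops
  insert E₀ zero    x ss sing hops = normalised 1 false ss sing hops
  insert E₂ (suc k) true  ss sing hops = normalised (suc (suc k)) true ss sing hops
  insert E₀ (suc k) false ss sing hops = normalised (suc (suc k)) false ss sing hops
  insert E₂ (suc k) false ss sing hops =
    normalised k false (D ∷ U ∷ ss) (refl ∷ refl ∷ sing)
      (↝-trans hops (step (hor false) refl (singles-past k false D U ss refl refl)))
  insert E₀ (suc k) true ss sing hops =
    normalised k true (U ∷ D ∷ ss) (refl ∷ refl ∷ sing)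
      (↝-trans hops (step (hor false) refl (singles-past k true U D ss refl refl)))

signed : Bool → ℕ → ℤ
signed true  k = + k
signed false k = ℤ.- + k

total-doubles : ∀ k x → total (replicate k (double-col x)) ≡ signed x k
total-doubles zero    true  = refl
total-doubles zero    false = refl
total-doubles (suc k) true  = cong (1ℤ +ᶻ_) (total-doubles k true)
total-doubles (suc k) false = trans (cong (-1ℤ +ᶻ_) (total-doubles k false)) (lemma k)
  where
  lemma : ∀ k → -1ℤ +ᶻ ℤ.- + k ≡ ℤ.- + suc k
  lemma zero    = refl
  lemma (suc k) = refl

total-singles : ∀ {s} → All Single s → total s ≡ 0ℤ
total-singles [] = refl
total-singles {(x , y) ∷ s} (sing ∷ sings) = cong₂ _+ᶻ_ (exc-single x y sing) (total-singles sings)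

-- The shortest list of columns across which the height changes by m.
slope : ℤ → List Col
slope (+ k)    = replicate k E₂
slope -[1+ k ] = replicate (suc k) E₀

slope-signed : ∀ x k → slope (signed x k) ≡ replicate k (double-col x)
slope-signed true  k       = refl
slope-signed false zero    = refl
slope-signed false (suc k) = refl

length-slope : ∀ m → length (slope m) ≡ abs m
length-slope (+ k)    = length-replicate k
length-slope -[1+ k ] = cong suc (length-replicate k)

total-slope : ∀ m → total (slope m) ≡ m
total-slope (+ k)    = total-doubles k true
total-slope -[1+ k ] = total-doubles (suc k) false

flatten : List Col → List Col
flatten s = replicate (length s) D

Flat-disj : ∀ h e f s → Disj e f → Active e s → Flat h f s → Flat h f (toggle e s)
Flat-disj h vert      (there f) ((x , y) ∷ s)  _ act flat =
  subst (λ z → Flat (h +ᶻ z) f s) (sym (exc-vert x y act)) flat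
Flat-disj h (hor r)   (hor r′)          (c ∷ d ∷ s) _ act flat = flat
Flat-disj h (hor r)   (there (hor r′))  (c ∷ d ∷ s) _ act flat = flat
Flat-disj h (hor r)   (there (there f)) (c ∷ d ∷ s) _ act flat =
  subst (λ z → Flat z f s) (sym (exc-hop-from h r c d act)) flat
Flat-disj h (there e) vert              (c ∷ s) _ act flat = flat
Flat-disj h (there (hor x)) (hor r)     (c ∷ s) _ act flat = flat
Flat-disj h (there (there e)) (hor r)   (c ∷ s) _ act flat = flat
Flat-disj h (there e) (there f)         (c ∷ s) d act flat = Flat-disj (h +ᶻ exc c) e f s d act flat

-- The class of a vertical hop depends only on its height

module Marks (L : ℕ) (3≤L : 3 ≤ L) where

  open Reduction L 3≤L public

  -- The class of the hop U → D between l and r, based at the empty plug, is ℓ.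
  Rep : Path K base base → List Col → List Col → Set
  Rep ℓ l r = ∀ {e p q} → e ≡ lift l vert → (m : Move e p q) → π p ≡ l ++ U ∷ r →
              T p ◅◅ mv m ~ ℓ ◅◅ T q

  -- In the commuting square of e and f both copies of f are flat, so `T` absorbs them and the class
  -- of e is the same before and after f.
  slide : ∀ ℓ {e f p q p′ q′} → Disj e f → (m : Move e p q) (m′ : Move e p′ q′)
          (x : Move f p p′) (y : Move f q q′) → Flat 0ℤ f (π p) →
          T p′ ◅◅ mv m′ ~ ℓ ◅◅ T q′ → T p ◅◅ mv m ~ ℓ ◅◅ T q
  slide ℓ {e} {f} {p} {q} {p′} {q′} d m m′ x y flat eq = cancelʳ (mv y) (begin
    (T p ◅◅ mv m) ◅◅ mv y    ≡⟨ ◅◅-assoc (T p) (mv m) (mv y) ⟩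
    T p ◅◅ mv m ◅◅ mv y      ≈⟨ ◅◅-congˡ (T p) (mv-comm d m y x m′) ⟩
    T p ◅◅ mv x ◅◅ mv m′     ≡⟨ ◅◅-assoc (T p) (mv x) (mv m′) ⟨
    (T p ◅◅ mv x) ◅◅ mv m′   ≈⟨ ◅◅-congʳ (mv m′) (T-flat x flat) ⟩
    T p′ ◅◅ mv m′            ≈⟨ eq ⟩
    ℓ ◅◅ T q′                ≈⟨ ◅◅-congˡ ℓ (T-flat y flat′) ⟨
    ℓ ◅◅ T q ◅◅ mv y         ≡⟨ ◅◅-assoc ℓ (T q) (mv y) ⟨
    (ℓ ◅◅ T q) ◅◅ mv y       ∎)
    where
    open ~-Reasoning
    flat′ : Flat 0ℤ f (π q)
    flat′ = subst (Flat 0ℤ f) (sym (moved m)) (Flat-disj 0ℤ e f (π p) d (active m) flat)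

  Rep-slide : ∀ {ℓ l r l′ r′} f → Disj (lift l vert) f → length l ≡ length l′ →
              Active f (l ++ U ∷ r) → Flat 0ℤ f (l ++ U ∷ r) →
              toggle f (l ++ U ∷ r) ≡ l′ ++ U ∷ r′ → Rep ℓ l′ r′ → Rep ℓ l r
  Rep-slide {ℓ} {l} {r} {l′} {r′} f d len act flat tog rep {e} {p} {q} refl m eq =
    slide ℓ d m m′ x y (subst (Flat 0ℤ f) (sym eq) flat)
      (rep (lift-length l l′ vert len) m′ (trans (moved x) (trans (cong (toggle f) eq) tog)))
    where
    act-p : Active f (π p)
    act-p = subst (Active f) (sym eq) act
    x = moveTo f p act-p
    y = moveTo f q (subst (Active f) (sym (moved m)) (Active-disj f e (π p) (Disj-sym e f d) act-p))
    m′ : Move e _ _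
    m′ = move (subst (Active e) (sym (moved x)) (Active-disj e f (π p) d (active m)))
      (trans (moved y) (trans (cong (toggle f) (moved m))
        (trans (sym (toggle-comm e f (π p) d)) (cong (toggle e) (sym (moved x))))))

  Rep-↝ˡ : ∀ {ℓ l l′ r} → l ↝ l′ → Rep ℓ l′ r → Rep ℓ l r
  Rep-↝ˡ done rep = rep
  Rep-↝ˡ {l = l} {r = r} (step {e} h act x) rep =
    Rep-slide e (Disj-sym e (lift l vert) (Disj-++ e l vert act)) (sym (length-toggle e l))
      act′ (Horizontal⇒Flat 0ℤ (l ++ U ∷ r) h act′) (toggle-++ e l (U ∷ r) act) (Rep-↝ˡ x rep)
    where
    act′ = Active-++ e l (U ∷ r) act

  Horizontal-lift : ∀ l {e} → Horizontal e → Horizontal (lift l e)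
  Horizontal-lift []      h = h
  Horizontal-lift (_ ∷ l) h = there (Horizontal-lift l h)

  Rep-↝ʳ : ∀ {ℓ l r r′} → r ↝ r′ → Rep ℓ l r′ → Rep ℓ l r
  Rep-↝ʳ done rep = rep
  Rep-↝ʳ {l = l} {r} (step {e} h act x) rep =
    Rep-slide (lift l (there e)) (Disj-lift l vert (there e) tt) refl act′
      (Horizontal⇒Flat 0ℤ (l ++ U ∷ r) (Horizontal-lift l (there h)) act′)
      (toggle-lift l (there e) (U ∷ r)) (Rep-↝ʳ x rep)
    where
    act′ = Active-lift l (there e) (U ∷ r) act

  -- A single neighbour does not change the height. The circuit of the block formed by it and the
  -- marked column trades the vertical hop in one column for that in the other, as the two
  -- horizontal hops through `E₀`, `E₂` are flat.
  Rep-carry : ∀ {ℓ} l c r → Single c → Rep ℓ l (c ∷ r) → Rep ℓ (l ++ c ∷ []) r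
  Rep-carry {ℓ} l U r _ rep {e} {p} {q} refl m eq = begin
    T p ◅◅ mv m                            ≈⟨ ◅◅-congʳ (mv m) T-p ⟩
    (ℓ ◅◅ T q ◅◅ mv (Move-sym m)) ◅◅ mv m  ≡⟨ ◅◅-assoc ℓ (T q ◅◅ mv (Move-sym m)) (mv m) ⟩
    ℓ ◅◅ (T q ◅◅ mv (Move-sym m)) ◅◅ mv m  ≈⟨ ◅◅-congˡ ℓ (moveʳ′ (mv m) (◅◅-congˡ (T q) (mv-sym m (Move-sym m)))) ⟩
    ℓ ◅◅ T q                               ∎
    where
    open ~-Reasoning
    e≡ : lift (l ++ U ∷ []) vert ≡ lift l (there vert)
    e≡ = lift-∷ʳ l U vert
    π-p : π p ≡ l ++ U ∷ U ∷ r
    π-p = trans eq (++-assoc l (U ∷ []) (U ∷ r))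
    π-q : π q ≡ l ++ U ∷ D ∷ r
    π-q = trans (moved m) (trans (cong₂ toggle e≡ π-p) (toggle-lift l (there vert) (U ∷ U ∷ r)))
    -- No horizontal hop inside the block starts from `U`, `U`, so the circuit begins at `U`, `D`,
    -- with m reversed.
    y = moveTo (lift l (hor false)) q
      (subst (Active (lift l (hor false))) (sym π-q) (Active-lift l (hor false) (U ∷ D ∷ r) refl))
    π-y : π (movePlug (lift l (hor false)) q _) ≡ l ++ E₀ ∷ E₂ ∷ r
    π-y = trans (moved y) (trans (cong (toggle (lift l (hor false))) π-q) (toggle-lift l (hor false) (U ∷ D ∷ r)))
    h₀ = Move-sym y
    h₁ = moveTo (lift l (hor true)) _
      (subst (Active (lift l (hor true))) (sym π-y) (Active-lift l (hor true) (E₀ ∷ E₂ ∷ r) refl))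
    π-z : π (movePlug (lift l (hor true)) _ _) ≡ l ++ D ∷ U ∷ r
    π-z = trans (moved h₁) (trans (cong (toggle (lift l (hor true))) π-y) (toggle-lift l (hor true) (E₀ ∷ E₂ ∷ r)))
    v : Move (lift l vert) _ p
    v = move (subst (Active (lift l vert)) (sym π-z) (Active-lift l vert (D ∷ U ∷ r) refl))
      (trans π-p (sym (trans (cong (toggle (lift l vert)) π-z) (toggle-lift l vert (D ∷ U ∷ r)))))
    square : mv h₀ ◅◅ mv (Move-sym m) ~ mv h₁ ◅◅ mv v
    square = mv-turn
      (subst (λ e → Turn (lift l (hor false)) e (lift l (hor true)) (lift l vert)) (sym e≡)
             (Turn-lift l (turn false true))) h₀ (Move-sym m) h₁ v
    horizontal : ∀ {r x y} (x : Move (lift l (hor r)) x y) → T _ ◅◅ mv x ~ T _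
    horizontal {r} x = T-flat x (Horizontal⇒Flat 0ℤ _ (Horizontal-lift l (hor r)) (active x))
    T-p : T p ~ ℓ ◅◅ T q ◅◅ mv (Move-sym m)
    T-p = begin
      T p                                     ≈⟨ moveʳ (mv (Move-sym v)) (rep refl (Move-sym v) π-p) ⟩
      (ℓ ◅◅ T _) ◅◅ inv (mv (Move-sym v))     ≈⟨ ◅◅-congˡ (ℓ ◅◅ T _) (≃-sym (mv-sym (Move-sym v) v)) ⟩
      (ℓ ◅◅ T _) ◅◅ mv v                      ≡⟨ ◅◅-assoc ℓ (T _) (mv v) ⟩
      ℓ ◅◅ T _ ◅◅ mv v                        ≈⟨ ◅◅-congˡ ℓ (◅◅-congʳ (mv v) (horizontal h₁)) ⟨
      ℓ ◅◅ (T _ ◅◅ mv h₁) ◅◅ mv v             ≡⟨ cong (ℓ ◅◅_) (◅◅-assoc (T _) (mv h₁) (mv v)) ⟩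
      ℓ ◅◅ T _ ◅◅ mv h₁ ◅◅ mv v               ≈⟨ ◅◅-congˡ ℓ (◅◅-congˡ (T _) square) ⟨
      ℓ ◅◅ T _ ◅◅ mv h₀ ◅◅ mv (Move-sym m)    ≡⟨ cong (ℓ ◅◅_) (◅◅-assoc (T _) (mv h₀) (mv (Move-sym m))) ⟨
      ℓ ◅◅ (T _ ◅◅ mv h₀) ◅◅ mv (Move-sym m)  ≈⟨ ◅◅-congˡ ℓ (◅◅-congʳ (mv (Move-sym m)) (horizontal h₀)) ⟩
      ℓ ◅◅ T q ◅◅ mv (Move-sym m)             ∎
  Rep-carry {ℓ} l D r _ rep {e} {p} {q} refl m eq = begin
    T p ◅◅ mv m                   ≈⟨ ◅◅-congʳ (mv m) (horizontal h₁) ⟨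
    (T _ ◅◅ mv h₁) ◅◅ mv m        ≡⟨ ◅◅-assoc (T _) (mv h₁) (mv m) ⟩
    T _ ◅◅ mv h₁ ◅◅ mv m          ≈⟨ ◅◅-congˡ (T _) square ⟨
    T _ ◅◅ mv h₀ ◅◅ mv v          ≡⟨ ◅◅-assoc (T _) (mv h₀) (mv v) ⟨
    (T _ ◅◅ mv h₀) ◅◅ mv v        ≈⟨ ◅◅-congʳ (mv v) (horizontal h₀) ⟩
    T _ ◅◅ mv v                   ≈⟨ rep refl v π-z ⟩
    ℓ ◅◅ T q                      ∎
    where
    open ~-Reasoning
    e≡ : lift (l ++ D ∷ []) vert ≡ lift l (there vert)
    e≡ = lift-∷ʳ l D vert
    π-p : π p ≡ l ++ D ∷ U ∷ r
    π-p = trans eq (++-assoc l (D ∷ []) (U ∷ r))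
    π-q : π q ≡ l ++ D ∷ D ∷ r
    π-q = trans (moved m) (trans (cong₂ toggle e≡ π-p) (toggle-lift l (there vert) (D ∷ U ∷ r)))
    y = moveTo (lift l (hor true)) p
      (subst (Active (lift l (hor true))) (sym π-p) (Active-lift l (hor true) (D ∷ U ∷ r) refl))
    π-y : π (movePlug (lift l (hor true)) p _) ≡ l ++ E₀ ∷ E₂ ∷ r
    π-y = trans (moved y) (trans (cong (toggle (lift l (hor true))) π-p) (toggle-lift l (hor true) (D ∷ U ∷ r)))
    h₁ = Move-sym y
    h₀ = moveTo (lift l (hor false)) _
      (subst (Active (lift l (hor false))) (sym π-y) (Active-lift l (hor false) (E₀ ∷ E₂ ∷ r) refl))
    π-z : π (movePlug (lift l (hor false)) _ _) ≡ l ++ U ∷ D ∷ r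
    π-z = trans (moved h₀) (trans (cong (toggle (lift l (hor false))) π-y) (toggle-lift l (hor false) (E₀ ∷ E₂ ∷ r)))
    v : Move (lift l vert) _ q
    v = move (subst (Active (lift l vert)) (sym π-z) (Active-lift l vert (U ∷ D ∷ r) refl))
      (trans π-q (sym (trans (cong (toggle (lift l vert)) π-z) (toggle-lift l vert (U ∷ D ∷ r)))))
    square : mv h₀ ◅◅ mv v ~ mv h₁ ◅◅ mv m
    square = mv-turn
      (subst (λ e → Turn (lift l (hor false)) (lift l vert) (lift l (hor true)) e) (sym e≡)
             (Turn-lift l (turn false false))) h₀ v h₁ m
    horizontal : ∀ {r x y} (x : Move (lift l (hor r)) x y) → T _ ◅◅ mv x ~ T _
    horizontal {r} x = T-flat x (Horizontal⇒Flat 0ℤ _ (Horizontal-lift l (hor r)) (active x))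

  Rep-carries : ∀ {ℓ} l ss r → All Single ss → Rep ℓ l (ss ++ r) → Rep ℓ (l ++ ss) r
  Rep-carries {ℓ} l []       r []             rep = subst (λ l → Rep ℓ l r) (sym (++-identityʳ l)) rep
  Rep-carries {ℓ} l (c ∷ ss) r (sing ∷ sings) rep = subst (λ l → Rep ℓ l r) (++-assoc l (c ∷ []) ss)
    (Rep-carries (l ++ c ∷ []) ss r sings (Rep-carry l c (ss ++ r) sing rep))

  -- Behind r the height is back at 0, where vertical hops are flat as well, so each single column
  -- can be set to `D`.
  Rep-flatten : ∀ {ℓ} l r ss → All Single ss → total l +ᶻ total r ≡ 0ℤ →
                Rep ℓ l (r ++ flatten ss) → Rep ℓ l (r ++ ss)
  Rep-flatten l r [] [] tot rep = rep
  Rep-flatten {ℓ} l r (c ∷ ss) (sing ∷ sings) tot rep = to-D c sing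
    where
    rest : Rep ℓ l (r ++ D ∷ ss)
    rest = subst (Rep ℓ l) (++-assoc r (D ∷ []) ss)
      (Rep-flatten l (r ++ D ∷ []) ss sings
        (trans (cong (total l +ᶻ_) (trans (total-++ r (D ∷ [])) (ℤ.+-identityʳ (total r)))) tot)
        (subst (Rep ℓ l) (sym (++-assoc r (D ∷ []) (flatten ss))) rep))
    to-D : ∀ c → Single c → Rep ℓ l (r ++ c ∷ ss)
    to-D D _ = rest
    to-D U _ = Rep-slide f (Disj-lift l vert (there (lift r vert)) tt) refl
      (Active-lift l (there (lift r vert)) (U ∷ r ++ U ∷ ss) (Active-lift r vert (U ∷ ss) refl))
      (Flat-lift 0ℤ l (there (lift r vert)) (U ∷ r ++ U ∷ ss)
        (Flat-lift (0ℤ +ᶻ total l +ᶻ 0ℤ) r vert (U ∷ ss) (trans (lemma (total l) (total r)) tot)))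
      (trans (toggle-lift l (there (lift r vert)) (U ∷ r ++ U ∷ ss))
             (cong (λ s → l ++ U ∷ s) (toggle-lift r vert (U ∷ ss))))
      rest
      where
      f = lift l (there (lift r vert))
      lemma : ∀ x y → 0ℤ +ᶻ x +ᶻ 0ℤ +ᶻ y ≡ x +ᶻ y
      lemma = ℤ-Ring.solve-∀

  -- The height reaches m in |m| columns, the mark takes one, and another |m| bring the height back
  -- to 0. The rest of the L columns is filled with `D`.
  normalR : ℤ → List Col
  normalR m = slope (ℤ.- m) ++ replicate (L ℕ.∸ suc (abs m ℕ.+ abs m)) D

  -- Singles left of the mark are carried across it and normalised together with the columns there;
  -- the singles that result are flattened. Only the slopes remain, and the height determines them,
  -- while L fixes the number of the other columns.
  Rep-normal : ∀ {ℓ} l r → Valid (l ++ U ∷ r) → Rep ℓ (slope (total l)) (normalR (total l)) → Rep ℓ l r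
  Rep-normal {ℓ} l r (len , tot) rep with normalise l
  ... | normalised k x ss sing hops with normalise (ss ++ r)
  ... | normalised k′ x′ ss′ sing′ hops′ =
    Rep-↝ˡ hops (Rep-carries (replicate k (double-col x)) ss r sing (Rep-↝ʳ hops′
      (Rep-flatten (replicate k (double-col x)) (replicate k′ (double-col x′)) ss′ sing′
        (trans (cong₂ _+ᶻ_ total-k total-k′) (ℤ.+-inverseʳ (total l)))
        (subst₂ (Rep ℓ) slope-l (cong₂ _++_ slope-r (cong (λ n → replicate n D) length-ss′)) rep))))
    where
    m = total l
    total-k : total (replicate k (double-col x)) ≡ m
    total-k = sym (trans (total-↝ hops) (trans (total-++ (replicate k (double-col x)) ss)
      (trans (cong (total (replicate k (double-col x)) +ᶻ_) (total-singles sing)) (ℤ.+-identityʳ _))))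
    total-r : total r ≡ ℤ.- m
    total-r = trans (lemma (total r) m) (trans (cong (_+ᶻ ℤ.- m)
      (trans (cong (m +ᶻ_) (sym (ℤ.+-identityˡ (total r)))) (trans (sym (total-++ l (U ∷ r))) tot)))
      (ℤ.+-identityˡ (ℤ.- m)))
      where
      lemma : ∀ r m → r ≡ m +ᶻ r +ᶻ ℤ.- m
      lemma = ℤ-Ring.solve-∀
    total-k′ : total (replicate k′ (double-col x′)) ≡ ℤ.- m
    total-k′ = sym (begin
      ℤ.- m                  ≡⟨ total-r ⟨
      total r                ≡⟨ ℤ.+-identityˡ (total r) ⟨
      0ℤ +ᶻ total r          ≡⟨ cong (_+ᶻ total r) (total-singles sing) ⟨
      total ss +ᶻ total r    ≡⟨ total-++ ss r ⟨
      total (ss ++ r)        ≡⟨ total-↝ hops′ ⟩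
      total (replicate k′ (double-col x′) ++ ss′) ≡⟨ total-++ (replicate k′ (double-col x′)) ss′ ⟩
      total (replicate k′ (double-col x′)) +ᶻ total ss′
        ≡⟨ cong (total (replicate k′ (double-col x′)) +ᶻ_) (total-singles sing′) ⟩
      total (replicate k′ (double-col x′)) +ᶻ 0ℤ  ≡⟨ ℤ.+-identityʳ _ ⟩
      total (replicate k′ (double-col x′))        ∎)
      where open ≡-Reasoning
    -- For k = 0 the kind x of the doubles is undetermined, hence the comparison of lists through
    -- `slope`.
    slope-l : slope m ≡ replicate k (double-col x)
    slope-l = trans (cong slope (trans (sym total-k) (total-doubles k x))) (slope-signed x k)
    slope-r : slope (ℤ.- m) ≡ replicate k′ (double-col x′)
    slope-r = trans (cong slope (trans (sym total-k′) (total-doubles k′ x′))) (slope-signed x′ k′)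
    k≡ : k ≡ abs m
    k≡ = trans (sym (length-replicate k)) (trans (cong length (sym slope-l)) (length-slope m))
    k′≡ : k′ ≡ abs m
    k′≡ = trans (sym (length-replicate k′)) (trans (cong length (sym slope-r))
      (trans (length-slope (ℤ.- m)) (ℤ.∣-i∣≡∣i∣ m)))
    length-ss′ : L ℕ.∸ suc (abs m ℕ.+ abs m) ≡ length ss′
    length-ss′ = trans (cong (ℕ._∸ suc (abs m ℕ.+ abs m)) L≡) (ℕ.m+n∸m≡n (suc (abs m ℕ.+ abs m)) (length ss′))
      where
      open ≡-Reasoning
      length-l : length l ≡ abs m ℕ.+ length ss
      length-l = trans (length-↝ hops) (trans (length-++ (replicate k (double-col x)))
        (cong (ℕ._+ length ss) (trans (length-replicate k) k≡)))
      length-r : length ss ℕ.+ length r ≡ abs m ℕ.+ length ss′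
      length-r = trans (sym (length-++ ss)) (trans (length-↝ hops′)
        (trans (length-++ (replicate k′ (double-col x′))) (cong (ℕ._+ length ss′) (trans (length-replicate k′) k′≡))))
      eq₁ : ∀ x y z → x ℕ.+ y ℕ.+ ℕ.suc z ≡ ℕ.suc (x ℕ.+ (y ℕ.+ z))
      eq₁ = ℕ-Ring.solve-∀
      eq₂ : ∀ x y z → ℕ.suc (x ℕ.+ (y ℕ.+ z)) ≡ ℕ.suc (x ℕ.+ y) ℕ.+ z
      eq₂ = ℕ-Ring.solve-∀
      L≡ : L ≡ suc (abs m ℕ.+ abs m) ℕ.+ length ss′
      L≡ = begin
        L                                               ≡⟨ len ⟨
        length (l ++ U ∷ r)                             ≡⟨ length-++ l ⟩
        length l ℕ.+ suc (length r)                     ≡⟨ cong (ℕ._+ suc (length r)) length-l ⟩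
        abs m ℕ.+ length ss ℕ.+ suc (length r)          ≡⟨ eq₁ (abs m) (length ss) (length r) ⟩
        suc (abs m ℕ.+ (length ss ℕ.+ length r))        ≡⟨ cong (λ n → suc (abs m ℕ.+ n)) length-r ⟩
        suc (abs m ℕ.+ (abs m ℕ.+ length ss′))          ≡⟨ eq₂ (abs m) (abs m) (length ss′) ⟩
        suc (abs m ℕ.+ abs m) ℕ.+ length ss′            ∎

-- The map Ψ from words to loops

data Shape (s : List Col) : Hop → Set where
  horizontal : ∀ {e} → Horizontal e → Shape s e
  vertical   : ∀ l c r → Single c → s ≡ l ++ c ∷ r → Shape s (lift l vert)

shape : ∀ e s → Active e s → Shape s e
shape vert      ((x , y) ∷ s) act = vertical [] (x , y) s act refl
shape (hor r)   s             act = horizontal (hor r)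
shape (there e) (c ∷ s)       act with shape e s act
... | horizontal h              = horizontal (there h)
... | vertical l d r sing refl  = vertical (c ∷ l) d r sing refl

-- Of the points 0, m and n on a line one lies between the other two, so one of the three distances
-- is the sum of the others.
abs-degenerate : ∀ m n → abs m ≡ abs n ℕ.+ abs (m - n) ⊎ abs n ≡ abs m ℕ.+ abs (m - n) ⊎
                 abs (m - n) ≡ abs m ℕ.+ abs n
abs-degenerate (+ m) (+ zero)     = inj₁ (sym (ℕ.+-identityʳ m))
abs-degenerate (+ m) +[1+ n ] with ℕ.≤-total m (suc n)
... | inj₁ m≤n = inj₂ (inj₁ (sym (trans (cong (m ℕ.+_) (ℤ.∣⊖∣-≤ m≤n)) (ℕ.m+[n∸m]≡n m≤n))))
... | inj₂ n≤m = inj₁ (sym (trans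
  (cong (suc n ℕ.+_) (trans (ℤ.∣m⊖n∣≡∣n⊖m∣ m (suc n)) (ℤ.∣⊖∣-≤ n≤m))) (ℕ.m+[n∸m]≡n n≤m)))
abs-degenerate (+ m) -[1+ n ]     = inj₂ (inj₂ refl)
abs-degenerate -[1+ m ] (+ zero)  = inj₁ refl
abs-degenerate -[1+ m ] +[1+ n ]  = inj₂ (inj₂ (cong suc (sym (ℕ.+-suc m n))))
abs-degenerate -[1+ m ] -[1+ n ] with ℕ.≤-total (suc n) (suc m)
... | inj₁ n≤m = inj₁ (sym (trans (cong (suc n ℕ.+_) (ℤ.∣⊖∣-≤ n≤m)) (ℕ.m+[n∸m]≡n n≤m)))
... | inj₂ m≤n = inj₂ (inj₁ (sym (trans
  (cong (suc m ℕ.+_) (trans (ℤ.∣m⊖n∣≡∣n⊖m∣ (suc n) (suc m)) (ℤ.∣⊖∣-≤ m≤n))) (ℕ.m+[n∸m]≡n m≤n))))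

-- The three numbers add up to twice the largest one, which is below ⌊L/2⌋. This is the converse of
-- the count in `InR-bound`.
InR⇒room : ∀ {L} m n → InR L m n → abs m ℕ.+ abs (n - m) ℕ.+ abs n ℕ.+ 2 ≤ L
InR⇒room {L} m n inR = begin
  abs m ℕ.+ abs (n - m) ℕ.+ abs n ℕ.+ 2  ≡⟨ cong (λ x → abs m ℕ.+ x ℕ.+ abs n ℕ.+ 2) (ℤ.∣i-j∣≡∣j-i∣ n m) ⟩
  abs m ℕ.+ abs (m - n) ℕ.+ abs n ℕ.+ 2  ≤⟨ bound (abs-degenerate m n) ⟩
  L ∎
  where
  open ℕ.≤-Reasoning
  m< : abs m ℕ.< ⌊ L /2⌋
  m< = ℕ.≤-trans (s≤s (ℕ.≤-trans (ℕ.m≤m⊔n (abs m) (abs n)) (ℕ.m≤m⊔n _ (abs (m - n))))) inR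
  n< : abs n ℕ.< ⌊ L /2⌋
  n< = ℕ.≤-trans (s≤s (ℕ.≤-trans (ℕ.m≤n⊔m (abs m) (abs n)) (ℕ.m≤m⊔n _ (abs (m - n))))) inR
  d< : abs (m - n) ℕ.< ⌊ L /2⌋
  d< = ℕ.≤-trans (s≤s (ℕ.m≤n⊔m (abs m ℕ.⊔ abs n) (abs (m - n)))) inR
  bound : abs m ≡ abs n ℕ.+ abs (m - n) ⊎ abs n ≡ abs m ℕ.+ abs (m - n) ⊎ abs (m - n) ≡ abs m ℕ.+ abs n →
          abs m ℕ.+ abs (m - n) ℕ.+ abs n ℕ.+ 2 ≤ L
  bound (inj₁ eq) = ℕ.≤-trans (ℕ.≤-reflexive (trans (lemma (abs m) (abs (m - n)) (abs n))
    (cong (λ x → suc (abs m) ℕ.+ suc x) (sym eq)))) (half-+ m<)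
    where
    lemma : ∀ x y z → x ℕ.+ y ℕ.+ z ℕ.+ 2 ≡ ℕ.suc x ℕ.+ ℕ.suc (z ℕ.+ y)
    lemma = ℕ-Ring.solve-∀
  bound (inj₂ (inj₁ eq)) = ℕ.≤-trans (ℕ.≤-reflexive (trans (lemma (abs m) (abs (m - n)) (abs n))
    (cong (λ x → suc (abs n) ℕ.+ suc x) (sym eq)))) (half-+ n<)
    where
    lemma : ∀ x y z → x ℕ.+ y ℕ.+ z ℕ.+ 2 ≡ ℕ.suc z ℕ.+ ℕ.suc (x ℕ.+ y)
    lemma = ℕ-Ring.solve-∀
  bound (inj₂ (inj₂ eq)) = ℕ.≤-trans (ℕ.≤-reflexive (trans (lemma (abs m) (abs (m - n)) (abs n))
    (cong (λ x → suc (abs (m - n)) ℕ.+ suc x) (sym eq)))) (half-+ d<)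
    where
    lemma : ∀ x y z → x ℕ.+ y ℕ.+ z ℕ.+ 2 ≡ ℕ.suc y ℕ.+ ℕ.suc (x ℕ.+ z)
    lemma = ℕ-Ring.solve-∀

-- The height needs |m| columns to be reached and |m| to return to 0, and the marked column is one
-- more.
twice-height : ∀ l r → total (l ++ U ∷ r) ≡ 0ℤ →
               suc (abs (total l) ℕ.+ abs (total l)) ≤ length (l ++ U ∷ r)
twice-height l r tot = begin
  suc (abs m ℕ.+ abs m)       ≤⟨ s≤s (ℕ.+-mono-≤ (abs-total l) (abs-height m r end)) ⟩
  suc (length l ℕ.+ length r) ≡⟨ ℕ.+-suc (length l) (length r) ⟨
  length l ℕ.+ length (U ∷ r) ≡⟨ length-++ l ⟨
  length (l ++ U ∷ r)         ∎
  where
  open ℕ.≤-Reasoning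
  m = total l
  end : m +ᶻ total r ≡ 0ℤ
  end = trans (cong (m +ᶻ_) (sym (ℤ.+-identityˡ (total r)))) (trans (sym (total-++ l (U ∷ r))) tot)

module Inverse (L : ℕ) (3≤L : 3 ≤ L) where

  open Marks L 3≤L public
  open Weights L using (α; wt; wt-disj)

  open ~-Reasoning

  wt-horizontal : ∀ h {e} s → Horizontal e → Active e s → wt h e s ≡ one
  wt-horizontal h s       (hor r)   act = refl
  wt-horizontal h (c ∷ s) (there x) act = wt-horizontal (h +ᶻ exc c) s x act

  wt-lift : ∀ h l e s → wt h (lift l e) (l ++ s) ≡ wt (h +ᶻ total l) e s
  wt-lift h []      e s = cong (λ h → wt h e s) (sym (ℤ.+-identityʳ h))
  wt-lift h (c ∷ l) e s = trans (wt-lift (h +ᶻ exc c) l e s)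
    (cong (λ h → wt h e s) (sym (height-∷ h c l)))

  -- The bound |m| ≤ ⌊(L-1)/2⌋ on the indices of symbols, doubled so that it counts columns.
  Fits-L : ℤ → Set
  Fits-L m = suc (abs m ℕ.+ abs m) ≤ L

  Valid-normal : ∀ m → Fits-L m → Valid (slope m ++ U ∷ normalR m)
  Valid-normal m fit = len , tot
    where
    k = L ℕ.∸ suc (abs m ℕ.+ abs m)
    len : length (slope m ++ U ∷ normalR m) ≡ L
    len = trans (length-++ (slope m)) (trans
      (cong₂ (λ x y → x ℕ.+ suc y) (length-slope m)
        (trans (length-++ (slope (ℤ.- m))) (cong₂ ℕ._+_ (trans (length-slope (ℤ.- m)) (ℤ.∣-i∣≡∣i∣ m)) (length-replicate k))))
      (trans (lemma (abs m) k) (ℕ.m+[n∸m]≡n fit)))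
      where
      lemma : ∀ x k → x ℕ.+ ℕ.suc (x ℕ.+ k) ≡ ℕ.suc (x ℕ.+ x) ℕ.+ k
      lemma = ℕ-Ring.solve-∀
    tot : total (slope m ++ U ∷ normalR m) ≡ 0ℤ
    tot = trans (total-++ (slope m) (U ∷ normalR m)) (trans
      (cong₂ (λ x y → x +ᶻ (0ℤ +ᶻ y)) (total-slope m)
        (trans (total-++ (slope (ℤ.- m)) (replicate k D)) (cong₂ _+ᶻ_ (total-slope (ℤ.- m)) (total-D k))))
      (lemma m))
      where
      lemma : ∀ m → m +ᶻ (0ℤ +ᶻ (ℤ.- m +ᶻ 0ℤ)) ≡ 0ℤ
      lemma = ℤ-Ring.solve-∀

  module _ (l r : List Col) (val : Valid (l ++ U ∷ r)) where
    private
      p = plugOf (l ++ U ∷ r) val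
      π-p : π p ≡ l ++ U ∷ r
      π-p = π-plugOf (l ++ U ∷ r) val
      m : Move (lift l vert) p _
      m = moveTo (lift l vert) p (subst (Active (lift l vert)) (sym π-p) (Active-lift l vert (U ∷ r) refl))

    loopBetween : Path K base base
    loopBetween = T p ◅◅ mv m ◅◅ inv (T _)

    Rep-loopBetween : Rep loopBetween l r
    Rep-loopBetween {p = p′} refl m′ eq = go (π-injective (trans eq (sym π-p))) m′
      where
      go₂ : ∀ {q′} → (m′ : Move (lift l vert) p q′) → q′ ≡ _ → T p ◅◅ mv m′ ~ loopBetween ◅◅ T q′
      go₂ m′ refl = begin
        T p ◅◅ mv m′                         ≡⟨ cong (T p ◅◅_) (mv-unique m′ m) ⟩
        T p ◅◅ mv m                          ≈⟨ moveʳ′ (T _) (≡⇒~ (sym (◅◅-assoc (T p) (mv m) (inv (T _))))) ⟨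
        loopBetween ◅◅ T _                   ∎
      go : ∀ {p′ q′} → p′ ≡ p → (m′ : Move (lift l vert) p′ q′) → T p′ ◅◅ mv m′ ~ loopBetween ◅◅ T q′
      go refl m′ = go₂ m′ (Move-unique m′ m)

    loopBetween-flat : total l ≡ 0ℤ → loopBetween ~ ε
    loopBetween-flat tot = begin
      T p ◅◅ mv m ◅◅ inv (T _)     ≡⟨ ◅◅-assoc (T p) (mv m) (inv (T _)) ⟨
      (T p ◅◅ mv m) ◅◅ inv (T _)   ≈⟨ ◅◅-congʳ (inv (T _)) (T-flat m flat) ⟩
      T _ ◅◅ inv (T _)             ≈⟨ inv-inverseʳ (T _) ⟩
      ε                            ∎
      where
      flat : Flat 0ℤ (lift l vert) (π p)
      flat = subst (Flat 0ℤ (lift l vert)) (sym π-p)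
        (Flat-lift 0ℤ l vert (U ∷ r) (trans (ℤ.+-identityˡ (total l)) tot))

  loopDec : ∀ m → Dec (Fits-L m) → Path K base base
  loopDec m (yes fit) = loopBetween (slope m) (normalR m) (Valid-normal m fit)
  loopDec m (no _)    = ε

  Valid⇒Fits-L : ∀ l r → Valid (l ++ U ∷ r) → Fits-L (total l)
  Valid⇒Fits-L l r (len , tot) = subst (suc (abs (total l) ℕ.+ abs (total l)) ≤_) len (twice-height l r tot)

  abstract
    -- The image of a_m, read off at the normal form. A height at which no plug has a vertical hop
    -- gets the trivial loop, in agreement with `α`.
    loopOf : ℤ → Path K base base
    loopOf m = loopDec m (suc (abs m ℕ.+ abs m) ℕ.≤? L)

    loopOf-0 : loopOf 0ℤ ~ ε
    loopOf-0 = go (1 ℕ.≤? L)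
      where
      go : ∀ d → loopDec 0ℤ d ~ ε
      go (yes fit) = loopBetween-flat [] (normalR 0ℤ) (Valid-normal 0ℤ fit) refl
      go (no _)    = ≃-refl

    Rep-loopOf : ∀ l r → Valid (l ++ U ∷ r) → Rep (loopOf (total l)) l r
    Rep-loopOf l r val = go (suc (abs (total l) ℕ.+ abs (total l)) ℕ.≤? L)
      where
      go : ∀ d → Rep (loopDec (total l) d) l r
      go (yes fit) = Rep-normal l r val
        (Rep-loopBetween (slope (total l)) (normalR (total l)) (Valid-normal (total l) fit))
      go (no ¬fit) = contradiction (Valid⇒Fits-L l r val) ¬fit

  Ψ : Word (Symbol L) → Path K base base
  Ψ (gen x) = loopOf (index x)
  Ψ one     = ε
  Ψ (x ∙ y) = Ψ x ◅◅ Ψ y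
  Ψ (x ⁻¹)  = inv (Ψ x)

  -- At height 0 the word is 1, and the loop is trivial because the hop there is flat.
  Ψ-α : ∀ m → Fits-L m → Ψ (α m) ~ loopOf m
  Ψ-α m fit = go (m ℤ.≟ 0ℤ)
    where
    go : Dec (m ≡ 0ℤ) → Ψ (α m) ~ loopOf m
    go (yes refl) = ≃-sym loopOf-0
    go (no m≢0)   = ≡⇒~ (cong Ψ (Weights.α-index L (a m m≢0 (+-half (abs m) (ℕ.∸-monoˡ-≤ 1 fit)))))

  T-up : ∀ l r {p q} (m : Move (lift l vert) p q) → π p ≡ l ++ U ∷ r →
         T p ◅◅ mv m ~ Ψ (α (total l)) ◅◅ T q
  T-up l r {p} {q} m eq = ≃-trans (Rep-loopOf l r val refl m eq)
    (◅◅-congʳ (T q) (≃-sym (Ψ-α (total l) (Valid⇒Fits-L l r val))))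
    where
    val : Valid (l ++ U ∷ r)
    val = subst Valid eq (Valid-π p)

  -- Between the paths `T`, every hop is Ψ of its weight: horizontal hops are flat, a hop from `U`
  -- to `D` has the class found at the normal form, and one from `D` to `U` is the inverse of such a
  -- hop.
  T-move : ∀ {e p q} (m : Move e p q) → T p ◅◅ mv m ~ Ψ (wt 0ℤ e (π p)) ◅◅ T q
  T-move {e} {p} {q} m = go (shape e (π p) (active m)) m
    where
    wt-col : ∀ {p} l c r → π p ≡ l ++ c ∷ r → wt 0ℤ (lift l vert) (π p) ≡ wt (total l) vert (c ∷ r)
    wt-col l c r eq = trans (cong (wt 0ℤ (lift l vert)) eq)
      (trans (wt-lift 0ℤ l vert (c ∷ r)) (cong (λ h → wt h vert (c ∷ r)) (ℤ.+-identityˡ (total l))))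
    go : ∀ {e} → Shape (π p) e → (m : Move e p q) → T p ◅◅ mv m ~ Ψ (wt 0ℤ e (π p)) ◅◅ T q
    go (horizontal h) m = ≃-trans (T-flat m (Horizontal⇒Flat 0ℤ (π p) h (active m)))
      (≡⇒~ (cong (λ w → Ψ w ◅◅ T q) (sym (wt-horizontal 0ℤ (π p) h (active m)))))
    go (vertical l U r _ eq) m = ≃-trans (T-up l r m eq)
      (≡⇒~ (cong (λ w → Ψ w ◅◅ T q) (sym (wt-col {p} l U r eq))))
    go (vertical l D r _ eq) m = begin
      T p ◅◅ mv m                            ≈⟨ ◅◅-congˡ (T p) (mv-sym (Move-sym m) m) ⟩
      T p ◅◅ inv (mv (Move-sym m))           ≈⟨ moveʳ (mv (Move-sym m)) claim ⟨
      inv (Ψ (α (total l))) ◅◅ T q           ≡⟨ cong (λ w → Ψ w ◅◅ T q) (wt-col {p} l D r eq) ⟨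
      Ψ (wt 0ℤ (lift l vert) (π p)) ◅◅ T q   ∎
      where
      π-q : π q ≡ l ++ U ∷ r
      π-q = trans (moved m) (trans (cong (toggle (lift l vert)) eq) (toggle-lift l vert (D ∷ r)))
      claim : (inv (Ψ (α (total l))) ◅◅ T q) ◅◅ mv (Move-sym m) ~ T p
      claim = ≃-trans (≡⇒~ (◅◅-assoc (inv (Ψ (α (total l)))) (T q) (mv (Move-sym m))))
        (≃-sym (moveˡ (Ψ (α (total l))) (≃-sym (T-up l r (Move-sym m) π-q))))

  target : ∀ {e p q} → Move e p q → Plug Rect
  target {q = q} _ = q

  T-two : ∀ {e f p q t} → Disj e f → (m : Move e p q) (m′ : Move f q t) →
          T p ◅◅ mv m ◅◅ mv m′ ~ (Ψ (wt 0ℤ e (π p)) ◅◅ Ψ (wt 0ℤ f (π p))) ◅◅ T t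
  T-two {e} {f} {p} {q} {t} d m m′ = begin
    T p ◅◅ mv m ◅◅ mv m′     ≡⟨ ◅◅-assoc (T p) (mv m) (mv m′) ⟨
    (T p ◅◅ mv m) ◅◅ mv m′   ≈⟨ ◅◅-congʳ (mv m′) (T-move m) ⟩
    (x ◅◅ T q) ◅◅ mv m′      ≡⟨ ◅◅-assoc x (T q) (mv m′) ⟩
    x ◅◅ T q ◅◅ mv m′        ≈⟨ ◅◅-congˡ x (T-move m′) ⟩
    x ◅◅ Ψ (wt 0ℤ f (π q)) ◅◅ T t
      ≡⟨ cong (λ w → x ◅◅ Ψ w ◅◅ T t) (trans (cong (wt 0ℤ f) (moved m)) (wt-disj 0ℤ e f (π p) d (active m))) ⟩
    x ◅◅ y ◅◅ T t            ≡⟨ ◅◅-assoc x y (T t) ⟨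
    (x ◅◅ y) ◅◅ T t          ∎
    where
    x = Ψ (wt 0ℤ e (π p))
    y = Ψ (wt 0ℤ f (π p))

  -- The witness is a plug with hops U → D at heights m and n in two different columns;
  -- InR leaves just enough room for it.
  module _ (m n : ℤ) (inR : InR L m n) where
    private
      k = L ℕ.∸ (abs m ℕ.+ abs (n - m) ℕ.+ abs n ℕ.+ 2)
      tail = slope (ℤ.- n) ++ replicate k D
      mid = slope (n - m) ++ U ∷ tail
      s = slope m ++ U ∷ mid
      e = lift (slope m) vert
      f′ : Hop
      f′ = there (lift (slope (n - m)) vert)
      f = lift (slope m) f′

      val : Valid s
      val = len , tot
        where
        lemma : ∀ x y z k → x ℕ.+ ℕ.suc (y ℕ.+ ℕ.suc (z ℕ.+ k)) ≡ (x ℕ.+ y ℕ.+ z ℕ.+ 2) ℕ.+ k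
        lemma = ℕ-Ring.solve-∀
        lemma′ : ∀ m n → m +ᶻ (0ℤ +ᶻ (n - m +ᶻ (0ℤ +ᶻ (ℤ.- n +ᶻ 0ℤ)))) ≡ 0ℤ
        lemma′ = ℤ-Ring.solve-∀
        len-tail : length tail ≡ abs n ℕ.+ k
        len-tail = trans (length-++ (slope (ℤ.- n)))
          (cong₂ ℕ._+_ (trans (length-slope (ℤ.- n)) (ℤ.∣-i∣≡∣i∣ n)) (length-replicate k))
        len-mid : length mid ≡ abs (n - m) ℕ.+ suc (abs n ℕ.+ k)
        len-mid = trans (length-++ (slope (n - m)))
          (cong₂ (λ x y → x ℕ.+ suc y) (length-slope (n - m)) len-tail)
        len : length s ≡ L
        len = trans (length-++ (slope m)) (trans (cong₂ (λ x y → x ℕ.+ suc y) (length-slope m) len-mid)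
          (trans (lemma (abs m) (abs (n - m)) (abs n) k) (ℕ.m+[n∸m]≡n (InR⇒room m n inR))))
        tot-tail : total tail ≡ ℤ.- n +ᶻ 0ℤ
        tot-tail = trans (total-++ (slope (ℤ.- n)) (replicate k D))
          (cong₂ _+ᶻ_ (total-slope (ℤ.- n)) (total-D k))
        tot-mid : total mid ≡ n - m +ᶻ (0ℤ +ᶻ (ℤ.- n +ᶻ 0ℤ))
        tot-mid = trans (total-++ (slope (n - m)) (U ∷ tail))
          (cong₂ (λ x y → x +ᶻ (0ℤ +ᶻ y)) (total-slope (n - m)) tot-tail)
        tot : total s ≡ 0ℤ
        tot = trans (total-++ (slope m) (U ∷ mid))
          (trans (cong₂ (λ x y → x +ᶻ (0ℤ +ᶻ y)) (total-slope m) tot-mid) (lemma′ m n))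

      p = plugOf s val
      π-p : π p ≡ s
      π-p = π-plugOf s val
      d : Disj e f
      d = Disj-lift (slope m) vert f′ tt
      act-e : Active e (π p)
      act-e = subst (Active e) (sym π-p) (Active-lift (slope m) vert (U ∷ mid) refl)
      act-f : Active f (π p)
      act-f = subst (Active f) (sym π-p)
        (Active-lift (slope m) f′ (U ∷ mid) (Active-lift (slope (n - m)) vert (U ∷ tail) refl))
      m₁ = moveTo e p act-e
      m₃ = moveTo f p act-f
      m₂ = moveTo f (target m₁) (subst (Active f) (sym (moved m₁)) (Active-disj f e (π p) (Disj-sym e f d) act-f))
      m₄ : Move e (target m₃) (target m₂)
      m₄ = move (subst (Active e) (sym (moved m₃)) (Active-disj e f (π p) d act-e))
        (trans (moved m₂) (trans (cong (toggle f) (moved m₁))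
          (trans (sym (toggle-comm e f (π p) d)) (cong (toggle e) (sym (moved m₃))))))

      t = target m₂

      wt-e : wt 0ℤ e (π p) ≡ α m
      wt-e = trans (cong (wt 0ℤ e) π-p) (trans (wt-lift 0ℤ (slope m) vert (U ∷ mid))
        (cong α (trans (ℤ.+-identityˡ (total (slope m))) (total-slope m))))
      wt-f : wt 0ℤ f (π p) ≡ α n
      wt-f = trans (cong (wt 0ℤ f) π-p) (trans (wt-lift 0ℤ (slope m) f′ (U ∷ mid))
        (trans (wt-lift (0ℤ +ᶻ total (slope m) +ᶻ 0ℤ) (slope (n - m)) vert (U ∷ tail))
          (cong α (trans (cong₂ (λ x y → 0ℤ +ᶻ x +ᶻ 0ℤ +ᶻ y) (total-slope m) (total-slope (n - m))) (lemma m n)))))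
        where
        lemma : ∀ m n → 0ℤ +ᶻ m +ᶻ 0ℤ +ᶻ (n - m) ≡ n
        lemma = ℤ-Ring.solve-∀

    -- Both orders of the two hops lead from p to t along homotopic paths; cancelling `T` at t
    -- leaves the two products.
    Ψα-commute : Ψ (α m) ◅◅ Ψ (α n) ~ Ψ (α n) ◅◅ Ψ (α m)
    Ψα-commute = subst₂ (λ x y → Ψ x ◅◅ Ψ y ~ Ψ y ◅◅ Ψ x) wt-e wt-f (cancelʳ (T t) (begin
      (Ψ (wt 0ℤ e (π p)) ◅◅ Ψ (wt 0ℤ f (π p))) ◅◅ T t   ≈⟨ T-two d m₁ m₂ ⟨
      T p ◅◅ mv m₁ ◅◅ mv m₂                             ≈⟨ ◅◅-congˡ (T p) (mv-comm d m₁ m₂ m₃ m₄) ⟩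
      T p ◅◅ mv m₃ ◅◅ mv m₄                             ≈⟨ T-two (Disj-sym e f d) m₃ m₄ ⟩
      (Ψ (wt 0ℤ f (π p)) ◅◅ Ψ (wt 0ℤ e (π p))) ◅◅ T t   ∎))

  Ψ-cong : ∀ {x y} → Relation L ⊢ x ≈ y → Ψ x ~ Ψ y
  Ψ-cong (relation (commute x y inR)) = begin
    ((Ψ (gen x) ◅◅ Ψ (gen y)) ◅◅ inv (Ψ (gen x))) ◅◅ inv (Ψ (gen y))
      ≈⟨ ◅◅-congʳ (inv (Ψ (gen y))) (moveʳ (Ψ (gen x)) (≃-sym commutes)) ⟨
    Ψ (gen y) ◅◅ inv (Ψ (gen y))
      ≈⟨ inv-inverseʳ (Ψ (gen y)) ⟩
    ε ∎
    where
    commutes : Ψ (gen x) ◅◅ Ψ (gen y) ~ Ψ (gen y) ◅◅ Ψ (gen x)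
    commutes = subst₂ (λ x y → Ψ x ◅◅ Ψ y ~ Ψ y ◅◅ Ψ x) (Weights.α-index L x) (Weights.α-index L y)
      (Ψα-commute (index x) (index y) inR)
  Ψ-cong ≈-refl             = ≃-refl
  Ψ-cong (≈-sym h)          = ≃-sym (Ψ-cong h)
  Ψ-cong (≈-trans h k)      = ≃-trans (Ψ-cong h) (Ψ-cong k)
  Ψ-cong (∙-cong h k)       = ◅◅-cong (Ψ-cong h) (Ψ-cong k)
  Ψ-cong (⁻¹-cong h)        = inv-cong (Ψ-cong h)
  Ψ-cong (assoc x y z)      = ≡⇒~ (◅◅-assoc (Ψ x) (Ψ y) (Ψ z))
  Ψ-cong (identityˡ x)      = ≃-refl
  Ψ-cong (identityʳ x)      = ≡⇒~ (◅◅-identityʳ (Ψ x))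
  Ψ-cong (inverseˡ x)       = inv-inverseˡ (Ψ x)
  Ψ-cong (inverseʳ x)       = inv-inverseʳ (Ψ x)

-- The weight of an edge

module Filling (L : ℕ) (3≤L : 3 ≤ L) where

  open Inverse L 3≤L public
  open Weights L public using (_≈_; ∙-congˡ; ∙-congʳ; ≡⇒≈; wt; α; wt-swap; wt-flat)
  module W = Weights L

  -- The dominoes of a pairing, listed in the order in which they are added to p
  -- until the complement of r is reached.
  data Fill : Plug Rect → Plug Rect → Pairing Rect → Set where
    done : ∀ {p r t} → squares r ≡ ∁ (squares p) → t ≡ id-pairing → Fill p r t
    more : ∀ {e p q r t t′} (x : Adds e p q) → Fill q r t′ →
           t ≡ addDomino Rect (Adds.s x) (Adds.s′ x) t′ → Fill p r t

  Ω : ∀ {p r t} → Fill p r t → Word (Symbol L)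
  Ω (done _ _)             = one
  Ω (more {e} {p} x F _)   = wt 0ℤ e (π p) ∙ Ω F

  Fill⇒Fits : ∀ {p r t} → Fill p r t → Fits (squares p) (squares r) t
  Fill⇒Fits (done eq refl)    = Fits-id eq
  Fill⇒Fits (more x F refl)   = Adds.Fits-added x (Fill⇒Fits F)

  addAt : ∀ {e s s′} p → At L e s s′ → lookup (squares p) s ≡ false → lookup (squares p) s′ ≡ false →
          ∃ λ q → Adds e p q
  addAt {e} p at free free′ =
    let act = ≡⇒Active false (squares p) at (trans free (sym free′))
    in movePlug e p act , Move⇒Adds (moveTo e p act) at free

  size-∁-added : ∀ {e p q} → Adds e p q → size (∁ (squares q)) < size (∁ (squares p))
  size-∁-added {p = p} {q} x = Subset.p⊂q⇒∣p∣<∣q∣ (Subset.p⊂q⇒∁p⊃∁q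
    ( (λ s∈p → true⇒∈ (squares q) (⊆-added _ (∈⇒true s∈p)))
    , s , true⇒∈ (squares q) added-s , false⇒∉ (squares p) free))
    where open Adds x

  no-domino : ∀ {v w t} → (∀ s → lookup t s ≡ s) → Fits v w t → w ≡ ∁ v
  no-domino {v} {w} {t} fixed f = vec-ext w (∁ v) λ s → trans (eq s) (sym (lookup-∁ v s))
    where
    open Fits f
    eq : ∀ s → lookup w s ≡ not (lookup v s)
    eq s with lookup v s in v-s | lookup w s in w-s
    ... | false | true  = refl
    ... | true  | false = refl
    ... | true  | true  = contradiction w-s (disjoint s v-s)
    ... | false | false = contradiction (subst (Adjacent Rect s) (fixed s) (covers s v-s w-s)) Adjacent-irrefl

  abstract
    -- Any square that the pairing moves yields a domino to add next, and fewer squares remain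
    -- outside the plug. As in an edge, the tiling proof is irrelevant, so the filling depends on
    -- the plugs and the pairing alone; what is drawn from that proof is recomputed.
    fillAcc : ∀ p r t → .(Fits (squares p) (squares r) t) → Acc _<_ (size (∁ (squares p))) → Fill p r t
    fillAcc p r t f (acc rs) = search (any? (λ s → ¬? (lookup t s ≟ s)))
      where
      remove : ∀ {e s s′} → At L e s s′ → lookup t s ≡ s′ → Fill p r t
      remove {e} {s} {s′} at t-s = go (addAt p at
          (recompute (_ ≟ᵇ _) (proj₁ (Fits-uncovered f t-s (At-distinct at))))
          (recompute (_ ≟ᵇ _) (proj₁ (proj₂ (Fits-uncovered f t-s (At-distinct at))))))
        where
        go : (∃ λ q → Adds e p q) → Fill p r t
        go (q , x) = more x (fillAcc q r (set₂ t (Adds.s x) (Adds.s′ x) (Adds.s x) (Adds.s′ x))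
            (subst (λ v → Fits v (squares r) (set₂ t (Adds.s x) (Adds.s′ x) (Adds.s x) (Adds.s′ x))) (sym (Adds.added x))
              (Fits-remove f t-s₁ (Adds.s≢s′ x)))
            (rs (size-∁-added x)))
          (recompute (Vec.≡-dec _≟_ _ _) (addDomino-remove f t-s₁ (Adds.s≢s′ x)))
          where
          t-s₁ : lookup t (Adds.s x) ≡ Adds.s′ x
          t-s₁ = trans (cong (lookup t) (proj₁ (At-functional (Adds.at x) at)))
            (trans t-s (sym (proj₂ (At-functional (Adds.at x) at))))
      search : Dec (∃ λ s → ¬ (lookup t s ≡ s)) → Fill p r t
      search (no none) = done (recompute (Vec.≡-dec _≟ᵇ_ _ _) (no-domino fixed f))
        (vec-ext t id-pairing λ s → trans (fixed s) (sym (Vec.lookup-allFin s)))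
        where
        fixed : ∀ s → lookup t s ≡ s
        fixed s = decidable-stable (lookup t s ≟ s) (λ ne → none (s , ne))
      search (yes (s , ne)) = orient (Adjacent⇒At L s (lookup t s)
          (recompute (_ ℕ.≟ _) (Fits-adjacent f refl (ne ∘ sym))))
        where
        orient : (∃ λ e → At L e s (lookup t s) ⊎ At L e (lookup t s) s) → Fill p r t
        orient (e , inj₁ at) = remove at refl
        orient (e , inj₂ at) = remove at (recompute (_ ≟ _) (Fits.involutive f s))

  fill : ∀ p r t → .(Fits (squares p) (squares r) t) → Fill p r t
  fill p r t f = fillAcc p r t f (<-wellFounded _)

  lookup-add : ∀ {e p q} (x : Adds e p q) t → lookup (addDomino Rect (Adds.s x) (Adds.s′ x) t) (Adds.s x) ≡ Adds.s′ x
  lookup-add x t = lookup-set₂ t _ _ (Adds.s≢s′ x)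

  lookup-add′ : ∀ {e p q} (x : Adds e p q) t → lookup (addDomino Rect (Adds.s x) (Adds.s′ x) t) (Adds.s′ x) ≡ Adds.s x
  lookup-add′ x t = lookup-set₂′ t _ _

  record Front {p r t} (F : Fill p r t) {e s s′} (at : At L e s s′) : Set where
    constructor front
    field
      {q}  : Plug Rect
      {t′} : Pairing Rect
      x    : Adds e p q
      rest : Fill q r t′
      t≡   : t ≡ addDomino Rect s s′ t′
      Ω≈   : Ω F ≈ wt 0ℤ e (π p) ∙ Ω rest

  Ω-swap : ∀ {e f p q q′} (x : Adds e p q) (y : Adds f p q′) → Disj e f → ∀ w →
           wt 0ℤ e (π p) ∙ (wt 0ℤ f (π q) ∙ w) ≈ wt 0ℤ f (π p) ∙ (wt 0ℤ e (π q′) ∙ w)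
  Ω-swap {e} {f} {p} {q} {q′} x y d w = begin
    wt 0ℤ e (π p) ∙ (wt 0ℤ f (π q) ∙ w)   ≈⟨ assoc _ _ _ ⟨
    wt 0ℤ e (π p) ∙ wt 0ℤ f (π q) ∙ w     ≈⟨ ∙-congʳ swapped ⟩
    wt 0ℤ f (π p) ∙ wt 0ℤ e (π q′) ∙ w    ≈⟨ assoc _ _ _ ⟩
    wt 0ℤ f (π p) ∙ (wt 0ℤ e (π q′) ∙ w)  ∎
    where
    open W.≈-Reasoning
    mx = Adds⇒Move x
    my = Adds⇒Move y
    swapped : wt 0ℤ e (π p) ∙ wt 0ℤ f (π q) ≈ wt 0ℤ f (π p) ∙ wt 0ℤ e (π q′)
    swapped = subst₂ (λ s t → wt 0ℤ e (π p) ∙ wt 0ℤ f s ≈ wt 0ℤ f (π p) ∙ wt 0ℤ e t)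
      (sym (moved mx)) (sym (moved my)) (wt-swap e f (π p) (Valid-π p) d (active mx) (active my))

  -- The domino overtakes those added before it one at a time; each exchange swaps two disjoint
  -- hops, whose weights commute in `G⁺ L`.
  toFront : ∀ {p r t} (F : Fill p r t) {e s s′} (at : At L e s s′) → lookup t s ≡ s′ → Front F at
  toFront (done _ refl) {s = s} at eq =
    contradiction (trans (sym (Vec.lookup-allFin s)) eq) (At-distinct at)
  toFront {p} {r} {t} F₊@(more {e₀} {q = q₀} {t′ = t₀} x F refl) {e} {s} {s′} at t-s =
    go (position s₀ s₀′ s) refl
    where
    s₀ = Adds.s x
    s₀′ = Adds.s′ x
    open Fits (Fill⇒Fits F₊)
    t-s′ : lookup t s′ ≡ s
    t-s′ = trans (cong (lookup t) (sym t-s)) (involutive s)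

    same : s ≡ s₀ → Front F₊ at
    same refl = fromHop (At-injective at (subst (At L e₀ s₀) s₀′≡s′ (Adds.at x)))
      where
      s₀′≡s′ : s₀′ ≡ s′
      s₀′≡s′ = trans (sym (lookup-add x t₀)) t-s
      fromHop : e ≡ e₀ → Front F₊ at
      fromHop refl = front x F (cong (λ u → addDomino Rect s₀ u t₀) s₀′≡s′) ≈-refl

    -- Both dominoes list their squares in the order of `At`, so s cannot be the second square of
    -- the front domino.
    reversed : s ≢ s₀′
    reversed refl = At-oriented (subst (At L e s) (trans (sym t-s) (lookup-add′ x t₀)) at) (Adds.at x)

    apart : s ≢ s₀ → Front F₊ at
    apart s≢s₀ = swap (toFront F at t₀-s)
      where
      s≢s₀′ = reversed
      s′≢s₀ : s′ ≢ s₀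
      s′≢s₀ refl = s≢s₀′ (trans (sym t-s′) (lookup-add x t₀))
      s′≢s₀′ : s′ ≢ s₀′
      s′≢s₀′ refl = s≢s₀ (trans (sym t-s′) (lookup-add′ x t₀))
      t₀-s : lookup t₀ s ≡ s′
      t₀-s = trans (sym (lookup-set₂-≢ t₀ s₀′ s₀ s≢s₀ s≢s₀′)) t-s
      disj : Disj e e₀
      disj = Apart⇒Disj at (Adds.at x) (s≢s₀ , s≢s₀′ , s′≢s₀ , s′≢s₀′)
      swap : Front F at → Front F₊ at
      swap (front {q₁} {t₁} x₁ F₁ t₀≡ Ω≈) = swap′ (addAt p at (lower s≢s₀ s≢s₀′ free₁) (lower s′≢s₀ s′≢s₀′ free₁′))
        where
        free₁ : lookup (squares q₀) s ≡ false
        free₁ = proj₁ (Adds-at x₁ at)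
        free₁′ : lookup (squares q₀) s′ ≡ false
        free₁′ = proj₁ (proj₂ (Adds-at x₁ at))
        lower : ∀ {u} → u ≢ s₀ → u ≢ s₀′ → lookup (squares q₀) u ≡ false → lookup (squares p) u ≡ false
        lower {u} n n′ eq = trans (sym (lookup-set₂-≢ (squares p) true true n n′))
          (trans (cong (λ v → lookup v u) (sym (Adds.added x))) eq)
        swap′ : (∃ λ q → Adds e p q) → Front F₊ at
        swap′ (q , y) = front y (more z F₁ refl)
          (trans (cong (addDomino Rect s₀ s₀′) t₀≡)
                 (set₂-comm t₁ _ _ _ _ (s≢s₀ , s≢s₀′ , s′≢s₀ , s′≢s₀′)))
          (≈-trans (∙-congˡ Ω≈) (Ω-swap x y (Disj-sym e e₀ disj) (Ω F₁)))
          where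
          q≡ : squares q ≡ set₂ (squares p) s s′ true true
          q≡ = proj₂ (proj₂ (Adds-at y at))
          raise : ∀ {u} → u ≢ s → u ≢ s′ → lookup (squares p) u ≡ false → lookup (squares q) u ≡ false
          raise {u} n n′ eq = trans (cong (λ v → lookup v u) q≡)
            (trans (lookup-set₂-≢ (squares p) true true n n′) eq)
          z : Adds e₀ q q₁
          z = adds (Adds.at x) (raise (s≢s₀ ∘ sym) (s′≢s₀ ∘ sym) (Adds.free x))
            (raise (s≢s₀′ ∘ sym) (s′≢s₀′ ∘ sym) (Adds.free′ x))
            (trans (proj₂ (proj₂ (Adds-at x₁ at)))
              (trans (cong (λ v → set₂ v s s′ true true) (Adds.added x))
              (trans (sym (set₂-comm (squares p) true true true true (s≢s₀ , s≢s₀′ , s′≢s₀ , s′≢s₀′)))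
                     (cong (λ v → set₂ v s₀ s₀′ true true) (sym q≡)))))

    go : ∀ {u} → Position s₀ s₀′ u → u ≡ s → Front F₊ at
    go fst eq             = same (sym eq)
    go snd eq             = contradiction (sym eq) reversed
    go (other n _) refl   = apart n

  addDomino-injective : ∀ {s s′ t t′} → s ≢ s′ → lookup t s ≡ s → lookup t s′ ≡ s′ →
                        lookup t′ s ≡ s → lookup t′ s′ ≡ s′ →
                        addDomino Rect s s′ t ≡ addDomino Rect s s′ t′ → t ≡ t′
  addDomino-injective {s} {s′} {t} {t′} ne t-s t-s′ t′-s t′-s′ eq = vec-ext t t′ same
    where
    same : ∀ u → lookup t u ≡ lookup t′ u
    same u with position s s′ u
    ... | fst = trans t-s (sym t′-s)
    ... | snd = trans t-s′ (sym t′-s′)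
    ... | other n n′ = trans (sym (lookup-set₂-≢ t s′ s n n′))
      (trans (cong (λ v → lookup v u) eq) (lookup-set₂-≢ t′ s′ s n n′))

  Fill-fixed : ∀ {e p q r t} (x : Adds e p q) → Fill q r t →
               lookup t (Adds.s x) ≡ Adds.s x × lookup t (Adds.s′ x) ≡ Adds.s′ x
  Fill-fixed x F = Fits.avoids (Fill⇒Fits F) _ (inj₁ (Adds.added-s x)) ,
                   Fits.avoids (Fill⇒Fits F) _ (inj₁ (Adds.added-s′ x))

  -- The first domino of F is brought to the front of G, and induction treats the rest. This makes
  -- the weight of an edge well defined.
  Ω-unique : ∀ {p r t} (F G : Fill p r t) → Ω F ≈ Ω G
  Ω-unique (done _ refl) (done _ _)      = ≈-refl
  Ω-unique (done _ refl) (more {t′ = t′} x G eq) = contradiction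
    (trans (sym (Vec.lookup-allFin (Adds.s x))) (trans (cong (λ t → lookup t (Adds.s x)) eq) (lookup-add x t′)))
    (Adds.s≢s′ x)
  Ω-unique {p} {r} {t} (more {e} {q = q} {t′ = t′} x F refl) G = go (toFront G (Adds.at x) (lookup-add x t′))
    where
    go : Front G (Adds.at x) → wt 0ℤ e (π p) ∙ Ω F ≈ Ω G
    go (front {q₁} {t₁} x₁ G₁ t≡ Ω≈) = ≈-trans (∙-congˡ (matched q≡ t₁≡ G₁)) (≈-sym Ω≈)
      where
      q≡ : q ≡ q₁
      q≡ = plug-≡ (trans (Adds.added x) (sym (proj₂ (proj₂ (Adds-at x₁ (Adds.at x))))))
      t₁≡ : t′ ≡ t₁
      t₁≡ = let t′-s , t′-s′ = Fill-fixed x F ; t₁-s , t₁-s′ = Fill-fixed x (subst (λ q → Fill q r t₁) (sym q≡) G₁)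
            in addDomino-injective (Adds.s≢s′ x) t′-s t′-s′ t₁-s t₁-s′ t≡
      matched : ∀ {q₁ t₁} → q ≡ q₁ → t′ ≡ t₁ → (G₁ : Fill q₁ r t₁) → Ω F ≈ Ω G₁
      matched refl refl G₁ = Ω-unique F G₁

  co-Adds : ∀ {e p q} → Adds e p q → Adds e (co q) (co p)
  co-Adds {p = p} {q} (adds {s} {s′} at free free′ added) = adds at
    (trans (lookup-∁ (squares q) s) (cong not added-s)) (trans (lookup-∁ (squares q) s′) (cong not added-s′))
    (vec-ext _ _ λ u → sym (eq u))
    where
    open Adds (adds {p = p} {q} at free free′ added) using (s≢s′; added-s; added-s′)
    eq : ∀ u → lookup (set₂ (∁ (squares q)) s s′ true true) u ≡ lookup (∁ (squares p)) u
    eq u with position s s′ u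
    ... | fst = trans (lookup-set₂ (∁ (squares q)) true true s≢s′)
      (sym (trans (lookup-∁ (squares p) s) (cong not free)))
    ... | snd = trans (lookup-set₂′ (∁ (squares q)) true true)
      (sym (trans (lookup-∁ (squares p) s′) (cong not free′)))
    ... | other n n′ = trans (lookup-set₂-≢ (∁ (squares q)) true true n n′)
      (trans (lookup-∁ (squares q) u) (trans (cong not
        (trans (cong (λ v → lookup v u) added) (lookup-set₂-≢ (squares p) true true n n′)))
        (sym (lookup-∁ (squares p) u))))

  -- Taking a domino away from the far plug r lengthens the filling at its end, since it now has to
  -- go on from `co r` to `co r′`.
  Ω-snoc : ∀ {e p r r′ t} (x : Adds e r′ r) (F : Fill p r t) →
           Σ (Fill p r′ (addDomino Rect (Adds.s x) (Adds.s′ x) t)) λ F′ →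
           Ω F′ ≈ Ω F ∙ wt 0ℤ e (π (co r))
  Ω-snoc {e} {p} {r} {r′} x (done eq refl) = close (plug-≡ (∁-swap eq))
    where
    close : p ≡ co r → Σ (Fill p r′ (addDomino Rect (Adds.s x) (Adds.s′ x) id-pairing)) λ F′ →
            Ω F′ ≈ one ∙ wt 0ℤ e (π (co r))
    close refl = more (co-Adds x) (done (sym (∁-involutive (squares r′))) refl) refl ,
      ≈-trans (identityʳ _) (≈-sym (identityˡ _))
  Ω-snoc {e} {p} {r} {r′} x (more {e₀} {q = q} {t′ = t′} y F refl) = go (Ω-snoc x F)
    where
    open Fits (Fill⇒Fits F) using (disjoint)
    ne : ∀ {u u′} → lookup (squares q) u ≡ true → lookup (squares r) u′ ≡ true → u ≢ u′
    ne q-u r-u refl = disjoint _ q-u r-u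
    apart : Apart (Adds.s y) (Adds.s′ y) (Adds.s x) (Adds.s′ x)
    apart = ne (Adds.added-s y) (Adds.added-s x) , ne (Adds.added-s y) (Adds.added-s′ x) ,
            ne (Adds.added-s′ y) (Adds.added-s x) , ne (Adds.added-s′ y) (Adds.added-s′ x)
    go : Σ (Fill q r′ (addDomino Rect (Adds.s x) (Adds.s′ x) t′)) (λ F′ → Ω F′ ≈ Ω F ∙ wt 0ℤ e (π (co r))) →
         Σ (Fill p r′ _) λ F′ → Ω F′ ≈ wt 0ℤ e₀ (π p) ∙ Ω F ∙ wt 0ℤ e (π (co r))
    go (F′ , Ω≈) = more y F′ (set₂-comm t′ _ _ _ _ apart) , ≈-trans (∙-congˡ Ω≈) (≈-sym (assoc _ _ _))

-- Invariance of the weights under the 2-cells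

data Blk : (Bool → Hop) → (Bool → Hop) → Set where
  here  : Blk hor side
  there : ∀ {h v} → Blk h v → Blk (λ j → there (h j)) (λ i → there (v i))

record Corners (n : ℕ) (s₀₀ s₁₀ s₀₁ s₁₁ : Fin (n ℕ.* 2)) : Set where
  constructor mkCorners
  field
    {h v} : Bool → Hop
    blk : Blk h v
    h₀ : At n (h false) s₀₀ s₁₀
    h₁ : At n (h true) s₀₁ s₁₁
    v₀ : At n (v false) s₀₀ s₀₁
    v₁ : At n (v true) s₁₀ s₁₁
    apart : Apart s₀₀ s₁₀ s₀₁ s₁₁

left-of : ℤ × ℤ → ℤ × ℤ
left-of (x , y) = x +ᶻ -1ℤ , y

-- A flip is given by coordinates; this finds the hops around its block. Stripping off the first
-- column shifts all corners by one.
corners⇒Blk : ∀ n s₀₀ s₁₀ s₀₁ s₁₁ →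
  let (x , y) = sq-corner n s₀₀ in
  sq-corner n s₁₀ ≡ (x +ᶻ 1ℤ , y) → sq-corner n s₀₁ ≡ (x , y +ᶻ 1ℤ) →
  sq-corner n s₁₁ ≡ (x +ᶻ 1ℤ , y +ᶻ 1ℤ) → Corners n s₀₀ s₁₀ s₀₁ s₁₁
corners⇒Blk (suc (suc n)) zero (suc (suc zero)) (suc zero) (suc (suc (suc zero))) _ _ _ =
  mkCorners here hor₀ hor₁ vert (there vert) ((λ ()) , (λ ()) , (λ ()) , (λ ()))
corners⇒Blk (suc n) zero zero _ _ () _ _
corners⇒Blk (suc n) zero (suc zero) _ _ () _ _
corners⇒Blk (suc (suc n)) zero (suc (suc (suc zero))) _ _ () _ _
corners⇒Blk (suc (suc n)) zero (suc (suc (suc (suc s)))) _ _ () _ _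
corners⇒Blk (suc n) zero _ zero _ _ () _
corners⇒Blk (suc n) zero _ (suc (suc s)) _ _ () _
corners⇒Blk (suc n) zero _ _ zero _ _ ()
corners⇒Blk (suc n) zero _ _ (suc zero) _ _ ()
corners⇒Blk (suc (suc n)) zero _ _ (suc (suc zero)) _ _ ()
corners⇒Blk (suc (suc n)) zero _ _ (suc (suc (suc (suc s)))) _ _ ()
corners⇒Blk (suc n) (suc zero) _ zero _ _ () _
corners⇒Blk (suc n) (suc zero) _ (suc zero) _ _ () _
corners⇒Blk (suc n) (suc zero) _ (suc (suc s)) _ _ () _
corners⇒Blk (suc n) (suc (suc _)) zero _ _ () _ _
corners⇒Blk (suc n) (suc (suc _)) (suc zero) _ _ () _ _
corners⇒Blk (suc n) (suc (suc _)) _ zero _ _ () _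
corners⇒Blk (suc n) (suc (suc _)) _ (suc zero) _ _ () _
corners⇒Blk (suc n) (suc (suc _)) _ _ zero _ _ ()
corners⇒Blk (suc n) (suc (suc _)) _ _ (suc zero) _ _ ()
corners⇒Blk (suc n) (suc (suc s₀₀)) (suc (suc s₁₀)) (suc (suc s₀₁)) (suc (suc s₁₁)) eq₁₀ eq₀₁ eq₁₁ =
  up (corners⇒Blk n s₀₀ s₁₀ s₀₁ s₁₁ (cong left-of eq₁₀) (cong left-of eq₀₁) (cong left-of eq₁₁))
  where
  up : Corners n s₀₀ s₁₀ s₀₁ s₁₁ → Corners (suc n) (suc² s₀₀) (suc² s₁₀) (suc² s₀₁) (suc² s₁₁)
  suc²-≢ : ∀ {s s′ : Fin (n ℕ.* 2)} → s ≢ s′ → suc² s ≢ suc² s′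
  suc²-≢ ne eq = ne (suc-injective (suc-injective eq))
  up (mkCorners b h₀ h₁ v₀ v₁ (x , y , z , w)) =
    mkCorners (there b) (there h₀) (there h₁) (there v₀) (there v₁) (suc²-≢ x , suc²-≢ y , suc²-≢ z , suc²-≢ w)

module Homomorphism (L : ℕ) (3≤L : 3 ≤ L) where

  open Filling L 3≤L public
  open import Algebra.Properties.Group (G⁺ L) using (ε⁻¹≈ε; ⁻¹-involutive; ⁻¹-anti-homo-∙; \\-leftDividesˡ; \\-leftDividesʳ)
  open W.≈-Reasoning

  wt-Blk-h : ∀ {h v} → Blk h v → ∀ j k s → wt k (h j) s ≡ one
  wt-Blk-h here      j k s       = refl
  wt-Blk-h (there b) j k []      = refl
  wt-Blk-h (there b) j k (c ∷ s) = wt-Blk-h b j (k +ᶻ exc c) s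

  -- The two active hops share a corner, which forces the vertical hops of the block to go in
  -- opposite directions. The first column is single, so they are at the same height and their
  -- weights cancel.
  wt-Blk-v : ∀ {h v} → Blk h v → ∀ k s → Active (v false) s → Active (h false) s →
             wt k (v false) s ∙ wt k (v true) (toggle (v false) s) ≈ one
  wt-Blk-v here k (U ∷ (false , y) ∷ s) _ _ =
    ≈-trans (∙-congˡ (⁻¹-cong (≡⇒≈ (cong α (ℤ.+-identityʳ k))))) (inverseʳ (α k))
  wt-Blk-v here k (D ∷ (true , y) ∷ s) _ _ =
    ≈-trans (∙-congˡ (≡⇒≈ (cong α (ℤ.+-identityʳ k)))) (inverseˡ (α k))
  wt-Blk-v (there b) k (c ∷ s) act act′ = wt-Blk-v b (k +ᶻ exc c) s act act′

  -- Once the dominoes of the block are at the front, the horizontal ones weigh 1 and the vertical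
  -- ones cancel; from there on both fillings have the same plug and the same pairing.
  Ω-flip : ∀ {p r t t′} (F : Fill p r t) (G : Fill p r t′) → Flip Rect t t′ → Ω F ≈ Ω G
  Ω-flip {p} {r} {t} {t′} F G fl =
    go (corners⇒Blk L s₀₀ s₁₀ s₀₁ s₁₁ corner₁₀ corner₀₁ corner₁₁)
    where
    open Flip fl
    go : Corners L s₀₀ s₁₀ s₀₁ s₁₁ → Ω F ≈ Ω G
    go (mkCorners {h} {v} b at-h₀ at-h₁ at-v₀ at-v₁ (n₀₀₀₁ , n₀₀₁₁ , n₁₀₀₁ , n₁₀₁₁)) =
      go₁ (toFront F at-h₀ h-bottom) (toFront G at-v₀ v-left)
      where
      n₀₀₁₀ : s₀₀ ≢ s₁₀
      n₀₀₁₀ = At-distinct at-h₀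
      n₀₁₁₁ : s₀₁ ≢ s₁₁
      n₀₁₁₁ = At-distinct at-h₁
      go₁ : Front F at-h₀ → Front G at-v₀ → Ω F ≈ Ω G
      go₁ (front {q} {t₁} x F₁ t≡ Ω≈) (front {q′} {t₁′} x′ G₁ t′≡ Ω≈′) =
        go₂ (toFront F₁ at-h₁ (trans (sym (lookup-set₂-≢ t₁ _ _ (n₀₀₀₁ ∘ sym) (n₁₀₀₁ ∘ sym)))
                                     (trans (cong (λ t → lookup t s₀₁) (sym t≡)) h-top)))
            (toFront G₁ at-v₁ (trans (sym (lookup-set₂-≢ t₁′ _ _ (n₀₀₁₀ ∘ sym) n₁₀₀₁))
                                     (trans (cong (λ t → lookup t s₁₀) (sym t′≡)) v-right)))
        where
        go₂ : Front F₁ at-h₁ → Front G₁ at-v₁ → Ω F ≈ Ω G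
        go₂ (front {q₂} {t₂} y F₂ t₁≡ Ω≈₂) (front {q₂′} {t₂′} y′ G₂ t₁′≡ Ω≈₂′) = begin
          Ω F                                                ≈⟨ Ω≈ ⟩
          wt 0ℤ (h false) (π p) ∙ Ω F₁                       ≈⟨ ∙-congˡ Ω≈₂ ⟩
          wt 0ℤ (h false) (π p) ∙ (wt 0ℤ (h true) (π q) ∙ Ω F₂)
            ≈⟨ ∙-cong (≡⇒≈ (wt-Blk-h b false 0ℤ (π p))) (∙-congʳ (≡⇒≈ (wt-Blk-h b true 0ℤ (π q)))) ⟩
          one ∙ (one ∙ Ω F₂)                                 ≈⟨ identityˡ _ ⟩
          one ∙ Ω F₂                                         ≈⟨ ∙-congˡ (matched q₂≡ t₂≡ G₂) ⟩
          one ∙ Ω G₂                                         ≈⟨ ∙-congʳ verticals ⟨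
          wt 0ℤ (v false) (π p) ∙ wt 0ℤ (v true) (π q′) ∙ Ω G₂    ≈⟨ assoc _ _ _ ⟩
          wt 0ℤ (v false) (π p) ∙ (wt 0ℤ (v true) (π q′) ∙ Ω G₂)  ≈⟨ ∙-congˡ Ω≈₂′ ⟨
          wt 0ℤ (v false) (π p) ∙ Ω G₁                       ≈⟨ Ω≈′ ⟨
          Ω G                                                ∎
          where
          mx′ = Adds⇒Move x′
          verticals : wt 0ℤ (v false) (π p) ∙ wt 0ℤ (v true) (π q′) ≈ one
          verticals = subst (λ s → wt 0ℤ (v false) (π p) ∙ wt 0ℤ (v true) s ≈ one) (sym (moved mx′))
            (wt-Blk-v b 0ℤ (π p) (active mx′) (active (Adds⇒Move x)))
          added : ∀ {e p q s s′} → Adds e p q → At L e s s′ → squares q ≡ set₂ (squares p) s s′ true true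
          added x at = proj₂ (proj₂ (Adds-at x at))
          squares-q₂ : squares q₂ ≡ set₂ (set₂ (squares p) s₀₀ s₁₀ true true) s₀₁ s₁₁ true true
          squares-q₂ = trans (added y at-h₁) (cong (λ v → set₂ v s₀₁ s₁₁ true true) (added x at-h₀))
          q₂≡ : q₂ ≡ q₂′
          q₂≡ = plug-≡ (trans squares-q₂ (trans
            (cong (_[ s₁₁ ]≔ true) (Vec.[]≔-commutes (squares p [ s₀₀ ]≔ true) s₁₀ s₀₁ n₁₀₀₁))
            (sym (trans (added y′ at-v₁) (cong (λ v → set₂ v s₁₀ s₁₁ true true) (added x′ at-v₀))))))
          lookup-q₂ : ∀ u → Position s₀₀ s₁₀ u → Position s₀₁ s₁₁ u → lookup (squares q₂) u ≡ true ⊎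
                      (u ≢ s₀₀ × u ≢ s₁₀ × u ≢ s₀₁ × u ≢ s₁₁)
          lookup-q₂ u _ fst = inj₁ (trans (cong (λ v → lookup v u) squares-q₂) (lookup-set₂ (set₂ (squares p) s₀₀ s₁₀ true true) true true n₀₁₁₁))
          lookup-q₂ u _ snd = inj₁ (trans (cong (λ v → lookup v u) squares-q₂)
            (lookup-set₂′ (set₂ (squares p) s₀₀ s₁₀ true true) true true))
          lookup-q₂ u fst (other n n′) = inj₁ (trans (cong (λ v → lookup v u) squares-q₂)
            (trans (lookup-set₂-≢ (set₂ (squares p) s₀₀ s₁₀ true true) true true n n′)
                   (lookup-set₂ (squares p) true true n₀₀₁₀)))
          lookup-q₂ u snd (other n n′) = inj₁ (trans (cong (λ v → lookup v u) squares-q₂)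
            (trans (lookup-set₂-≢ (set₂ (squares p) s₀₀ s₁₀ true true) true true n n′)
                   (lookup-set₂′ (squares p) true true)))
          lookup-q₂ u (other n n′) (other m m′) = inj₂ (n , n′ , m , m′)
          t₂-u : ∀ u → lookup (squares q₂) u ≡ true ⊎ (u ≢ s₀₀ × u ≢ s₁₀ × u ≢ s₀₁ × u ≢ s₁₁) →
                 lookup t₂ u ≡ lookup t₂′ u
          t₂-u u (inj₁ q₂-u) = trans (Fits.avoids (Fill⇒Fits F₂) u (inj₁ q₂-u))
            (sym (Fits.avoids (Fill⇒Fits G₂) u (inj₁ (subst (λ q → lookup (squares q) u ≡ true) q₂≡ q₂-u))))
          t₂-u u (inj₂ (n₀₀ , n₁₀ , n₀₁ , n₁₁)) = trans (sym t-u) (trans (agree u n₀₀ n₁₀ n₀₁ n₁₁) t′-u)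
            where
            t-u : lookup t u ≡ lookup t₂ u
            t-u = trans (cong (λ t → lookup t u) t≡) (trans (lookup-set₂-≢ t₁ s₁₀ s₀₀ n₀₀ n₁₀)
              (trans (cong (λ t → lookup t u) t₁≡) (lookup-set₂-≢ t₂ s₁₁ s₀₁ n₀₁ n₁₁)))
            t′-u : lookup t′ u ≡ lookup t₂′ u
            t′-u = trans (cong (λ t → lookup t u) t′≡) (trans (lookup-set₂-≢ t₁′ s₀₁ s₀₀ n₀₀ n₀₁)
              (trans (cong (λ t → lookup t u) t₁′≡) (lookup-set₂-≢ t₂′ s₁₁ s₁₀ n₁₀ n₁₁)))
          t₂≡ : t₂ ≡ t₂′
          t₂≡ = vec-ext t₂ t₂′ (λ u → t₂-u u (lookup-q₂ u (position s₀₀ s₁₀ u) (position s₀₁ s₁₁ u)))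
          matched : ∀ {q₂′ t₂′} → q₂ ≡ q₂′ → t₂ ≡ t₂′ → (G₂ : Fill q₂′ r t₂′) → Ω F₂ ≈ Ω G₂
          matched refl refl G₂ = Ω-unique F₂ G₂

  loop-Fits : ∀ {t} → IsTiling Rect Subset.⊤ t → Fits (squares base) (squares base) t
  loop-Fits isT = record
    { involutive = involutive ; covers = λ s _ _ → covers Subset.∈⊤
    ; avoids = λ s → [ (λ eq → contradiction eq (false≢true (Vec.lookup-replicate s false)))
                     , (λ eq → contradiction eq (false≢true (Vec.lookup-replicate s false))) ]′
    ; disjoint = λ s eq → contradiction eq (false≢true (Vec.lookup-replicate s false)) }
    where open IsTiling isT

  edgeFill : ∀ {p q} (e : Edge Rect p q) → Fill p q (edgePairing Rect e)
  edgeFill {p} {q} (edge _ disj (tiling t isT)) = fill p q t (⇒Fits isT disj)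
  edgeFill (loop _ (tiling t isT)) = fill base base t (loop-Fits isT)

  -- The flag is the parity of the vertex at which the edge starts.
  weight : Bool → ∀ {p q} → Edge Rect p q → Word (Symbol L)
  weight false e = Ω (edgeFill e)
  weight true  e = Ω (edgeFill (revEdge Rect e)) ⁻¹

  Φ : Bool → ∀ {p q} → Path K p q → Word (Symbol L)
  Φ b ε       = one
  Φ b (e ◅ γ) = weight b e ∙ Φ (not b) γ

  end : Bool → ∀ {p q} → Path K p q → Bool
  end b ε       = b
  end b (e ◅ γ) = end (not b) γ

  end-◅◅ : ∀ b {p q r} (γ : Path K p q) (δ : Path K q r) → end b (γ ◅◅ δ) ≡ end (end b γ) δ
  end-◅◅ b ε       δ = refl
  end-◅◅ b (e ◅ γ) δ = end-◅◅ (not b) γ δ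

  Φ-◅◅ : ∀ b {p q r} (γ : Path K p q) (δ : Path K q r) → Φ b (γ ◅◅ δ) ≈ Φ b γ ∙ Φ (end b γ) δ
  Φ-◅◅ b ε       δ = ≈-sym (identityˡ _)
  Φ-◅◅ b (e ◅ γ) δ = ≈-trans (∙-congˡ (Φ-◅◅ (not b) γ δ)) (≈-sym (assoc _ _ _))

  Ω-pairing : ∀ {p q t t′} (F : Fill p q t) (G : Fill p q t′) → t ≡ t′ → Ω F ≈ Ω G
  Ω-pairing F G refl = Ω-unique F G

  weight-rev : ∀ b {p q} (e : Edge Rect p q) → weight b e ∙ (weight (not b) (revEdge Rect e) ∙ one) ≈ one
  weight-rev false e = begin
    Ω (edgeFill e) ∙ (Ω (edgeFill (revEdge Rect (revEdge Rect e))) ⁻¹ ∙ one)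
      ≡⟨ cong (λ e′ → Ω (edgeFill e) ∙ (Ω (edgeFill e′) ⁻¹ ∙ one)) (revEdge-involutive Rect e) ⟩
    Ω (edgeFill e) ∙ (Ω (edgeFill e) ⁻¹ ∙ one)   ≈⟨ ∙-congˡ (identityʳ _) ⟩
    Ω (edgeFill e) ∙ Ω (edgeFill e) ⁻¹           ≈⟨ inverseʳ _ ⟩
    one                                          ∎
  weight-rev true e = ≈-trans (∙-congˡ (identityʳ _)) (inverseˡ _)

  record QuadAdds {p q : Plug Rect} (s s′ : Fin N) : Set where
    constructor quadAdds
    field
      {e} : Hop
      x   : Adds e p q
      addDomino≡ : ∀ t → addDomino Rect s s′ t ≡ addDomino Rect (Adds.s x) (Adds.s′ x) t

  toQuadAdds : ∀ {p q s s′} → Adjacent Rect s s′ → s ∉ squares p → s′ ∉ squares p →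
               squares q ≡ squares p ∪ (⁅ s ⁆ ∪ ⁅ s′ ⁆) → QuadAdds {p} {q} s s′
  toQuadAdds {p} {q} {s} {s′} adj s∉ s′∉ eq = go (Adjacent⇒At L s s′ adj)
    where
    added : squares q ≡ set₂ (squares p) s s′ true true
    added = trans eq (∪-⁅⁆∪⁅⁆ (squares p) s s′)
    go : (∃ λ e → At L e s s′ ⊎ At L e s′ s) → QuadAdds {p} {q} s s′
    go (e , inj₁ at) = quadAdds (adds at (∉⇒false (squares p) s∉) (∉⇒false (squares p) s′∉) added) λ t → refl
    go (e , inj₂ at) = quadAdds (adds at (∉⇒false (squares p) s′∉) (∉⇒false (squares p) s∉)
      (trans added (Vec.[]≔-commutes (squares p) s s′ (At-distinct at ∘ sym))))
      λ t → Vec.[]≔-commutes t s s′ (At-distinct at ∘ sym)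

  -- If the cell is entered at an even vertex, the fillings run towards p₂ and p₃ and the extra
  -- domino comes last; otherwise they start at p₂ and p₃ and it comes first. Either way its weight
  -- w occurs twice, once inverted.
  weight-quad : ∀ b {p₁ p₂ p₃ p₄ s s′} → QuadAdds {p₃} {p₂} s s′ →
    (e₁₂ : Edge Rect p₁ p₂) (e₂₄ : Edge Rect p₂ p₄) (e₄₃ : Edge Rect p₄ p₃) (e₃₁ : Edge Rect p₃ p₁) →
    edgePairing Rect e₄₃ ≡ addDomino Rect s s′ (edgePairing Rect e₂₄) →
    edgePairing Rect e₃₁ ≡ addDomino Rect s s′ (edgePairing Rect e₁₂) →
    Φ b (e₁₂ ◅ e₂₄ ◅ e₄₃ ◅ e₃₁ ◅ ε) ≈ one
  weight-quad false {p₂ = p₂} (quadAdds {e} x addDomino≡) e₁₂ e₂₄ e₄₃ e₃₁ eq₄₃ eq₃₁ = begin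
    A ∙ (B ⁻¹ ∙ (Ω (edgeFill e₄₃) ∙ (Ω (edgeFill (revEdge Rect e₃₁)) ⁻¹ ∙ one)))
      ≈⟨ ∙-congˡ (∙-congˡ (∙-cong B′ (≈-trans (identityʳ _) (⁻¹-cong A′)))) ⟩
    A ∙ (B ⁻¹ ∙ (B ∙ w ∙ (A ∙ w) ⁻¹))       ≈⟨ ∙-congˡ (∙-congˡ (assoc B w _)) ⟩
    A ∙ (B ⁻¹ ∙ (B ∙ (w ∙ (A ∙ w) ⁻¹)))     ≈⟨ ∙-congˡ (\\-leftDividesʳ B _) ⟩
    A ∙ (w ∙ (A ∙ w) ⁻¹)                    ≈⟨ assoc A w _ ⟨
    A ∙ w ∙ (A ∙ w) ⁻¹                      ≈⟨ inverseʳ _ ⟩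
    one                                     ∎
    where
    w = wt 0ℤ e (π (co p₂))
    A = Ω (edgeFill e₁₂)
    B = Ω (edgeFill (revEdge Rect e₂₄))
    B′ : Ω (edgeFill e₄₃) ≈ B ∙ w
    B′ = let F , Ω≈ = Ω-snoc x (edgeFill (revEdge Rect e₂₄))
         in ≈-trans (Ω-pairing (edgeFill e₄₃) F (trans eq₄₃ (trans (addDomino≡ _)
              (cong (addDomino Rect (Adds.s x) (Adds.s′ x)) (sym (edgePairing-rev e₂₄)))))) Ω≈
    A′ : Ω (edgeFill (revEdge Rect e₃₁)) ≈ A ∙ w
    A′ = let F , Ω≈ = Ω-snoc x (edgeFill e₁₂)
         in ≈-trans (Ω-pairing (edgeFill (revEdge Rect e₃₁)) F
              (trans (edgePairing-rev e₃₁) (trans eq₃₁ (addDomino≡ _)))) Ω≈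
  weight-quad true {p₃ = p₃} (quadAdds {e} x addDomino≡) e₁₂ e₂₄ e₄₃ e₃₁ eq₄₃ eq₃₁ = begin
    A ⁻¹ ∙ (B ∙ (Ω (edgeFill (revEdge Rect e₄₃)) ⁻¹ ∙ (Ω (edgeFill e₃₁) ∙ one)))
      ≈⟨ ∙-congˡ (∙-congˡ (∙-cong (⁻¹-cong B′) (≈-trans (identityʳ _) A′))) ⟩
    A ⁻¹ ∙ (B ∙ ((w ∙ B) ⁻¹ ∙ (w ∙ A)))     ≈⟨ ∙-congˡ (∙-congˡ (∙-congʳ (⁻¹-anti-homo-∙ w B))) ⟩
    A ⁻¹ ∙ (B ∙ (B ⁻¹ ∙ w ⁻¹ ∙ (w ∙ A)))    ≈⟨ ∙-congˡ (∙-congˡ (assoc (B ⁻¹) (w ⁻¹) _)) ⟩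
    A ⁻¹ ∙ (B ∙ (B ⁻¹ ∙ (w ⁻¹ ∙ (w ∙ A))))  ≈⟨ ∙-congˡ (\\-leftDividesˡ B _) ⟩
    A ⁻¹ ∙ (w ⁻¹ ∙ (w ∙ A))                 ≈⟨ ∙-congˡ (\\-leftDividesʳ w A) ⟩
    A ⁻¹ ∙ A                                ≈⟨ inverseˡ A ⟩
    one                                     ∎
    where
    w = wt 0ℤ e (π p₃)
    A = Ω (edgeFill (revEdge Rect e₁₂))
    B = Ω (edgeFill e₂₄)
    B′ : Ω (edgeFill (revEdge Rect e₄₃)) ≈ w ∙ B
    B′ = Ω-pairing (edgeFill (revEdge Rect e₄₃)) (more x (edgeFill e₂₄) refl)
      (trans (edgePairing-rev e₄₃) (trans eq₄₃ (addDomino≡ _)))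
    A′ : Ω (edgeFill e₃₁) ≈ w ∙ A
    A′ = Ω-pairing (edgeFill e₃₁) (more x (edgeFill (revEdge Rect e₁₂)) refl)
      (trans eq₃₁ (trans (addDomino≡ _)
        (cong (addDomino Rect (Adds.s x) (Adds.s′ x)) (sym (edgePairing-rev e₁₂)))))

  end-Cell : ∀ b {p} {γ : Path K p p} → Cell Rect γ → end b γ ≡ b
  end-Cell b (loop² _)                  = not-involutive b
  end-Cell b (bigon _ _ _ _)            = not-involutive b
  end-Cell b (quad _ _ _ _ _ _ _ _ _ _) = trans (not-involutive (not (not b))) (not-involutive b)

  Φ-Cell : ∀ b {p} {γ : Path K p p} → Cell Rect γ → Φ b γ ≈ one
  -- Both orientations of a loop carry the same tiling, so the second, odd passage has the inverse
  -- weight of the first.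
  Φ-Cell false (loop² t) = ≈-trans (∙-congˡ (identityʳ _)) (≈-trans
    (∙-congˡ (⁻¹-cong (Ω-pairing (edgeFill (loop s- t)) (edgeFill (loop s+ t)) refl))) (inverseʳ _))
  Φ-Cell true  (loop² t) = ≈-trans (∙-congˡ (identityʳ _)) (≈-trans
    (∙-congˡ (Ω-pairing (edgeFill (loop s+ t)) (edgeFill (loop s- t)) refl)) (inverseˡ _))
  Φ-Cell false (bigon _ e e′ fl) = ≈-trans (∙-congʳ (Ω-flip (edgeFill e) (edgeFill e′) fl)) (weight-rev false e′)
  Φ-Cell true  (bigon _ e e′ fl) = ≈-trans
    (∙-congʳ (⁻¹-cong (Ω-flip (edgeFill (revEdge Rect e)) (edgeFill (revEdge Rect e′))
      (subst₂ (Flip Rect) (sym (edgePairing-rev e)) (sym (edgePairing-rev e′)) fl)))) (weight-rev true e′)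
  Φ-Cell b (quad adj s∉ s′∉ eq e₁₂ e₂₄ e₄₃ e₃₁ eq₄₃ eq₃₁) =
    weight-quad b (toQuadAdds adj s∉ s′∉ eq) e₁₂ e₂₄ e₄₃ e₃₁ eq₄₃ eq₃₁

  end-cong : ∀ b {p q} {γ δ : Path K p q} → γ ~ δ → end b γ ≡ end b δ
  end-cong b (backtrack e)   = not-involutive b
  end-cong b (cell c)        = end-Cell b c
  end-cong b ≃-refl          = refl
  end-cong b (≃-sym h)       = sym (end-cong b h)
  end-cong b (≃-trans h k)   = trans (end-cong b h) (end-cong b k)
  end-cong b (◅◅-cong {p = γ} {γ′} {δ} {δ′} h k) = trans (end-◅◅ b γ δ)
    (trans (cong (λ c → end c δ) (end-cong b h)) (trans (end-cong (end b γ′) k) (sym (end-◅◅ b γ′ δ′))))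

  Φ-cong : ∀ b {p q} {γ δ : Path K p q} → γ ~ δ → Φ b γ ≈ Φ b δ
  Φ-cong b (backtrack e)   = weight-rev b e
  Φ-cong b (cell c)        = Φ-Cell b c
  Φ-cong b ≃-refl          = ≈-refl
  Φ-cong b (≃-sym h)       = ≈-sym (Φ-cong b h)
  Φ-cong b (≃-trans h k)   = ≈-trans (Φ-cong b h) (Φ-cong b k)
  Φ-cong b (◅◅-cong {p = γ} {γ′} {δ} {δ′} h k) = begin
    Φ b (γ ◅◅ δ)               ≈⟨ Φ-◅◅ b γ δ ⟩
    Φ b γ ∙ Φ (end b γ) δ      ≡⟨ cong (λ c → Φ b γ ∙ Φ c δ) (end-cong b h) ⟩
    Φ b γ ∙ Φ (end b γ′) δ     ≈⟨ ∙-cong (Φ-cong b h) (Φ-cong (end b γ′) k) ⟩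
    Φ b γ′ ∙ Φ (end b γ′) δ′   ≈⟨ Φ-◅◅ b γ′ δ′ ⟨
    Φ b (γ′ ◅◅ δ′)             ∎

-- Φ and Ψ are inverse to each other

module Isomorphism (L : ℕ) (3≤L : 3 ≤ L) where

  open Homomorphism L 3≤L

  full-unique : ∀ {p r} (e : Edge Rect p r) (eq : squares r ≡ ∁ (squares p)) →
                edgePairing Rect e ≡ id-pairing → e ≡ full eq
  full-unique (edge _ _ (tiling _ _)) eq refl = refl
  full-unique (loop _ t)              eq _    =
    contradiction (cong (λ v → lookup v s) eq) (λ eq′ → false≢true (Vec.lookup-replicate s false)
      (trans eq′ (trans (lookup-∁ Subset.⊥ s) (cong not (Vec.lookup-replicate s false)))))
    where
    s : Fin N
    s = fromℕ< {0} (ℕ.≤-trans (s≤s z≤n) 6≤N)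

  back : ∀ p → Path K (co p) p
  back p = full (sym (∁-involutive (squares p))) ◅ ε

  -- The dominoes of the edge are peeled off one by one, each contributing its weight by `T-move`,
  -- until the edge into r without dominoes is left.
  floor : ∀ {p r t} (F : Fill p r t) (e : Edge Rect p r) → edgePairing Rect e ≡ t →
          T p ◅◅ e ◅ ε ~ Ψ (Ω F) ◅◅ T (co r) ◅◅ back r
  floor {p} {r} (done eq refl) e pairing≡ = go (plug-≡ (∁-swap eq)) e pairing≡
    where
    go : ∀ {p} → p ≡ co r → (e : Edge Rect p r) → edgePairing Rect e ≡ id-pairing →
         T p ◅◅ e ◅ ε ~ T (co r) ◅◅ back r
    go refl e pairing≡ = ≡⇒~ (cong (λ e → T (co r) ◅◅ e ◅ ε)
      (full-unique e (sym (∁-involutive (squares r))) pairing≡))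
  floor {p} {r} (more {e′} {q = q} {t′ = t′} x F refl) e pairing≡ = begin
    T p ◅◅ e ◅ ε                        ≈⟨ ◅◅-congˡ (T p) (peel x e ψ pairing≡) ⟩
    T p ◅◅ add x ◅◅ ψ ◅ ε               ≡⟨ ◅◅-assoc (T p) (add x) (ψ ◅ ε) ⟨
    (T p ◅◅ add x) ◅◅ ψ ◅ ε             ≈⟨ ◅◅-congʳ (ψ ◅ ε) T-add ⟩
    (Ψ w ◅◅ T q) ◅◅ ψ ◅ ε               ≡⟨ ◅◅-assoc (Ψ w) (T q) (ψ ◅ ε) ⟩
    Ψ w ◅◅ T q ◅◅ ψ ◅ ε                 ≈⟨ ◅◅-congˡ (Ψ w) (floor F ψ refl) ⟩
    Ψ w ◅◅ Ψ (Ω F) ◅◅ T (co r) ◅◅ back r   ≡⟨ ◅◅-assoc (Ψ w) (Ψ (Ω F)) (T (co r) ◅◅ back r) ⟨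
    (Ψ w ◅◅ Ψ (Ω F)) ◅◅ T (co r) ◅◅ back r ∎
    where
    open ~-Reasoning
    w = wt 0ℤ e′ (π p)
    m = Adds⇒Move x
    T-add : T p ◅◅ add x ~ Ψ w ◅◅ T q
    T-add = ≃-trans (≡⇒~ (cong (T p ◅◅_) (sym (mv≡mvD false m (Adds.at x) (Adds.free x) x)))) (T-move m)
    ψ : Edge Rect q r
    ψ = mkEdge t′ (λ { refl → Fits.disjoint (Fill⇒Fits F) _ (Adds.added-s x) (Adds.added-s x) }) (Fill⇒Fits F)

  -- The canonical path with label w from `base` to the vertex of parity b over p in the double
  -- cover; an odd vertex is reached through the even vertex over `co p`.
  S : Bool → Word (Symbol L) → ∀ p → Path K base p
  S false w p = Ψ w ◅◅ T p
  S true  w p = Ψ w ◅◅ T (co p) ◅◅ back p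

  S-edge : ∀ b w {p q} (e : Edge Rect p q) → S b w p ◅◅ e ◅ ε ~ S (not b) (w ∙ weight b e) q
  S-edge false w {p} {q} e = begin
    (Ψ w ◅◅ T p) ◅◅ e ◅ ε                       ≡⟨ ◅◅-assoc (Ψ w) (T p) (e ◅ ε) ⟩
    Ψ w ◅◅ T p ◅◅ e ◅ ε                         ≈⟨ ◅◅-congˡ (Ψ w) (floor (edgeFill e) e refl) ⟩
    Ψ w ◅◅ Ψ (weight false e) ◅◅ T (co q) ◅◅ back q
      ≡⟨ ◅◅-assoc (Ψ w) (Ψ (weight false e)) (T (co q) ◅◅ back q) ⟨
    (Ψ w ◅◅ Ψ (weight false e)) ◅◅ T (co q) ◅◅ back q   ∎
    where open ~-Reasoning
  -- An edge leaving an odd vertex is the reverse of one leaving an even vertex, and `floor` applies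
  -- to the latter.
  S-edge true w {p} {q} e = begin
    (Ψ w ◅◅ T (co p) ◅◅ back p) ◅◅ e ◅ ε        ≡⟨ ◅◅-assoc (Ψ w) (T (co p) ◅◅ back p) (e ◅ ε) ⟩
    Ψ w ◅◅ (T (co p) ◅◅ back p) ◅◅ e ◅ ε        ≈⟨ ◅◅-congˡ (Ψ w) (◅◅-congʳ (e ◅ ε) step₁) ⟩
    Ψ w ◅◅ (inv (Ψ u) ◅◅ T q ◅◅ e⁻¹ ◅ ε) ◅◅ e ◅ ε
      ≡⟨ cong (Ψ w ◅◅_) (trans (◅◅-assoc (inv (Ψ u)) (T q ◅◅ e⁻¹ ◅ ε) (e ◅ ε))
           (cong (inv (Ψ u) ◅◅_) (◅◅-assoc (T q) (e⁻¹ ◅ ε) (e ◅ ε)))) ⟩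
    Ψ w ◅◅ inv (Ψ u) ◅◅ T q ◅◅ e⁻¹ ◅ e ◅ ε
      ≈⟨ ◅◅-congˡ (Ψ w) (◅◅-congˡ (inv (Ψ u)) (◅◅-congˡ (T q) (backtrackˡ e))) ⟩
    Ψ w ◅◅ inv (Ψ u) ◅◅ T q ◅◅ ε                ≡⟨ cong (λ γ → Ψ w ◅◅ inv (Ψ u) ◅◅ γ) (◅◅-identityʳ (T q)) ⟩
    Ψ w ◅◅ inv (Ψ u) ◅◅ T q                     ≡⟨ ◅◅-assoc (Ψ w) (inv (Ψ u)) (T q) ⟨
    (Ψ w ◅◅ inv (Ψ u)) ◅◅ T q                   ∎
    where
    open ~-Reasoning
    e⁻¹ = revEdge Rect e
    u = Ω (edgeFill e⁻¹)
    step₁ : T (co p) ◅◅ back p ~ inv (Ψ u) ◅◅ T q ◅◅ e⁻¹ ◅ ε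
    step₁ = moveˡ (Ψ u) (≃-sym (floor (edgeFill e⁻¹) e⁻¹ refl))

  S-cong : ∀ b {w w′} p → w ≈ w′ → S b w p ~ S b w′ p
  S-cong false p eq = ◅◅-congʳ (T p) (Ψ-cong eq)
  S-cong true  p eq = ◅◅-congʳ (T (co p) ◅◅ back p) (Ψ-cong eq)

  S-path : ∀ b w {p q} (γ : Path K p q) → S b w p ◅◅ γ ~ S (end b γ) (w ∙ Φ b γ) q
  S-path b w {p} ε = ≃-trans (≡⇒~ (◅◅-identityʳ (S b w p))) (S-cong b p (≈-sym (identityʳ w)))
  S-path b w {p} {q} (_◅_ {j = r} e γ) = begin
    S b w p ◅◅ e ◅ γ                                 ≡⟨ ◅◅-assoc (S b w p) (e ◅ ε) γ ⟨
    (S b w p ◅◅ e ◅ ε) ◅◅ γ                          ≈⟨ ◅◅-congʳ γ (S-edge b w e) ⟩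
    S (not b) (w ∙ weight b e) r ◅◅ γ                ≈⟨ S-path (not b) (w ∙ weight b e) γ ⟩
    S (end (not b) γ) (w ∙ weight b e ∙ Φ (not b) γ) q
      ≈⟨ S-cong (end (not b) γ) q (assoc w (weight b e) (Φ (not b) γ)) ⟩
    S (end (not b) γ) (w ∙ (weight b e ∙ Φ (not b) γ)) q   ∎
    where open ~-Reasoning

  -- Each edge multiplies the label of the canonical path by its weight, and at the end of an even
  -- loop `T` at `base` is trivial. Injectivity of Φ follows.
  Ψ-Φ : ∀ (γ : Path K base base) → end false γ ≡ false → γ ~ Ψ (Φ false γ)
  Ψ-Φ γ even = begin
    γ                                     ≈⟨ ◅◅-congʳ γ T-base ⟨
    T base ◅◅ γ                           ≈⟨ S-path false one γ ⟩
    S (end false γ) (one ∙ Φ false γ) base ≡⟨ cong (λ b → S b (one ∙ Φ false γ) base) even ⟩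
    Ψ (Φ false γ) ◅◅ T base               ≈⟨ ◅◅-congˡ (Ψ (Φ false γ)) T-base ⟩
    Ψ (Φ false γ) ◅◅ ε                    ≡⟨ ◅◅-identityʳ (Ψ (Φ false γ)) ⟩
    Ψ (Φ false γ)                         ∎
    where open ~-Reasoning

  -- `end≡` records that the length is even, which is what lets the weights multiply under
  -- concatenation. The record serves to compute Φ on the image of Ψ.
  record Value {p q} (γ : Path K p q) (w : Word (Symbol L)) : Set where
    constructor value
    field
      end≡ : ∀ b → end b γ ≡ b
      Φ≈   : Φ false γ ≈ w
  open Value

  Value-ε : ∀ {p} → Value {p} ε one
  Value-ε = value (λ b → refl) ≈-refl

  Value-≈ : ∀ {p q} {γ : Path K p q} {w w′} → w ≈ w′ → Value γ w → Value γ w′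
  Value-≈ eq v = value (end≡ v) (≈-trans (Φ≈ v) eq)

  Value-~ : ∀ {p q} {γ δ : Path K p q} {w} → γ ~ δ → Value γ w → Value δ w
  Value-~ eq v = value (λ b → trans (sym (end-cong b eq)) (end≡ v b)) (≈-trans (≈-sym (Φ-cong false eq)) (Φ≈ v))

  Value-◅◅ : ∀ {p q r} {γ : Path K p q} {δ : Path K q r} {w w′} → Value γ w → Value δ w′ → Value (γ ◅◅ δ) (w ∙ w′)
  Value-◅◅ {γ = γ} {δ} v v′ = value
    (λ b → trans (end-◅◅ b γ δ) (trans (cong (λ c → end c δ) (end≡ v b)) (end≡ v′ b)))
    (≈-trans (Φ-◅◅ false γ δ) (∙-cong (Φ≈ v) (≈-trans (≡⇒≈ (cong (λ b → Φ b δ) (end≡ v false))) (Φ≈ v′))))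

  Value-inv : ∀ {p q} {γ : Path K p q} {w} → Value γ w → Value (inv γ) (w ⁻¹)
  -- `inv` reverses the order of the edges and shifts their flags; uniqueness of inverses avoids
  -- following them.
  Value-inv {γ = γ} {w} v = value end-inv (W.inverseˡ-unique _ _ (begin
      Φ false (inv γ) ∙ w                        ≈⟨ ∙-congˡ (Φ≈ v) ⟨
      Φ false (inv γ) ∙ Φ false γ                ≡⟨ cong (λ b → Φ false (inv γ) ∙ Φ b γ) (end-inv false) ⟨
      Φ false (inv γ) ∙ Φ (end false (inv γ)) γ  ≈⟨ Φ-◅◅ false (inv γ) γ ⟨
      Φ false (inv γ ◅◅ γ)                       ≈⟨ Φ-cong false (inv-inverseˡ γ) ⟩
      one                                        ∎))
    where
    open W.≈-Reasoning
    end-inv : ∀ b → end b (inv γ) ≡ b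
    end-inv b = trans (sym (end≡ v (end b (inv γ))))
      (trans (sym (end-◅◅ b (inv γ) γ)) (end-cong b (inv-inverseˡ γ)))

  Value-add : ∀ {e p q} (x : Adds e p q) → Value (add x) (wt 0ℤ e (π p))
  Value-add {e} {p} {q} x = value not-involutive (begin
    Ω (edgeFill A) ∙ (Ω (edgeFill (revEdge Rect V)) ⁻¹ ∙ one)
      ≈⟨ ∙-cong (Ω-pairing (edgeFill A) (more x (done refl refl) refl) refl)
                (≈-trans (identityʳ _) (⁻¹-cong (Ω-pairing (edgeFill (revEdge Rect V)) (done refl refl) refl))) ⟩
    wt 0ℤ e (π p) ∙ one ∙ one ⁻¹   ≈⟨ ∙-cong (identityʳ _) W.ε⁻¹≈ε ⟩
    wt 0ℤ e (π p) ∙ one            ≈⟨ identityʳ _ ⟩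
    wt 0ℤ e (π p)                  ∎)
    where
    open W.≈-Reasoning
    A : Edge Rect p (co q)
    A = single x refl
    V : Edge Rect (co q) q
    V = full (sym (∁-involutive (squares q)))

  Value-mvD : ∀ b {e p q} (d : Dir b e p q) → Move e p q → Value (mvD b d) (wt 0ℤ e (π p))
  Value-mvD false d m = Value-add d
  Value-mvD true {e} {p} {q} d m = Value-≈ (≈-sym wt≈) (Value-inv (Value-add d))
    where
    wt≈ : wt 0ℤ e (π p) ≈ wt 0ℤ e (π q) ⁻¹
    wt≈ = ≈-trans (≡⇒≈ (cong (wt 0ℤ e) (moved (Move-sym m)))) (W.wt-toggle 0ℤ e (π q) (active (Move-sym m)))

  Value-mv : ∀ {e p q} (m : Move e p q) → Value (mv m) (wt 0ℤ e (π p))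
  Value-mv {e} {p} m = let s , _ , at = at-active m ; d = dir _ m at refl in
    subst (λ γ → Value γ (wt 0ℤ e (π p))) (sym (mv≡mvD _ m at refl d)) (Value-mvD (lookup (squares p) s) d m)

  -- `T` runs along flat hops, and these weigh 1.
  Value-T : ∀ p → Value (T p) one
  Value-T = T-inductive (λ γ → Value γ one) Value-ε
    (λ v v′ → Value-≈ (identityˡ one) (Value-◅◅ v v′))
    (λ v → Value-≈ W.ε⁻¹≈ε (Value-inv v))
    (λ {e} {p} m flat → Value-≈ (wt-flat 0ℤ e (π p) flat) (Value-mv m))

  Value-gen : ∀ x → Value (Ψ (gen x)) (gen x)
  Value-gen (a k k≢0 bound) = Value-~ (≃-sym loop~)
    (Value-≈ word≈ (Value-◅◅ (Value-◅◅ (Value-T p) (Value-mv m)) (Value-inv (Value-T q))))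
    where
    fit : Fits-L k
    -- The bound on the index gives 2|k| ≤ L - 1, and L ≥ 1 turns this into 2|k| + 1 ≤ L.
    fit = recompute (_ ℕ.≤? _) (subst (suc (abs k ℕ.+ abs k) ≤_)
      (ℕ.m+[n∸m]≡n {1} {L} (ℕ.≤-trans (s≤s z≤n) 3≤L)) (s≤s (half-+ bound)))
    l = slope k
    r = normalR k
    val = Valid-normal k fit
    p = plugOf (l ++ U ∷ r) val
    π-p : π p ≡ l ++ U ∷ r
    π-p = π-plugOf (l ++ U ∷ r) val
    e = lift l vert
    m = moveTo e p (subst (Active e) (sym π-p) (Active-lift l vert (U ∷ r) refl))
    q = target m
    loop~ : Ψ (gen (a k k≢0 bound)) ~ (T p ◅◅ mv m) ◅◅ inv (T q)
    -- `loopOf` is abstract, but `Rep-loopOf` at the normal form itself expresses it by a hop.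
    loop~ = moveʳ (T q) (≃-trans
      (≡⇒~ (cong (λ k → loopOf k ◅◅ T q) (sym (total-slope k)))) (≃-sym (Rep-loopOf l r val refl m π-p)))
    word≈ : one ∙ wt 0ℤ e (π p) ∙ one ⁻¹ ≈ gen (a k k≢0 bound)
    word≈ = begin
      one ∙ wt 0ℤ e (π p) ∙ one ⁻¹   ≈⟨ ∙-cong (identityˡ _) W.ε⁻¹≈ε ⟩
      wt 0ℤ e (π p) ∙ one            ≈⟨ identityʳ _ ⟩
      wt 0ℤ e (π p)                  ≡⟨ trans (cong (wt 0ℤ e) π-p) (wt-lift 0ℤ l vert (U ∷ r)) ⟩
      α (0ℤ +ᶻ total l)              ≡⟨ cong α (trans (ℤ.+-identityˡ (total l)) (total-slope k)) ⟩
      α k                            ≡⟨ W.α-index (a k k≢0 bound) ⟩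
      gen (a k k≢0 bound)            ∎
      where open W.≈-Reasoning

  Value-Ψ : ∀ w → Value (Ψ w) w
  Value-Ψ (gen x) = Value-gen x
  Value-Ψ one     = Value-ε
  Value-Ψ (x ∙ y) = Value-◅◅ (Value-Ψ x) (Value-Ψ y)
  Value-Ψ (x ⁻¹)  = Value-inv (Value-Ψ x)

  odd : Parity → Bool
  odd 0ℙ = false
  odd 1ℙ = true

  odd-injective : ∀ {x y} → odd x ≡ odd y → x ≡ y
  odd-injective {0ℙ} {0ℙ} _ = refl
  odd-injective {1ℙ} {1ℙ} _ = refl

  end-parity : ∀ {p q} (γ : Path K p q) → end false γ ≡ odd (lengthParity K γ)
  end-parity ε             = refl
  end-parity (e ◅ ε)       = refl
  end-parity (e ◅ e′ ◅ γ)  = end-parity γ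

  open GroupMorphisms (Group.rawGroup (evenDominoGroup Rect)) (Group.rawGroup (G⁺ L))

  isomorphism : evenDominoGroup Rect ≅ G⁺ L
  isomorphism = f , record
    { isGroupMonomorphism = record
      { isGroupHomomorphism = record
        { isMonoidHomomorphism = record
          { isMagmaHomomorphism = record
            { isRelHomomorphism = record { cong = Φ-cong false }
            ; homo = f-homo }
          ; ε-homo = ≈-refl }
        ; ⁻¹-homo = λ x → W.inverseˡ-unique _ _
            (≈-trans (≈-sym (f-homo (x ⁻¹ᴱ) x)) (Φ-cong false (Group.inverseˡ (π₁ K base) (proj₁ x)))) }
      ; injective = λ {x} {y} eq → ≃-trans (Ψ-Φ (proj₁ x) (even-end x))
          (≃-trans (Ψ-cong eq) (≃-sym (Ψ-Φ (proj₁ y) (even-end y)))) }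
    ; surjective = λ w → (Ψ w , odd-injective (trans (sym (end-parity (Ψ w))) (end≡ (Value-Ψ w) false))) ,
        λ {z} eq → ≈-trans (Φ-cong false eq) (Φ≈ (Value-Ψ w)) }
    where
    Even = Group.Carrier (evenDominoGroup Rect)
    _⁻¹ᴱ = Group._⁻¹ (evenDominoGroup Rect)
    f : Even → Word (Symbol L)
    f (γ , _) = Φ false γ
    even-end : (x : Even) → end false (proj₁ x) ≡ false
    even-end (γ , eq) = trans (end-parity γ) (cong odd eq)
    f-homo : ∀ x y → f (Group._∙_ (evenDominoGroup Rect) x y) ≈ f x ∙ f y
    f-homo x y = ≈-trans (Φ-◅◅ false (proj₁ x) (proj₁ y))
      (≡⇒≈ (cong (λ b → f x ∙ Φ b (proj₁ y)) (even-end x)))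

theorem2 : (L : ℕ) → 3 ≤ L → evenDominoGroup (rectangle L 2) ≅ G⁺ L
theorem2 = Isomorphism.isomorphism
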